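{- Let $a$ be an integer and let $n$ be a positive odd integer. Then, for an indeterminate $q$ (equivalently, for every complex number $q\neq 0,1$), $$\det\left[\left[\left\lfloor\frac{aj-(a+1)k}{n}\right\rfloor\right]_q\right]_{1\leqslant j,k\leqslant n}=-\left(\frac{a(a+1)}{n}\right)q^{(1-3n)/2}.$$
   Context: For an integer $m$, its $q$-analogue is $[m]_q=(1-q^m)/(1-q)$ (so $[m]_q=-q^m(1-q^{ -m})/(1-q)$ for negative $m$). $\lfloor x\rfloor$ denotes the largest integer not exceeding $x$. $\left(\frac{\cdot}{n}\right)$ denotes the Jacobi symbol modulo the positive odd integer $n$ (equal to $0$ when the argument is not coprime to $n$, and $\left(\frac{\cdot}{1}\right)=1$). -}

module Defs where

open import Algebra.Apartness.Bundles using (HeytingField; HeytingCommutativeRing)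
open import Algebra.Bundles using (CommutativeRing; Semiring)
open import Data.Fin.Base using (Fin; zero; suc; toℕ; punchIn)
open import Data.Fin.Properties using (any?)
open import Data.Integer.Base as ℤ using (ℤ; +_; -[1+_]; 0ℤ; 1ℤ; -1ℤ)
open import Data.Integer.Divisibility.Signed using (_∣?_)
open import Data.List.Base using (foldr; map)
open import Data.Nat.Base as ℕ using (ℕ; zero; suc)
open import Data.Nat.Primality.Factorisation using (factorise; factors)
open import Data.Product.Base using (proj₁)
open import Relation.Nullary.Decidable using (does)
open import Data.Bool.Base using (if_then_else_)
import Algebra.Definitions.RawSemiring as RawSemiringDefs

-- Meaningful for p an odd prime.
legendre : ℤ → ℕ → ℤ
legendre a p =
  if does (+ p ∣? a) then 0ℤ else
  if does (any? {n = p} λ x → + p ∣? (+ toℕ x ℤ.* + toℕ x ℤ.- a)) then 1ℤ else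
  -1ℤ

-- The product of the Legendre symbols over the prime factors of n, with
-- multiplicity.  Meaningful for n odd; the empty product gives (a/1) = 1.
jacobi : ℤ → (n : ℕ) → .{{ℕ.NonZero n}} → ℤ
jacobi a n = foldr ℤ._*_ 1ℤ (map (legendre a) (factors (factorise n)))

module Determinant {c ℓ} (R : CommutativeRing c ℓ) where
  open CommutativeRing R hiding (zero)
  open RawSemiringDefs (Semiring.rawSemiring semiring) using (_^_; sum)

  Matrix : ℕ → Set c
  Matrix n = Fin n → Fin n → Carrier

  minor : ∀ {n} → Matrix (suc n) → Fin (suc n) → Matrix n
  minor M k i j = M (suc i) (punchIn k j)

  -- Laplace expansion along the first row.
  det : ∀ {n} → Matrix n → Carrier
  det {zero}  M = 1#
  det {suc n} M = sum λ k → ((- 1#) ^ toℕ k * M zero k) * det (minor M k)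

module FieldOps {c ℓ₁ ℓ₂} (K : HeytingField c ℓ₁ ℓ₂) where
  open HeytingField K
  private
    R : CommutativeRing c ℓ₁
    R = HeytingCommutativeRing.commutativeRing heytingCommutativeRing
  open RawSemiringDefs (Semiring.rawSemiring (CommutativeRing.semiring R)) using (_×_) renaming (_^_ to _^ℕ_)
  open Determinant R public using (Matrix; det)

  fromℤ : ℤ → Carrier
  fromℤ (+ n)    = n × 1#
  fromℤ -[1+ n ] = - (suc n × 1#)

  -- The inverse of the difference x - y; so inv q#0 is the inverse of q - 0#.
  inv : ∀ {x y} → x # y → Carrier
  inv x#y = proj₁ (#⇒invertible x#y)

  pow : (q : Carrier) → q # 0# → ℤ → Carrier
  pow q q#0 (+ n)    = q ^ℕ n
  pow q q#0 -[1+ n ] = inv q#0 ^ℕ suc n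

  -- [m]_q = (1 - q^m) / (1 - q)
  qInt : (q : Carrier) → q # 0# → q # 1# → ℤ → Carrier
  qInt q q#0 q#1 m = (1# - pow q q#0 m) * inv (#-sym q#1)

{-# OPTIONS --safe #-}
module Submission where

-- Put Q = [q^⌊(aj - (a+1)k)/n⌋] and J = [1], so that the matrix is
-- (J - Q) / (1 - q).
--
-- If a prime p divides n and a, then in rows 1, 1 + n/p, 1 + 2n/p the
-- exponents form arithmetic progressions with a common difference, so these
-- rows are dependent; the same holds for columns if p divides n and a + 1.
-- The Jacobi symbol also vanishes in these cases.
--
-- Otherwise, dividing aj and (a+1)k by n with remainder shows that Q is, up to
-- scaling rows and columns by powers of q and permuting them by
-- multiplications modulo n, the matrix with 1 on and below the diagonal and
-- 1/q above it.  The permutations contribute (a(a+1)/n) by Zolotarev's lemma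
-- for the Jacobi symbol.  Next, let x(y) be the residue of (a+1)y/a modulo n.
-- The exponents e(y) = ((a+1)y - a x(y))/n for 0 ≤ y < n and e(n) = 1 give a
-- vector z = [q^e(k) - q^e(k-1)] with Q z = (1 - 1/q) 1 whose entries have
-- the telescoping sum q - 1.  Hence J - Q = - Q (I - z 1ᵀ / (1 - 1/q)),
-- whose last factor has determinant 1 - q.

-- The vector z comes from clearing the floors. As n divides (a+1)y - a x(y), multiplying column k
-- of Q by q^e(k) turns the exponents into ⌊a(j - x)/n⌋, and multiplying it by q^e(k-1) turns them
-- into ⌊(a(j - x) - 1)/n⌋, with x the representative that belongs to k or to k-1. In both families
-- x runs through all residues, so the two sums over k differ only where n divides a(j - x), that is
-- at x = j. Hence Q z is constant, and Q is never inverted.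
--
-- Signs are determinants of 0-1 matrices over the ground ring. They make sense for every self-map
-- of a finite set: for odd n, multiplication by a non-unit has sign 0, in agreement with the Jacobi
-- symbol, and composition is governed by `det-·`. As 1 = -1 may hold in the field, the symbol
-- cannot be read off from the sign; the relation `Represents` says instead that the sign is the
-- image of the symbol.
--
-- `det` is an expansion along the first row, from which alternation is visible in the columns only.
-- It is carried over to the rows by the uniqueness of alternating forms, which also yields
-- transposition, products and block matrices.

open import Defs
open import Algebra.Apartness.Bundles using (HeytingField; HeytingCommutativeRing)
open import Algebra.Bundles using (CommutativeRing)
import Algebra.Properties.CommutativeMonoid.Sum as CommutativeMonoidSum
import Algebra.Properties.CommutativeSemiring.Exp as CommutativeSemiringExp
import Algebra.Properties.Ring as RingProperties
import Algebra.Properties.Semiring.Exp as SemiringExp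
import Algebra.Properties.Semiring.Mult.TCOptimised as SemiringMult
import Algebra.Properties.Semiring.Sum as SemiringSum
import Algebra.Solver.Ring
import Algebra.Solver.Ring.AlmostCommutativeRing as ACR
open import Data.Bool.Base using (if_then_else_)
open import Data.Fin.Base as Fin using (Fin; zero; suc; toℕ; fromℕ; fromℕ<; inject₁; punchIn; punchOut; splitAt; _↑ˡ_; _↑ʳ_; combine; remQuot)
open import Data.Fin.Induction using (<-weakInduction)
open import Data.Fin.Permutation using (permutation)
import Data.Fin.Properties as Fin
open import Data.Integer.Base as ℤ using (ℤ; +_; -[1+_]; 0ℤ; 1ℤ; -1ℤ; _/ℕ_; _%ℕ_)
open import Data.Integer.DivMod using (n%ℕd<d; a≡a%ℕn+[a/ℕn]*n)
open import Data.Integer.Divisibility.Signed using (_∣_; divides; ∣⇒∣ᵤ; ∣ᵤ⇒∣; ∣m⇒∣m*n; _∣?_)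
import Data.Integer.Properties as ℤ
open import Data.Integer.Tactic.RingSolver using (solve-∀)
open import Data.List.Base using ([]; _∷_; foldr; map)
open import Data.List.Relation.Unary.All using (All; []; _∷_)
open import Data.Maybe.Base as Maybe using (Maybe)
open import Data.Nat.Base as ℕ using (ℕ; zero; suc; NonZero; _%_)
open import Data.Nat.Coprimality using (prime⇒coprime; coprime-Bézout)
import Data.Nat.Divisibility as ℕ
import Data.Nat.DivMod as ℕ
open import Data.Nat.GCD using (module Bézout)
import Data.Nat.ListAction as ℕ
open import Data.Nat.Primality using (Prime; euclidsLemma; prime⇒nonZero; ¬prime[1])
open import Data.Nat.Primality.Factorisation using (factorise; module PrimeFactorisation)
import Data.Nat.Properties as ℕ
open import Data.Product.Base using (∃-syntax; _×_; _,_; proj₁; proj₂; uncurry)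
open import Data.Sum.Base as Sum using (_⊎_; inj₁; inj₂)
open import Data.Vec.Functional using (Vector; tail; updateAt; insertAt) renaming (_∷_ to _◂_)
open import Data.Vec.Functional.Properties using (updateAt-updates; updateAt-minimal; updateAt-commutes; insertAt-lookup; insertAt-punchIn)
open import Function.Base using (_∘_; id; const; flip)
open import Level using (Level; _⊔_)
open import Relation.Binary.Definitions using (tri<; tri≈; tri>)
open import Relation.Binary.PropositionalEquality.Core as ≡ using (_≡_; _≢_)
open import Relation.Binary.PropositionalEquality.Properties using (module ≡-Reasoning)
import Relation.Binary.Reasoning.Setoid as SetoidReasoning
open import Relation.Nullary.Decidable using (Dec; does; yes; no; ¬?; decidable-stable; dec⇒maybe)
open import Relation.Nullary.Negation using (contradiction; ¬_)

open CommutativeMonoidSum ℕ.+-0-commutativeMonoid using () renaming (sum to sumℕ; sum-cong-≗ to sumℕ-cong; ∑-distrib-+ to sumℕ-+)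
open CommutativeMonoidSum ℤ.+-0-commutativeMonoid using () renaming (sum to sumℤ; sum-cong-≗ to sumℤ-cong; ∑-distrib-+ to sumℤ-+; sum-permute to sumℤ-permute)

-- A ring solver for commutative rings, with integer coefficients

module IntegerCoefficientSolver {c ℓ} (R : CommutativeRing c ℓ) where
  open CommutativeRing R hiding (zero)
  -- With the optimised multiple, `1 ⋆ 1#` computes to `1#`; hence `con (+ 1)` denotes `1#` itself,
  -- and 0 and 1 are preserved by `refl`.
  open SemiringMult semiring renaming (_×_ to _⋆_)
  open RingProperties ring
  open SetoidReasoning setoid

  ⟦_⟧ℤ : ℤ → Carrier
  ⟦ + n ⟧ℤ    = n ⋆ 1#
  ⟦ -[1+ n ] ⟧ℤ = - (suc n ⋆ 1#)

  private
    cancel : ∀ x y z → (x + y) - (x + z) ≈ y - z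
    cancel x y z = begin
      (x + y) - (x + z)       ≈⟨ +-cong (+-comm x y) (sym (-‿+-comm x z)) ⟩
      (y + x) + (- x + - z)   ≈⟨ +-assoc y x _ ⟩
      y + (x + (- x + - z))   ≈⟨ +-congˡ (sym (+-assoc x (- x) (- z))) ⟩
      y + ((x + - x) + - z)   ≈⟨ +-congˡ (+-congʳ (-‿inverseʳ x)) ⟩
      y + (0# + - z)          ≈⟨ +-congˡ (+-identityˡ _) ⟩
      y - z                   ∎

  neg-homo : ∀ i → ⟦ ℤ.- i ⟧ℤ ≈ - ⟦ i ⟧ℤ
  neg-homo (+ zero)   = sym -0#≈0#
  neg-homo (+ suc n)  = refl
  neg-homo -[1+ n ]   = sym (-‿involutive _)

  ⊖-homo : ∀ m n → ⟦ m ℤ.⊖ n ⟧ℤ ≈ m ⋆ 1# - n ⋆ 1#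
  ⊖-homo m zero = sym (trans (+-congˡ -0#≈0#) (+-identityʳ _))
  ⊖-homo zero (suc n) = sym (+-identityˡ _)
  ⊖-homo (suc m) (suc n) = begin
    ⟦ suc m ℤ.⊖ suc n ⟧ℤ     ≡⟨ ≡.cong ⟦_⟧ℤ (ℤ.[1+m]⊖[1+n]≡m⊖n m n) ⟩
    ⟦ m ℤ.⊖ n ⟧ℤ             ≈⟨ ⊖-homo m n ⟩
    m ⋆ 1# - n ⋆ 1#         ≈⟨ cancel 1# _ _ ⟨
    (1# + m ⋆ 1#) - (1# + n ⋆ 1#) ≈⟨ +-cong (1+× m 1#) (-‿cong (1+× n 1#)) ⟨
    suc m ⋆ 1# - suc n ⋆ 1# ∎

  +-homo : ∀ i j → ⟦ i ℤ.+ j ⟧ℤ ≈ ⟦ i ⟧ℤ + ⟦ j ⟧ℤ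
  +-homo (+ m)    (+ n)    = ×-homo-+ 1# m n
  +-homo (+ m)    -[1+ n ] = ⊖-homo m (suc n)
  +-homo -[1+ m ] (+ n)    = trans (⊖-homo n (suc m)) (+-comm _ _)
  +-homo -[1+ m ] -[1+ n ] = begin
    - (suc (suc (m ℕ.+ n)) ⋆ 1#)     ≡⟨ ≡.cong (λ k → - (suc k ⋆ 1#)) (ℕ.+-suc m n) ⟨
    - ((suc m ℕ.+ suc n) ⋆ 1#)       ≈⟨ -‿cong (×-homo-+ 1# (suc m) (suc n)) ⟩
    - (suc m ⋆ 1# + suc n ⋆ 1#)      ≈⟨ sym (-‿+-comm _ _) ⟩
    - (suc m ⋆ 1#) + - (suc n ⋆ 1#)  ∎

  private
    *-homo-pos : ∀ m i → ⟦ + m ℤ.* i ⟧ℤ ≈ ⟦ + m ⟧ℤ * ⟦ i ⟧ℤ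
    *-homo-pos zero    i = sym (zeroˡ _)
    *-homo-pos (suc m) i = begin
      ⟦ + suc m ℤ.* i ⟧ℤ                ≡⟨ ≡.cong ⟦_⟧ℤ (ℤ.suc-* (+ m) i) ⟩
      ⟦ i ℤ.+ + m ℤ.* i ⟧ℤ              ≈⟨ +-homo i (+ m ℤ.* i) ⟩
      ⟦ i ⟧ℤ + ⟦ + m ℤ.* i ⟧ℤ           ≈⟨ +-cong (sym (*-identityˡ _)) (*-homo-pos m i) ⟩
      1# * ⟦ i ⟧ℤ + ⟦ + m ⟧ℤ * ⟦ i ⟧ℤ   ≈⟨ distribʳ _ _ _ ⟨
      (1# + ⟦ + m ⟧ℤ) * ⟦ i ⟧ℤ          ≈⟨ *-congʳ (1+× m 1#) ⟨
      ⟦ + suc m ⟧ℤ * ⟦ i ⟧ℤ             ∎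

  *-homo : ∀ i j → ⟦ i ℤ.* j ⟧ℤ ≈ ⟦ i ⟧ℤ * ⟦ j ⟧ℤ
  *-homo (+ m)    j = *-homo-pos m j
  *-homo -[1+ m ] j = begin
    ⟦ -[1+ m ] ℤ.* j ⟧ℤ           ≡⟨ ≡.cong ⟦_⟧ℤ (ℤ.neg-distribˡ-* (+ suc m) j) ⟨
    ⟦ ℤ.- (+ suc m ℤ.* j) ⟧ℤ      ≈⟨ neg-homo (+ suc m ℤ.* j) ⟩
    - ⟦ + suc m ℤ.* j ⟧ℤ          ≈⟨ -‿cong (*-homo-pos (suc m) j) ⟩
    - (⟦ + suc m ⟧ℤ * ⟦ j ⟧ℤ)     ≈⟨ -‿distribˡ-* _ _ ⟩
    ⟦ -[1+ m ] ⟧ℤ * ⟦ j ⟧ℤ        ∎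

  private
    ⟦⟧ℤ-homomorphism : ℤ.+-*-rawRing ACR.-Raw-AlmostCommutative⟶ ACR.fromCommutativeRing R
    ⟦⟧ℤ-homomorphism = record
      { ⟦_⟧    = ⟦_⟧ℤ
      ; +-homo = +-homo
      ; *-homo = *-homo
      ; -‿homo = neg-homo
      ; 0-homo = refl
      ; 1-homo = refl
      }

    -- Equality in `R` is undecided, and distinct integers may have equal images, so only a positive
    -- answer can be given. It is enough for integer coefficients to cancel.
    ⟦⟧ℤ-≟ : ∀ i j → Maybe (⟦ i ⟧ℤ ≈ ⟦ j ⟧ℤ)
    ⟦⟧ℤ-≟ i j = Maybe.map (λ eq → reflexive (≡.cong ⟦_⟧ℤ eq)) (dec⇒maybe (i ℤ.≟ j))

  open Algebra.Solver.Ring ℤ.+-*-rawRing (ACR.fromCommutativeRing R) ⟦⟧ℤ-homomorphism ⟦⟧ℤ-≟ public using (solve; _:=_; _:+_; _:*_; _:-_; :-_; con)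

-- Determinants and alternating forms

punchIn-inject₁-self : ∀ {n} (k : Fin n) → punchIn (inject₁ k) k ≡ suc k
punchIn-inject₁-self zero    = ≡.refl
punchIn-inject₁-self (suc k) = ≡.cong suc (punchIn-inject₁-self k)

punchIn-suc-self : ∀ {n} (k : Fin n) → punchIn (suc k) k ≡ inject₁ k
punchIn-suc-self zero    = ≡.refl
punchIn-suc-self (suc k) = ≡.cong suc (punchIn-suc-self k)

punchIn-inject₁-suc : ∀ {n} (k i : Fin n) → i ≢ k → punchIn (inject₁ k) i ≡ punchIn (suc k) i
punchIn-inject₁-suc zero    zero    i≢k = contradiction ≡.refl i≢k
punchIn-inject₁-suc zero    (suc i) i≢k = ≡.refl
punchIn-inject₁-suc (suc k) zero    i≢k = ≡.refl
punchIn-inject₁-suc (suc k) (suc i) i≢k = ≡.cong suc (punchIn-inject₁-suc k i (i≢k ∘ ≡.cong suc))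

punchIn-elim : ∀ {n p} (k : Fin (suc n)) (P : Fin (suc n) → Set p) →
               P k → (∀ j → P (punchIn k j)) → ∀ j → P j
punchIn-elim k P Pk Pp j with k Fin.≟ j
... | yes ≡.refl = Pk
... | no  k≢j    = ≡.subst P (Fin.punchIn-punchOut k≢j) (Pp (punchOut k≢j))

-- Deleting column `k` removes one of two neighbouring columns or leaves them neighbours; this is
-- the case split behind `det-adjacentᶜ`.
punchIn-adjacent : ∀ {n} (i : Fin (suc n)) (k : Fin (suc (suc n))) →
                   k ≡ inject₁ i ⊎ k ≡ suc i ⊎
                   (∃[ l ] punchIn k (inject₁ l) ≡ inject₁ i × punchIn k (suc l) ≡ suc i)
punchIn-adjacent         zero    zero          = inj₁ ≡.refl
punchIn-adjacent         zero    (suc zero)    = inj₂ (inj₁ ≡.refl)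
punchIn-adjacent {suc n} zero    (suc (suc k)) = inj₂ (inj₂ (zero , ≡.refl , ≡.refl))
punchIn-adjacent         (suc i) zero          = inj₂ (inj₂ (i , ≡.refl , ≡.refl))
punchIn-adjacent {suc n} (suc i) (suc k) with punchIn-adjacent i k
... | inj₁ eq                    = inj₁ (≡.cong suc eq)
... | inj₂ (inj₁ eq)             = inj₂ (inj₁ (≡.cong suc eq))
... | inj₂ (inj₂ (l , eq , eq′)) = inj₂ (inj₂ (suc l , ≡.cong suc eq , ≡.cong suc eq′))

module Determinants {c ℓ} (R : CommutativeRing c ℓ) where
  open CommutativeRing R hiding (zero)
  open Determinant R public
  open RingProperties ring
  open SemiringSum semiring public
  open CommutativeMonoidSum *-commutativeMonoid public using () renaming (sum to product; sum-cong-≋ to product-cong)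
  open SemiringExp semiring public using (_^_; ^-congˡ)
  open IntegerCoefficientSolver R public using (solve; _:=_; _:+_; _:*_; _:-_; :-_; con)
  open SetoidReasoning setoid

  -- Rectangular, because fixing the first row of a square matrix leaves a form in `n` rows of
  -- length `suc n`.
  Rows : ℕ → ℕ → Set c
  Rows n m = Fin n → Fin m → Carrier

  sum-cong : ∀ {n} {f g : Vector Carrier n} → (∀ i → f i ≈ g i) → sum f ≈ sum g
  sum-cong = sum-cong-≋

  sum-zero : ∀ {n} {f : Vector Carrier n} → (∀ i → f i ≈ 0#) → sum f ≈ 0#
  sum-zero {n} f≈0 = trans (sum-cong f≈0) (sum-replicate-zero n)

  sum-linear : ∀ {n} s t (f g : Vector Carrier n) →
               sum (λ i → s * f i + t * g i) ≈ s * sum f + t * sum g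
  sum-linear s t f g = trans (∑-distrib-+ (λ i → s * f i) (λ i → t * g i)) (+-cong (sym (*-distribˡ-sum s f)) (sym (*-distribˡ-sum t g)))

  sum-adjacent : ∀ {n} (i : Fin n) (f : Vector Carrier (suc n)) →
                 (∀ k → k ≢ inject₁ i → k ≢ suc i → f k ≈ 0#) →
                 sum f ≈ f (inject₁ i) + f (suc i)
  sum-adjacent zero    f f≈0 = +-congˡ (trans (+-congˡ (sum-zero λ k → f≈0 (suc (suc k)) (λ ()) (λ ()))) (+-identityʳ _))
  sum-adjacent (suc i) f f≈0 = trans
    (+-cong (f≈0 zero (λ ()) (λ ()))
            (sum-adjacent i (f ∘ suc) λ k k≢ k≢′ → f≈0 (suc k) (k≢ ∘ Fin.suc-injective) (k≢′ ∘ Fin.suc-injective)))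
    (+-identityˡ _)

  δ : ∀ {n} → Fin n → Fin n → Carrier
  δ zero    zero    = 1#
  δ zero    (suc j) = 0#
  δ (suc i) zero    = 0#
  δ (suc i) (suc j) = δ i j

  δ-refl : ∀ {n} (i : Fin n) → δ i i ≡ 1#
  δ-refl zero    = ≡.refl
  δ-refl (suc i) = δ-refl i

  δ-≢ : ∀ {n} {i j : Fin n} → i ≢ j → δ i j ≡ 0#
  δ-≢ {i = zero}  {zero}  i≢j = contradiction ≡.refl i≢j
  δ-≢ {i = zero}  {suc j} i≢j = ≡.refl
  δ-≢ {i = suc i} {zero}  i≢j = ≡.refl
  δ-≢ {i = suc i} {suc j} i≢j = δ-≢ (i≢j ∘ ≡.cong suc)

  δ-sym : ∀ {n} (i j : Fin n) → δ i j ≡ δ j i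
  δ-sym zero    zero    = ≡.refl
  δ-sym zero    (suc j) = ≡.refl
  δ-sym (suc i) zero    = ≡.refl
  δ-sym (suc i) (suc j) = δ-sym i j

  sum-δˡ : ∀ {n} (i : Fin n) (f : Vector Carrier n) → sum (λ k → δ i k * f k) ≈ f i
  sum-δˡ zero    f = trans (+-cong (*-identityˡ _) (sum-zero {f = λ k → 0# * f (suc k)} λ k → zeroˡ _)) (+-identityʳ _)
  sum-δˡ (suc i) f = trans (+-cong (zeroˡ _) (sum-δˡ i (f ∘ suc))) (+-identityˡ _)

  sum-δʳ : ∀ {n} (i : Fin n) (f : Vector Carrier n) → sum (λ k → f k * δ k i) ≈ f i
  sum-δʳ i f = trans (sum-cong λ k → trans (*-congˡ (reflexive (δ-sym k i))) (*-comm _ _)) (sum-δˡ i f)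

  -- `linear` compares three arrays that agree outside row `r`, instead of updates of a single
  -- array, so that it applies without extensionality to matrices given by formulas.
  record Multilinear {n m} (F : Rows n m → Carrier) : Set (c ⊔ ℓ) where
    field
      cong   : ∀ {A B} → (∀ i j → A i j ≈ B i j) → F A ≈ F B
      linear : ∀ r s t {A B C} →
               (∀ i → i ≢ r → ∀ j → A i j ≈ B i j) →
               (∀ i → i ≢ r → ∀ j → A i j ≈ C i j) →
               (∀ j → A r j ≈ s * B r j + t * C r j) →
               F A ≈ s * F B + t * F C

  AlternatesAt : ∀ {n m} → (Rows n m → Carrier) → (r r′ : Fin n) → Set (c ⊔ ℓ)
  AlternatesAt F r r′ = ∀ {A} → (∀ j → A r j ≈ A r′ j) → F A ≈ 0#

  record Alternating {n m} (F : Rows n m → Carrier) : Set (c ⊔ ℓ) where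
    field
      multilinear : Multilinear F
      alternates  : ∀ {r r′} → r ≢ r′ → AlternatesAt F r r′
    open Multilinear multilinear public

  _[_↦_] : ∀ {n m} → Rows n m → Fin n → Vector Carrier m → Rows n m
  A [ r ↦ v ] = updateAt A r (const v)

  module _ {n m} {A : Rows n m} {v : Vector Carrier m} where
    ↦-at : ∀ r j → (A [ r ↦ v ]) r j ≈ v j
    ↦-at r j = reflexive (≡.cong (λ w → w j) (updateAt-updates r A))

    ↦-off : ∀ {r} i → i ≢ r → ∀ j → (A [ r ↦ v ]) i j ≈ A i j
    ↦-off {r} i i≢r j = reflexive (≡.cong (λ w → w j) (updateAt-minimal i r A i≢r))

  module _ {n m} {F : Rows n m → Carrier} (ml : Multilinear F) where
    open Multilinear ml

    ↦-linear : ∀ A r s t x y → F (A [ r ↦ (λ j → s * x j + t * y j) ]) ≈ s * F (A [ r ↦ x ]) + t * F (A [ r ↦ y ])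
    ↦-linear A r s t x y = linear r s t
      (λ i i≢r j → trans (↦-off i i≢r j) (sym (↦-off i i≢r j)))
      (λ i i≢r j → trans (↦-off i i≢r j) (sym (↦-off i i≢r j)))
      (λ j → trans (↦-at r j) (sym (+-cong (*-congˡ (↦-at r j)) (*-congˡ (↦-at r j)))))

    ↦-id : ∀ A r {v} → (∀ j → v j ≈ A r j) → F (A [ r ↦ v ]) ≈ F A
    ↦-id A r {v} v≈ = cong λ i j → helper i j
      where
      helper : ∀ i j → (A [ r ↦ v ]) i j ≈ A i j
      helper i j with i Fin.≟ r
      ... | yes ≡.refl = trans (↦-at i j) (v≈ j)
      ... | no  i≢r    = ↦-off i i≢r j

    ↦-sum : ∀ A r {k} (s : Vector Carrier k) (V : Rows k m) →
            F (A [ r ↦ (λ j → sum (λ i → s i * V i j)) ]) ≈ sum (λ i → s i * F (A [ r ↦ V i ]))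
    ↦-sum A r {zero} s V = trans
      (linear r 0# 0# {C = A [ r ↦ (λ j → 0#) ]} (λ _ _ _ → refl) (λ _ _ _ → refl)
        (λ j → trans (↦-at r j) (sym (trans (+-cong (zeroˡ _) (zeroˡ _)) (+-identityˡ _)))))
      (trans (+-cong (zeroˡ _) (zeroˡ _)) (+-identityˡ _))
    ↦-sum A r {suc k} s V = begin
      F (A [ r ↦ (λ j → s zero * V zero j + rest j) ])
        ≈⟨ cong (λ i j → helper i j) ⟩
      F (A [ r ↦ (λ j → s zero * V zero j + 1# * rest j) ])
        ≈⟨ ↦-linear A r (s zero) 1# (V zero) rest ⟩
      s zero * F (A [ r ↦ V zero ]) + 1# * F (A [ r ↦ rest ])
        ≈⟨ +-congˡ (trans (*-identityˡ _) (↦-sum A r (tail s) (tail V))) ⟩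
      s zero * F (A [ r ↦ V zero ]) + sum (λ i → s (suc i) * F (A [ r ↦ V (suc i) ])) ∎
      where
      rest : Vector Carrier m
      rest j = sum (λ i → s (suc i) * V (suc i) j)
      helper : ∀ i j → (A [ r ↦ (λ j → s zero * V zero j + rest j) ]) i j ≈
                       (A [ r ↦ (λ j → s zero * V zero j + 1# * rest j) ]) i j
      helper i j with i Fin.≟ r
      ... | yes ≡.refl = trans (↦-at i j) (trans (+-congˡ (sym (*-identityˡ _))) (sym (↦-at i j)))
      ... | no  i≢r    = trans (↦-off i i≢r j) (sym (↦-off i i≢r j))

    -- Polarisation: expand the form with x + y in both rows. Alternation is assumed at this one
    -- pair only, since `adjacent⇒alternating` applies the lemma before the other pairs are known.
    swap : ∀ {r r′} → r ≢ r′ → AlternatesAt F r r′ → ∀ {A B} →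
           (∀ j → A r j ≈ B r′ j) → (∀ j → A r′ j ≈ B r j) →
           (∀ i → i ≢ r → i ≢ r′ → ∀ j → A i j ≈ B i j) → F A ≈ - F B
    swap {r} {r′} r≢r′ alt {A} {B} Ar Ar′ Ai = begin
      F A              ≈⟨ FA≈ ⟩
      H x y            ≈⟨ solve 2 (λ u v → u := (u :+ v) :- v) refl (H x y) (H y x) ⟩
      (H x y + H y x) - H y x  ≈⟨ +-congʳ Hxy+Hyx≈0 ⟩
      0# - H y x       ≈⟨ +-identityˡ _ ⟩
      - H y x          ≈⟨ -‿cong FB≈ ⟨
      - F B            ∎
      where
      x y x+y : Vector Carrier m
      x = A r
      y = A r′
      x+y j = 1# * x j + 1# * y j

      H : Vector Carrier m → Vector Carrier m → Carrier
      H u v = F ((A [ r ↦ u ]) [ r′ ↦ v ])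

      H-swap : ∀ u v → H u v ≈ F ((A [ r′ ↦ v ]) [ r ↦ u ])
      H-swap u v = cong λ i j → reflexive (≡.cong (λ w → w j) (updateAt-commutes r′ r (r≢r′ ∘ ≡.sym) A i))

      H-alt : ∀ u → H u u ≈ 0#
      H-alt u = alt λ j → trans (↦-off r r≢r′ j) (trans (↦-at r j) (sym (↦-at r′ j)))

      H-+ʳ : ∀ u → H u x+y ≈ H u x + H u y
      H-+ʳ u = trans (↦-linear _ r′ 1# 1# x y) (+-cong (*-identityˡ _) (*-identityˡ _))

      H-+ˡ : ∀ u → H x+y u ≈ H x u + H y u
      H-+ˡ u = trans (H-swap _ _) (trans (↦-linear _ r 1# 1# x y)
        (+-cong (trans (*-identityˡ _) (sym (H-swap _ _))) (trans (*-identityˡ _) (sym (H-swap _ _)))))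

      Hxy+Hyx≈0 : H x y + H y x ≈ 0#
      Hxy+Hyx≈0 = begin
        H x y + H y x
          ≈⟨ solve 2 (λ u v → u :+ v := (con (+ 0) :+ v) :+ (u :+ con (+ 0))) refl (H x y) (H y x) ⟩
        (0# + H y x) + (H x y + 0#)       ≈⟨ +-cong (+-congʳ (H-alt x)) (+-congˡ (H-alt y)) ⟨
        (H x x + H y x) + (H x y + H y y) ≈⟨ +-cong (H-+ˡ x) (H-+ˡ y) ⟨
        H x+y x + H x+y y                 ≈⟨ H-+ʳ x+y ⟨
        H x+y x+y                         ≈⟨ H-alt x+y ⟩
        0#                                ∎

      FA≈ : F A ≈ H x y
      FA≈ = sym (trans (↦-id _ r′ (λ j → sym (↦-off r′ (r≢r′ ∘ ≡.sym) j))) (↦-id A r λ j → refl))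

      FB≈ : F B ≈ H y x
      FB≈ = cong B≈
        where
        B≈ : ∀ i j → B i j ≈ ((A [ r ↦ y ]) [ r′ ↦ x ]) i j
        B≈ i j with i Fin.≟ r′ | i Fin.≟ r
        ... | yes ≡.refl | _          = trans (sym (Ar j)) (sym (↦-at i j))
        ... | no  i≢r′   | yes ≡.refl = trans (sym (Ar′ j)) (sym (trans (↦-off i i≢r′ j) (↦-at i j)))
        ... | no  i≢r′   | no  i≢r    = trans (sym (Ai i i≢r i≢r′ j)) (sym (trans (↦-off i i≢r′ j) (↦-off i i≢r j)))

  -- By induction on the lower of the two equal rows: exchanging it with the row just above costs a
  -- sign and brings the equal rows one step closer.
  adjacent⇒alternating : ∀ {n m} {F : Rows (suc n) m → Carrier} → Multilinear F →
                         (∀ i → AlternatesAt F (inject₁ i) (suc i)) → Alternating F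
  adjacent⇒alternating {n} {m} {F} ml adjacent = record { multilinear = ml ; alternates = alternates }
    where
    below : ∀ r′ r → r Fin.< r′ → AlternatesAt F r r′
    below = <-weakInduction _ (λ r ()) step
      where
      step : ∀ i → (∀ r → r Fin.< inject₁ i → AlternatesAt F r (inject₁ i)) →
             ∀ r → r Fin.< suc i → AlternatesAt F r (suc i)
      step i ih r r<1+i {A} eq with r Fin.≟ inject₁ i
      ... | yes ≡.refl = adjacent i eq
      ... | no  r≢i    = trans (swap ml i≢1+i (adjacent i) A≈ A≈′ A≈″)
                               (trans (-‿cong (ih r r<i B≈)) -0#≈0#)
        where
        i≢1+i : inject₁ i ≢ suc i
        i≢1+i e = ℕ.<⇒≢ (ℕ.n<1+n (toℕ i)) (≡.trans (≡.sym (Fin.toℕ-inject₁ i)) (≡.cong toℕ e))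
        r<i : r Fin.< inject₁ i
        r<i = ℕ.≤∧≢⇒< (≡.subst (toℕ r ℕ.≤_) (≡.sym (Fin.toℕ-inject₁ i)) (ℕ.s≤s⁻¹ r<1+i)) (r≢i ∘ Fin.toℕ-injective)
        r≢1+i : r ≢ suc i
        r≢1+i e = ℕ.<⇒≢ r<1+i (≡.cong toℕ e)
        B : Rows (suc n) m
        B = (A [ inject₁ i ↦ A (suc i) ]) [ suc i ↦ A (inject₁ i) ]
        A≈ : ∀ j → A (inject₁ i) j ≈ B (suc i) j
        A≈ j = sym (↦-at {A = A [ inject₁ i ↦ A (suc i) ]} (suc i) j)
        A≈′ : ∀ j → A (suc i) j ≈ B (inject₁ i) j
        A≈′ j = sym (trans (↦-off {A = A [ inject₁ i ↦ A (suc i) ]} _ i≢1+i j) (↦-at (inject₁ i) j))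
        A≈″ : ∀ k → k ≢ inject₁ i → k ≢ suc i → ∀ j → A k j ≈ B k j
        A≈″ k k≢ k≢′ j = sym (trans (↦-off {A = A [ inject₁ i ↦ A (suc i) ]} k k≢′ j) (↦-off k k≢ j))
        B≈ : ∀ j → B r j ≈ B (inject₁ i) j
        B≈ j = trans (sym (A≈″ r r≢i r≢1+i j)) (trans (eq j) (A≈′ j))

    alternates : ∀ {r r′} → r ≢ r′ → AlternatesAt F r r′
    alternates {r} {r′} r≢r′ eq with Fin.<-cmp r r′
    ... | tri< r<r′ _ _ = below r′ r r<r′ eq
    ... | tri≈ _ r≡r′ _ = contradiction r≡r′ r≢r′
    ... | tri> _ _ r′<r = below r r′ r′<r (λ j → sym (eq j))

  -- The determinant as an alternating form in the columns.

  det-cong : ∀ {n} {A B : Matrix n} → (∀ i j → A i j ≈ B i j) → det A ≈ det B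
  det-cong {zero}  A≈B = refl
  det-cong {suc n} A≈B = sum-cong λ k → *-cong (*-congˡ {(- 1#) ^ toℕ k} (A≈B zero k)) (det-cong λ i j → A≈B (suc i) (punchIn k j))

  transpose : ∀ {n} → Matrix n → Matrix n
  transpose = flip

  -- In the expansion along the first row, term `k` meets column `r` either as its entry, if `k` is
  -- `r` and the minor does not contain the column, or inside the minor, where induction applies.
  det-linearᶜ : ∀ {n} (r : Fin n) s t {A B C : Matrix n} →
                (∀ j → j ≢ r → ∀ i → A i j ≈ B i j) →
                (∀ j → j ≢ r → ∀ i → A i j ≈ C i j) →
                (∀ i → A i r ≈ s * B i r + t * C i r) →
                det A ≈ s * det B + t * det C
  det-linearᶜ {suc n} r s t {A} {B} {C} A≈B A≈C A≈ = trans (sum-cong term) (sum-linear s t (laplace B) (laplace C))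
    where
    laplace : Matrix (suc n) → Vector Carrier (suc n)
    laplace M k = ((- 1#) ^ toℕ k * M zero k) * det (minor M k)
    term : ∀ k → ((- 1#) ^ toℕ k * A zero k) * det (minor A k) ≈
                 s * (((- 1#) ^ toℕ k * B zero k) * det (minor B k)) +
                 t * (((- 1#) ^ toℕ k * C zero k) * det (minor C k))
    term k with k Fin.≟ r
    ... | yes ≡.refl = begin
      ((- 1#) ^ toℕ k * A zero k) * det (minor A k)
        ≈⟨ *-congʳ (*-congˡ (A≈ zero)) ⟩
      ((- 1#) ^ toℕ k * (s * B zero k + t * C zero k)) * det (minor A k)
        ≈⟨ solve 6 (λ e s b t c d → (e :* (s :* b :+ t :* c)) :* d := s :* ((e :* b) :* d) :+ t :* ((e :* c) :* d))
                 refl _ s _ t _ _ ⟩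
      s * (((- 1#) ^ toℕ k * B zero k) * det (minor A k)) +
      t * (((- 1#) ^ toℕ k * C zero k) * det (minor A k))
        ≈⟨ +-cong (*-congˡ (*-congˡ (det-cong λ i j → A≈B _ (Fin.punchInᵢ≢i k j) (suc i))))
                  (*-congˡ (*-congˡ (det-cong λ i j → A≈C _ (Fin.punchInᵢ≢i k j) (suc i)))) ⟩
      s * (((- 1#) ^ toℕ k * B zero k) * det (minor B k)) +
      t * (((- 1#) ^ toℕ k * C zero k) * det (minor C k)) ∎
    ... | no k≢r = begin
      ((- 1#) ^ toℕ k * A zero k) * det (minor A k)
        ≈⟨ *-congˡ (det-linearᶜ (punchOut k≢r) s t (λ j j≢ i → A≈B _ (punchIn-≢ j≢) (suc i)) (λ j j≢ i → A≈C _ (punchIn-≢ j≢) (suc i)) minor≈) ⟩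
      ((- 1#) ^ toℕ k * A zero k) * (s * det (minor B k) + t * det (minor C k))
        ≈⟨ solve 6 (λ e a s b t c → (e :* a) :* (s :* b :+ t :* c) := s :* ((e :* a) :* b) :+ t :* ((e :* a) :* c))
                 refl _ _ s _ t _ ⟩
      s * (((- 1#) ^ toℕ k * A zero k) * det (minor B k)) +
      t * (((- 1#) ^ toℕ k * A zero k) * det (minor C k))
        ≈⟨ +-cong (*-congˡ (*-congʳ (*-congˡ (A≈B k k≢r zero)))) (*-congˡ (*-congʳ (*-congˡ (A≈C k k≢r zero)))) ⟩
      s * (((- 1#) ^ toℕ k * B zero k) * det (minor B k)) +
      t * (((- 1#) ^ toℕ k * C zero k) * det (minor C k)) ∎
      where
      punchIn-≢ : ∀ {j} → j ≢ punchOut k≢r → punchIn k j ≢ r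
      punchIn-≢ {j} j≢ e = j≢ (Fin.punchIn-injective k _ _ (≡.trans e (≡.sym (Fin.punchIn-punchOut k≢r))))
      minor≈ : ∀ i → minor A k i (punchOut k≢r) ≈ s * minor B k i (punchOut k≢r) + t * minor C k i (punchOut k≢r)
      minor≈ i = ≡.subst (λ l → A (suc i) l ≈ s * B (suc i) l + t * C (suc i) l) (≡.sym (Fin.punchIn-punchOut k≢r)) (A≈ (suc i))

  -- Only the terms that delete one of the two equal columns survive. Their minors agree and their
  -- signs are opposite.
  det-adjacentᶜ : ∀ {n} (i : Fin n) {A : Matrix (suc n)} →
                  (∀ r → A r (inject₁ i) ≈ A r (suc i)) → det A ≈ 0#
  det-adjacentᶜ {suc n} i {A} eq = begin
    det A ≈⟨ sum-adjacent i _ off ⟩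
    ((- 1#) ^ toℕ (inject₁ i) * A zero (inject₁ i)) * det (minor A (inject₁ i)) +
    ((- 1#) ^ toℕ (suc i) * A zero (suc i)) * det (minor A (suc i))
      ≈⟨ +-congʳ (*-cong (*-cong (reflexive (≡.cong ((- 1#) ^_) (Fin.toℕ-inject₁ i))) (eq zero)) (det-cong minor≈)) ⟩
    ((- 1#) ^ toℕ i * A zero (suc i)) * det (minor A (suc i)) +
    ((- 1# * (- 1#) ^ toℕ i) * A zero (suc i)) * det (minor A (suc i))
      ≈⟨ solve 3 (λ e a d → (e :* a) :* d :+ ((:- con (+ 1) :* e) :* a) :* d := con (+ 0)) refl _ _ _ ⟩
    0# ∎
    where
    minor≈ : ∀ r j → minor A (inject₁ i) r j ≈ minor A (suc i) r j
    minor≈ r j with j Fin.≟ i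
    ... | yes ≡.refl = trans (reflexive (≡.cong (A (suc r)) (punchIn-inject₁-self i)))
                         (trans (sym (eq (suc r))) (reflexive (≡.cong (A (suc r)) (≡.sym (punchIn-suc-self i)))))
    ... | no  j≢i    = reflexive (≡.cong (A (suc r)) (punchIn-inject₁-suc i j j≢i))
    off : ∀ k → k ≢ inject₁ i → k ≢ suc i → ((- 1#) ^ toℕ k * A zero k) * det (minor A k) ≈ 0#
    off k k≢ k≢′ with punchIn-adjacent i k
    ... | inj₁ e = contradiction e k≢
    ... | inj₂ (inj₁ e) = contradiction e k≢′
    ... | inj₂ (inj₂ (l , e , e′)) = trans (*-congˡ (det-adjacentᶜ l {minor A k} λ r →
            trans (reflexive (≡.cong (A (suc r)) e)) (trans (eq (suc r)) (reflexive (≡.cong (A (suc r)) (≡.sym e′)))))) (zeroʳ _)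

  det-transpose-alternating : ∀ {n} → Alternating (det ∘ transpose {n})
  det-transpose-alternating {n} = go n multilinear
    where
    multilinear : ∀ {n} → Multilinear (det ∘ transpose {n})
    multilinear = record
      { cong   = λ A≈B → det-cong λ i j → A≈B j i
      ; linear = λ r s t {A} {B} {C} → det-linearᶜ r s t {transpose A} {transpose B} {transpose C}
      }
    go : ∀ n → Multilinear (det ∘ transpose {n}) → Alternating (det ∘ transpose {n})
    go zero    ml = record { multilinear = ml ; alternates = λ { {()} } }
    go (suc n) ml = adjacent⇒alternating ml λ i {A} → det-adjacentᶜ i {transpose A}


  -- Row operations and the uniqueness of alternating forms.

  stepwise : ∀ {n m} {G : Rows n m → Carrier} (Rel : Fin n → Vector Carrier m → Vector Carrier m → Set ℓ) →
             (∀ {A B} → (∀ i j → A i j ≈ B i j) → G A ≈ G B) →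
             (∀ r {A B} → (∀ i → i ≢ r → ∀ j → A i j ≈ B i j) → Rel r (A r) (B r) → G A ≈ G B) →
             ∀ {A B} → (∀ r → Rel r (A r) (B r)) → G A ≈ G B
  stepwise {zero}  Rel cong step rel = cong λ ()
  stepwise {suc n} {m} {G} Rel cong step {A} {B} rel = begin
    G A
      ≈⟨ step zero {A} {B zero ◂ tail A} (λ { zero 0≢0 → contradiction ≡.refl 0≢0 ; (suc i) _ j → refl }) (rel zero) ⟩
    G (B zero ◂ tail A)
      -- The row already exchanged is absorbed into the form, which is why `G` has to be arbitrary.
      ≈⟨ stepwise {G = λ X → G (B zero ◂ X)} (Rel ∘ suc) (λ A≈B → cong λ { zero j → refl ; (suc i) j → A≈B i j })
                                (λ r A≈B → step (suc r) λ { zero _ j → refl ; (suc i) i≢r j → A≈B i (i≢r ∘ ≡.cong suc) j })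
                                {tail A} {tail B} (rel ∘ suc) ⟩
    G (B zero ◂ tail B)    ≈⟨ cong (λ { zero j → refl ; (suc i) j → refl }) ⟩
    G B                    ∎

  module _ {n m} {F : Rows (suc n) m → Carrier} (alt : Alternating F) where
    open Alternating alt

    ◂-multilinear : ∀ v → Multilinear (λ A → F (v ◂ A))
    ◂-multilinear v = record
      { cong   = λ A≈B → cong λ { zero j → refl ; (suc i) j → A≈B i j }
      ; linear = λ r s t A≈B A≈C A≈ → linear (suc r) s t
          (λ { zero _ j → refl ; (suc i) i≢r j → A≈B i (i≢r ∘ ≡.cong suc) j })
          (λ { zero _ j → refl ; (suc i) i≢r j → A≈C i (i≢r ∘ ≡.cong suc) j })
          A≈
      }

    ◂-alternating : ∀ v → Alternating (λ A → F (v ◂ A))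
    ◂-alternating v = record
      { multilinear = ◂-multilinear v
      ; alternates  = λ r≢r′ → alternates (r≢r′ ∘ Fin.suc-injective)
      }

    add-head-multiples : ∀ v (s : Vector Carrier n) {A B} →
                         (∀ i j → A i j ≈ B i j + s i * v j) → F (v ◂ A) ≈ F (v ◂ B)
    add-head-multiples v s = stepwise (λ r a b → ∀ j → a j ≈ b j + s r * v j) (Multilinear.cong (◂-multilinear v)) step
      where
      step : ∀ r {A B} → (∀ i → i ≢ r → ∀ j → A i j ≈ B i j) →
             (∀ j → A r j ≈ B r j + s r * v j) → F (v ◂ A) ≈ F (v ◂ B)
      step r {A} {B} A≈B A≈ = begin
        F (v ◂ A)                                   ≈⟨ Multilinear.linear (◂-multilinear v) r 1# (s r) A≈B
                                                         (λ i i≢r j → sym (↦-off i i≢r j))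
                                                         (λ j → trans (A≈ j) (+-cong (sym (*-identityˡ _)) (*-congˡ (sym (↦-at r j))))) ⟩
        1# * F (v ◂ B) + s r * F (v ◂ (A [ r ↦ v ]))
          ≈⟨ +-cong (*-identityˡ _) (*-congˡ (alternates {zero} {suc r} (λ ()) (λ j → sym (↦-at r j)))) ⟩
        F (v ◂ B) + s r * 0#                        ≈⟨ trans (+-congˡ (zeroʳ _)) (+-identityʳ _) ⟩
        F (v ◂ B)                                   ∎

  sum-expand : ∀ {n} (v : Vector Carrier n) j → v j ≈ sum (λ k → v k * δ k j)
  sum-expand v j = sym (sum-δʳ j v)

  -- The identity matrix with row `k` moved to the top: the permutation matrix of a cycle of length
  -- `suc (toℕ k)`.
  cycle : ∀ {n} → Fin (suc n) → Matrix (suc n)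
  cycle k = δ k ◂ (λ i → δ (punchIn k i))

  -- The cycles of `inject₁ k` and `suc k` differ by an exchange of the top row with row `suc k`, so
  -- each step of the induction contributes one sign.
  alternating-cycle : ∀ {n} {F : Matrix (suc n) → Carrier} → Alternating F → ∀ k → F (cycle k) ≈ (- 1#) ^ toℕ k * F δ
  alternating-cycle {n} {F} alt = <-weakInduction _ base step
    where
    open Alternating alt
    base : F (cycle zero) ≈ 1# * F δ
    base = trans (cong λ { zero j → refl ; (suc i) j → refl }) (sym (*-identityˡ _))
    step : ∀ k → F (cycle (inject₁ k)) ≈ (- 1#) ^ toℕ (inject₁ k) * F δ → F (cycle (suc k)) ≈ (- 1#) ^ toℕ (suc k) * F δ
    step k ih = begin
      F (cycle (suc k))             ≈⟨ swap multilinear {zero} {suc k} (λ ()) (alternates (λ ()))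
                                         (λ j → reflexive (≡.cong (λ i → δ i j) (≡.sym (punchIn-inject₁-self k))))
                                         (λ j → reflexive (≡.cong (λ i → δ i j) (punchIn-suc-self k)))
                                         (λ { zero 0≢0 _ → contradiction ≡.refl 0≢0
                                            ; (suc i) _ i≢k j → reflexive (≡.cong (λ i → δ i j) (≡.sym (punchIn-inject₁-suc k i (i≢k ∘ ≡.cong suc)))) }) ⟩
      - F (cycle (inject₁ k))       ≈⟨ -‿cong ih ⟩
      - ((- 1#) ^ toℕ (inject₁ k) * F δ) ≡⟨ ≡.cong (λ l → - ((- 1#) ^ l * F δ)) (Fin.toℕ-inject₁ k) ⟩
      - ((- 1#) ^ toℕ k * F δ)      ≈⟨ solve 2 (λ x y → :- (x :* y) := (:- con (+ 1) :* x) :* y) refl _ _ ⟩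
      (- 1#) ^ toℕ (suc k) * F δ    ∎

  -- Expand the first row in unit vectors. With `δ k` on top, column `k` can be cleared below it,
  -- which leaves an alternating form `G k` in the rows of the minor; induction and
  -- `alternating-cycle` then reproduce the terms of the expansion of `det`.
  det-unique : ∀ {n} {F : Matrix n → Carrier} → Alternating F → ∀ A → F A ≈ det A * F δ
  det-unique {zero}      alt A = trans (Alternating.cong alt λ ()) (sym (*-identityˡ _))
  det-unique {suc n} {F} alt A = begin
    F A
      ≈⟨ ↦-id multilinear A zero (λ j → sym (sum-expand (A zero) j)) ⟨
    F (A [ zero ↦ (λ j → sum (λ k → A zero k * δ k j)) ])
      ≈⟨ ↦-sum multilinear A zero (A zero) δ ⟩
    sum (λ k → A zero k * F (A [ zero ↦ δ k ]))
      ≈⟨ sum-cong term ⟩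
    sum (λ k → ((- 1#) ^ toℕ k * A zero k) * det (minor A k) * F δ)
      ≈⟨ *-distribʳ-sum (F δ) (λ k → ((- 1#) ^ toℕ k * A zero k) * det (minor A k)) ⟨
    det A * F δ ∎
    where
    open Alternating alt
    insert-zero : Fin (suc n) → Vector Carrier n → Vector Carrier (suc n)
    insert-zero k v = insertAt v k 0#

    G : Fin (suc n) → Matrix n → Carrier
    G k N = F (δ k ◂ (λ i → insert-zero k (N i)))

    insert-cong : ∀ k {v w : Vector Carrier n} → (∀ j → v j ≈ w j) → ∀ j → insert-zero k v j ≈ insert-zero k w j
    insert-cong k {v} {w} v≈w = punchIn-elim k _
      (reflexive (≡.trans (insertAt-lookup v k 0#) (≡.sym (insertAt-lookup w k 0#))))
      (λ j → trans (reflexive (insertAt-punchIn v k 0# j)) (trans (v≈w j) (reflexive (≡.sym (insertAt-punchIn w k 0# j)))))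

    insert-linear : ∀ k s t {u v w : Vector Carrier n} → (∀ j → u j ≈ s * v j + t * w j) →
                    ∀ j → insert-zero k u j ≈ s * insert-zero k v j + t * insert-zero k w j
    insert-linear k s t {u} {v} {w} u≈ = punchIn-elim k _
      (begin
        insert-zero k u k                              ≡⟨ insertAt-lookup u k 0# ⟩
        0#
          ≈⟨ solve 2 (λ s t → con (+ 0) := s :* con (+ 0) :+ t :* con (+ 0)) refl s t ⟩
        s * 0# + t * 0#
          ≡⟨ ≡.cong₂ (λ x y → s * x + t * y) (insertAt-lookup v k 0#) (insertAt-lookup w k 0#) ⟨
        s * insert-zero k v k + t * insert-zero k w k  ∎)
      (λ j → begin
        insert-zero k u (punchIn k j)  ≡⟨ insertAt-punchIn u k 0# j ⟩
        u j                            ≈⟨ u≈ j ⟩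
        s * v j + t * w j
          ≡⟨ ≡.cong₂ (λ x y → s * x + t * y) (insertAt-punchIn v k 0# j) (insertAt-punchIn w k 0# j) ⟨
        s * insert-zero k v (punchIn k j) + t * insert-zero k w (punchIn k j) ∎)

    G-alternating : ∀ k → Alternating (G k)
    G-alternating k = record
      { multilinear = record
        { cong   = λ A≈B → ◂.cong λ i → insert-cong k (A≈B i)
        ; linear = λ r s t A≈B A≈C A≈ → ◂.linear r s t (λ i i≢r → insert-cong k (A≈B i i≢r)) (λ i i≢r → insert-cong k (A≈C i i≢r)) (insert-linear k s t A≈)
        }
      ; alternates = λ r≢r′ A≈ → ◂.alternates r≢r′ (insert-cong k A≈)
      }
      where module ◂ = Alternating (◂-alternating alt (δ k))

    G-δ : ∀ k → G k δ ≈ (- 1#) ^ toℕ k * F δ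
    G-δ k = trans (cong λ { zero j → refl ; (suc i) j → row i j }) (alternating-cycle alt k)
      where
      row : ∀ i j → insert-zero k (δ i) j ≈ δ (punchIn k i) j
      row i = punchIn-elim k _
        (reflexive (≡.trans (insertAt-lookup (δ i) k 0#) (≡.sym (δ-≢ (Fin.punchInᵢ≢i k i)))))
        (λ j → reflexive (≡.trans (insertAt-punchIn (δ i) k 0# j) (≡.sym (δ-punchIn i j))))
        where
        δ-punchIn : ∀ i j → δ (punchIn k i) (punchIn k j) ≡ δ i j
        δ-punchIn i j with i Fin.≟ j
        ... | yes ≡.refl = ≡.trans (δ-refl (punchIn k i)) (≡.sym (δ-refl i))
        ... | no  i≢j    = ≡.trans (δ-≢ (i≢j ∘ Fin.punchIn-injective k i j)) (≡.sym (δ-≢ i≢j))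

    -- The multiple of `δ k` to be removed from a row is its entry in column `k`.
    clear : ∀ k → F (A [ zero ↦ δ k ]) ≈ G k (minor A k)
    clear k = trans (cong λ { zero j → refl ; (suc i) j → refl }) (add-head-multiples alt (δ k) (λ i → A (suc i) k) λ i →
      punchIn-elim k _
        (begin
          A (suc i) k                    ≈⟨ solve 1 (λ x → x := con (+ 0) :+ x :* con (+ 1)) refl _ ⟩
          0# + A (suc i) k * 1#
            ≡⟨ ≡.cong₂ (λ x y → x + A (suc i) k * y) (insertAt-lookup (minor A k i) k 0#) (δ-refl k) ⟨
          insert-zero k (minor A k i) k + A (suc i) k * δ k k ∎)
        (λ j → begin
          A (suc i) (punchIn k j)                   ≈⟨ solve 2 (λ x y → x := x :+ y :* con (+ 0)) refl _ _ ⟩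
          A (suc i) (punchIn k j) + A (suc i) k * 0#
            ≡⟨ ≡.cong₂ (λ x y → x + A (suc i) k * y) (insertAt-punchIn (minor A k i) k 0# j) (δ-≢ (Fin.punchInᵢ≢i k j ∘ ≡.sym)) ⟨
          insert-zero k (minor A k i) (punchIn k j) + A (suc i) k * δ k (punchIn k j) ∎))

    term : ∀ k → A zero k * F (A [ zero ↦ δ k ]) ≈ ((- 1#) ^ toℕ k * A zero k) * det (minor A k) * F δ
    term k = begin
      A zero k * F (A [ zero ↦ δ k ])
        ≈⟨ *-congˡ (trans (clear k) (det-unique (G-alternating k) (minor A k))) ⟩
      A zero k * (det (minor A k) * G k δ)                     ≈⟨ *-congˡ (*-congˡ (G-δ k)) ⟩
      A zero k * (det (minor A k) * ((- 1#) ^ toℕ k * F δ))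
        ≈⟨ solve 4 (λ a d e f → a :* (d :* (e :* f)) := ((e :* a) :* d) :* f) refl _ _ _ _ ⟩
      ((- 1#) ^ toℕ k * A zero k) * det (minor A k) * F δ      ∎

  det-lower : ∀ {n} (A : Matrix (suc n)) → (∀ k → A zero (suc k) ≈ 0#) → det A ≈ A zero zero * det (minor A zero)
  det-lower A A≈0 = begin
    det A
      ≈⟨ +-congˡ (sum-zero λ k → trans (*-congʳ (trans (*-congˡ {(- 1#) ^ toℕ (suc k)} (A≈0 k)) (zeroʳ _))) (zeroˡ _)) ⟩
    (1# * A zero zero) * det (minor A zero) + 0#   ≈⟨ trans (+-identityʳ _) (*-congʳ (*-identityˡ _)) ⟩
    A zero zero * det (minor A zero)               ∎

  det-δ : ∀ n → det (δ {n}) ≈ 1#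
  det-δ zero    = refl
  det-δ (suc n) = trans (det-lower (δ {suc n}) λ k → refl) (trans (*-identityˡ _) (det-δ n))

  -- Uniqueness applied to `det ∘ transpose`, which alternates in the rows because `det` does so in
  -- the columns. From here on `det` itself can be treated as a form in the rows.
  det-transpose : ∀ {n} (A : Matrix n) → det (transpose A) ≈ det A
  det-transpose {n} A = begin
    det (transpose A)          ≈⟨ det-unique det-transpose-alternating A ⟩
    det A * det (transpose (δ {n}))
      ≈⟨ *-congˡ (trans (det-cong {n} {transpose δ} {δ} λ i j → reflexive (δ-sym j i)) (det-δ n)) ⟩
    det A * 1#                 ≈⟨ *-identityʳ _ ⟩
    det A                      ∎

  det-alternating : ∀ {n} → Alternating (det {n})
  det-alternating = record
    { multilinear = record
      { cong   = det-cong
      ; linear = λ r s t {A} {B} {C} p q e → trans (sym (det-transpose A))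
          (trans (linear r s t {A} {B} {C} p q e) (+-cong (*-congˡ (det-transpose B)) (*-congˡ (det-transpose C))))
      }
    ; alternates = λ r≢r′ {A} e → trans (sym (det-transpose A)) (alternates r≢r′ {A} e)
    }
    where open Alternating det-transpose-alternating

  det-upper : ∀ {n} (A : Matrix (suc n)) → (∀ i → A (suc i) zero ≈ 0#) → det A ≈ A zero zero * det (minor A zero)
  det-upper A A≈0 = begin
    det A                                         ≈⟨ det-transpose A ⟨
    det (transpose A)                             ≈⟨ det-lower (transpose A) A≈0 ⟩
    A zero zero * det (transpose (minor A zero))  ≈⟨ *-congˡ (det-transpose (minor A zero)) ⟩
    A zero zero * det (minor A zero)              ∎

  -- Products of matrices and signs of maps.

  infixl 7 _·_
  _·_ : ∀ {n} → Matrix n → Matrix n → Matrix n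
  (A · B) i j = sum λ k → A i k * B k j

  ·-identityˡ : ∀ {n} (A : Matrix n) i j → (δ · A) i j ≈ A i j
  ·-identityˡ A i j = sum-δˡ i (λ k → A k j)

  -- For fixed `B`, the left-hand side is an alternating form in the rows of `A`, whose value at the
  -- identity is `det B`.
  det-· : ∀ {n} (A B : Matrix n) → det (A · B) ≈ det A * det B
  det-· A B = trans (det-unique alternating A) (*-congˡ (det-cong (·-identityˡ B)))
    where
    module D = Alternating det-alternating
    row-cong : ∀ {v w : Vector Carrier _} → (∀ k → v k ≈ w k) → ∀ j → sum (λ k → v k * B k j) ≈ sum (λ k → w k * B k j)
    row-cong v≈w j = sum-cong λ k → *-congʳ (v≈w k)
    alternating : Alternating (λ A → det (A · B))
    alternating = record
      { multilinear = record
        { cong   = λ A≈B → det-cong λ i → row-cong (A≈B i)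
        ; linear = λ r s t {U} {V} {W} p q e → D.linear r s t {U · B} {V · B} {W · B}
            (λ i i≢r → row-cong (p i i≢r)) (λ i i≢r → row-cong (q i i≢r))
            (λ j → trans (sum-cong λ k → trans (*-congʳ (e k))
                     (solve 5 (λ s v t w b → (s :* v :+ t :* w) :* b := s :* (v :* b) :+ t :* (w :* b)) refl s (V r k) t (W r k) (B k j)))
                   (sum-linear s t (λ k → V r k * B k j) (λ k → W r k * B k j)))
        }
      ; alternates = λ r≢r′ {U} e → D.alternates r≢r′ {U · B} (row-cong e)
      }

  det-scale-rows : ∀ {n} (x : Vector Carrier n) (A : Matrix n) → det (λ i j → x i * A i j) ≈ product x * det A
  det-scale-rows {zero}  x A = sym (*-identityˡ _)
  det-scale-rows {suc n} x A = trans (sum-cong term) (sym (*-distribˡ-sum (product x) (λ k → ((- 1#) ^ toℕ k * A zero k) * det (minor A k))))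
    where
    term : ∀ k → ((- 1#) ^ toℕ k * (x zero * A zero k)) * det (λ i j → x (suc i) * minor A k i j) ≈
                 product x * (((- 1#) ^ toℕ k * A zero k) * det (minor A k))
    term k = trans (*-congˡ (det-scale-rows (x ∘ suc) (minor A k)))
      (solve 5 (λ e x a p d → (e :* (x :* a)) :* (p :* d) := (x :* p) :* ((e :* a) :* d)) refl _ (x zero) _ (product (x ∘ suc)) _)

  det-scale-columns : ∀ {n} (y : Vector Carrier n) (A : Matrix n) → det (λ i j → y j * A i j) ≈ product y * det A
  det-scale-columns y A = begin
    det (λ i j → y j * A i j)              ≈⟨ det-transpose (λ i j → y j * A i j) ⟨
    det (λ i j → y i * transpose A i j)    ≈⟨ det-scale-rows y (transpose A) ⟩
    product y * det (transpose A)          ≈⟨ *-congˡ (det-transpose A) ⟩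
    product y * det A                      ∎

  -- The determinant of the 0-1 matrix of f; the sign of f when f is a
  -- permutation, and 0# otherwise.
  sgn : ∀ {n} → (Fin n → Fin n) → Carrier
  sgn f = det λ i → δ (f i)

  sgn-cong : ∀ {n} {f g : Fin n → Fin n} → (∀ i → f i ≡ g i) → sgn f ≈ sgn g
  sgn-cong f≗g = det-cong λ i j → reflexive (≡.cong (λ k → δ k j) (f≗g i))

  sgn-∘ : ∀ {n} (f g : Fin n → Fin n) → sgn (g ∘ f) ≈ sgn f * sgn g
  sgn-∘ f g = trans (det-cong λ i j → sym (sum-δˡ (f i) (λ k → δ (g k) j))) (det-· (λ i → δ (f i)) (λ i → δ (g i)))

  sgn-inverse : ∀ {n} (f g : Fin n → Fin n) → (∀ i → g (f i) ≡ i) → sgn f * sgn g ≈ 1#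
  sgn-inverse {n} f g g∘f = trans (sym (sgn-∘ f g)) (trans (sgn-cong {n} {g ∘ f} {id} g∘f) (det-δ n))

  -- The 0-1 matrix of the inverse `g` is the transpose of that of `f`, so the two signs agree, and
  -- their product is 1 by `sgn-inverse`.
  sgn-square : ∀ {n} (f g : Fin n → Fin n) → (∀ i → g (f i) ≡ i) → (∀ i → f (g i) ≡ i) → sgn f * sgn f ≈ 1#
  sgn-square f g g∘f f∘g = trans (*-congˡ sgn-f≈sgn-g) (sgn-inverse f g g∘f)
    where
    entry : ∀ i j → δ (f j) i ≡ δ (g i) j
    entry i j with f j Fin.≟ i
    ... | yes ≡.refl = ≡.trans (δ-refl (f j)) (≡.sym (≡.trans (≡.cong (λ k → δ k j) (g∘f j)) (δ-refl j)))
    ... | no  fj≢i   = ≡.trans (δ-≢ fj≢i) (≡.sym (δ-≢ λ gi≡j → fj≢i (≡.trans (≡.cong f (≡.sym gi≡j)) (f∘g i))))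
    sgn-f≈sgn-g : sgn f ≈ sgn g
    sgn-f≈sgn-g = trans (sym (det-transpose λ i → δ (f i))) (det-cong λ i j → reflexive (entry i j))

  -- m and n need not agree definitionally, as in the case of p * m and m * p.
  sgn-conjugate : ∀ {m n} → m ≡ n → (f : Fin m → Fin n) (g : Fin n → Fin m) → (∀ i → g (f i) ≡ i) →
                  (h : Fin n → Fin n) → sgn (g ∘ h ∘ f) ≈ sgn h
  sgn-conjugate ≡.refl f g g∘f h = begin
    sgn (g ∘ h ∘ f)          ≈⟨ sgn-∘ f (g ∘ h) ⟩
    sgn f * sgn (g ∘ h)      ≈⟨ *-congˡ (sgn-∘ h g) ⟩
    sgn f * (sgn h * sgn g)  ≈⟨ solve 3 (λ x y z → x :* (y :* z) := (x :* z) :* y) refl _ _ _ ⟩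
    (sgn f * sgn g) * sgn h  ≈⟨ *-congʳ (sgn-inverse f g g∘f) ⟩
    1# * sgn h               ≈⟨ *-identityˡ _ ⟩
    sgn h                    ∎

  det-reindex-rows : ∀ {n} (u : Fin n → Fin n) (A : Matrix n) → det (λ i j → A (u i) j) ≈ sgn u * det A
  det-reindex-rows u A = trans (det-cong λ i j → sym (sum-δˡ (u i) (λ k → A k j))) (det-· (λ i → δ (u i)) A)

  det-reindex : ∀ {n} (u v : Fin n → Fin n) (A : Matrix n) → det (λ i j → A (u i) (v j)) ≈ (sgn u * sgn v) * det A
  det-reindex u v A = begin
    det (λ i j → A (u i) (v j))              ≈⟨ det-reindex-rows u (λ i j → A i (v j)) ⟩
    sgn u * det (λ i j → A i (v j))          ≈⟨ *-congˡ (det-transpose (λ i j → A i (v j))) ⟨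
    sgn u * det (λ i j → transpose A (v i) j) ≈⟨ *-congˡ (det-reindex-rows v (transpose A)) ⟩
    sgn u * (sgn v * det (transpose A))      ≈⟨ *-congˡ (*-congˡ (det-transpose A)) ⟩
    sgn u * (sgn v * det A)                  ≈⟨ *-assoc _ _ _ ⟨
    (sgn u * sgn v) * det A                  ∎

  -- Block-diagonal matrices and maps that act block by block.

  block-entry : ∀ {m n} → Matrix m → Matrix n → Fin m ⊎ Fin n → Fin m ⊎ Fin n → Carrier
  block-entry A B (inj₁ i) (inj₁ j) = A i j
  block-entry A B (inj₁ i) (inj₂ j) = 0#
  block-entry A B (inj₂ i) (inj₁ j) = 0#
  block-entry A B (inj₂ i) (inj₂ j) = B i j

  block-diagonal : ∀ {m n} → Matrix m → Matrix n → Matrix (m ℕ.+ n)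
  block-diagonal {m} A B i j = block-entry A B (splitAt m i) (splitAt m j)

  -- Again uniqueness, for the form in `A` with `B` fixed. Its value at the identity is found by
  -- splitting off one row at a time.
  det-block-diagonal : ∀ {m n} (A : Matrix m) (B : Matrix n) → det (block-diagonal A B) ≈ det A * det B
  det-block-diagonal {m} {n} A B = trans (det-unique alternating A) (*-congˡ (det-δ-block m))
    where
    module D = Alternating det-alternating
    row-cong : ∀ {U V : Matrix m} {i} → (∀ j → U i j ≈ V i j) → ∀ x → block-entry U B (inj₁ i) x ≈ block-entry V B (inj₁ i) x
    row-cong U≈V (inj₁ j) = U≈V j
    row-cong U≈V (inj₂ j) = refl
    rows-cong : ∀ {U V : Matrix m} i → (∀ i′ → i ≡ i′ ↑ˡ n → ∀ j → U i′ j ≈ V i′ j) → ∀ j → block-diagonal U B i j ≈ block-diagonal V B i j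
    rows-cong {U} {V} i U≈V j with splitAt m i in eq
    ... | inj₁ i′ = row-cong {U} {V} (U≈V i′ (≡.sym (Fin.splitAt⁻¹-↑ˡ eq))) (splitAt m j)
    ... | inj₂ i′ with splitAt m j
    ...   | inj₁ j′ = refl
    ...   | inj₂ j′ = refl
    alternating : Alternating (λ A → det (block-diagonal A B))
    alternating = record
      { multilinear = record
        { cong   = λ {U} {V} U≈V → det-cong λ i → rows-cong {U} {V} i (λ i′ _ → U≈V i′)
        ; linear = λ r s t {U} {V} {W} p q e → D.linear (r ↑ˡ n) s t {block-diagonal U B} {block-diagonal V B} {block-diagonal W B}
            (λ i i≢r → rows-cong {U} {V} i λ i′ eq → p i′ λ i′≡r → i≢r (≡.trans eq (≡.cong (_↑ˡ n) i′≡r)))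
            (λ i i≢r → rows-cong {U} {W} i λ i′ eq → q i′ λ i′≡r → i≢r (≡.trans eq (≡.cong (_↑ˡ n) i′≡r)))
            (λ j → lin r s t {U} {V} {W} e j)
        }
      ; alternates = λ {r} {r′} r≢r′ {U} e → D.alternates {r ↑ˡ n} {r′ ↑ˡ n} (r≢r′ ∘ Fin.↑ˡ-injective n r r′) {block-diagonal U B} (alt r r′ {U} e)
      }
      where
      lin : ∀ r s t {U V W : Matrix m} → (∀ j → U r j ≈ s * V r j + t * W r j) → ∀ j →
            block-diagonal U B (r ↑ˡ n) j ≈ s * block-diagonal V B (r ↑ˡ n) j + t * block-diagonal W B (r ↑ˡ n) j
      lin r s t e j rewrite Fin.splitAt-↑ˡ m r n with splitAt m j
      ... | inj₁ j′ = e j′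
      ... | inj₂ j′ = solve 2 (λ s t → con (+ 0) := s :* con (+ 0) :+ t :* con (+ 0)) refl s t
      alt : ∀ r r′ {U : Matrix m} → (∀ j → U r j ≈ U r′ j) → ∀ j → block-diagonal U B (r ↑ˡ n) j ≈ block-diagonal U B (r′ ↑ˡ n) j
      alt r r′ e j rewrite Fin.splitAt-↑ˡ m r n | Fin.splitAt-↑ˡ m r′ n with splitAt m j
      ... | inj₁ j′ = e j′
      ... | inj₂ j′ = refl
    det-δ-block : ∀ m → det (block-diagonal (δ {m}) B) ≈ det B
    det-δ-block zero    = refl
    det-δ-block (suc m) = begin
      det (block-diagonal (δ {suc m}) B)  ≈⟨ det-lower (block-diagonal (δ {suc m}) B) head-row ⟩
      1# * det (minor (block-diagonal (δ {suc m}) B) zero) ≈⟨ *-identityˡ _ ⟩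
      det (minor (block-diagonal (δ {suc m}) B) zero)      ≈⟨ det-cong tail-rows ⟩
      det (block-diagonal (δ {m}) B)      ≈⟨ det-δ-block m ⟩
      det B ∎
      where
      head-row : ∀ k → block-diagonal (δ {suc m}) B zero (suc k) ≈ 0#
      head-row k with splitAt m k
      ... | inj₁ _ = refl
      ... | inj₂ _ = refl
      tail-rows : ∀ i j → block-diagonal (δ {suc m}) B (suc i) (suc j) ≈ block-diagonal (δ {m}) B i j
      tail-rows i j with splitAt m i | splitAt m j
      ... | inj₁ _ | inj₁ _ = refl
      ... | inj₁ _ | inj₂ _ = refl
      ... | inj₂ _ | inj₁ _ = refl
      ... | inj₂ _ | inj₂ _ = refl

  -- `combine r s` is the number `p * r + s`, that is, place `s` of block `r`. Every block is mapped
  -- into itself, so the 0-1 matrix is block diagonal.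
  blockwise : ∀ {m p} → (Fin m → Fin p → Fin p) → Fin (m ℕ.* p) → Fin (m ℕ.* p)
  blockwise {m} {p} τ x = uncurry (λ r s → combine r (τ r s)) (remQuot {m} p x)

  δ-↑ˡ-↑ˡ : ∀ {m} n (i j : Fin m) → δ (i ↑ˡ n) (j ↑ˡ n) ≡ δ i j
  δ-↑ˡ-↑ˡ n zero    zero    = ≡.refl
  δ-↑ˡ-↑ˡ n zero    (suc j) = ≡.refl
  δ-↑ˡ-↑ˡ n (suc i) zero    = ≡.refl
  δ-↑ˡ-↑ˡ n (suc i) (suc j) = δ-↑ˡ-↑ˡ n i j

  δ-↑ˡ-↑ʳ : ∀ {m n} (i : Fin m) (j : Fin n) → δ (i ↑ˡ n) (m ↑ʳ j) ≡ 0#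
  δ-↑ˡ-↑ʳ zero    j = ≡.refl
  δ-↑ˡ-↑ʳ (suc i) j = δ-↑ˡ-↑ʳ i j

  δ-↑ʳ-↑ʳ : ∀ m {n} (i j : Fin n) → δ (m ↑ʳ i) (m ↑ʳ j) ≡ δ i j
  δ-↑ʳ-↑ʳ zero    i j = ≡.refl
  δ-↑ʳ-↑ʳ (suc m) i j = δ-↑ʳ-↑ʳ m i j

  sgn-blockwise : ∀ {m p} (τ : Fin m → Fin p → Fin p) → sgn (blockwise τ) ≈ product (λ r → sgn (τ r))
  sgn-blockwise {zero}      τ = refl
  sgn-blockwise {suc m} {p} τ = begin
    sgn (blockwise τ)                                                     ≈⟨ det-cong entries ⟩
    det (block-diagonal (λ i → δ (τ zero i)) (λ i → δ (blockwise (τ ∘ suc) i)))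
      ≈⟨ det-block-diagonal (λ i → δ (τ zero i)) (λ i → δ (blockwise (τ ∘ suc) i)) ⟩
    sgn (τ zero) * sgn (blockwise (τ ∘ suc))                              ≈⟨ *-congˡ (sgn-blockwise (τ ∘ suc)) ⟩
    product (λ r → sgn (τ r))                                             ∎
    where
    entries : ∀ x y → δ (blockwise τ x) y ≈ block-diagonal (λ i → δ (τ zero i)) (λ i → δ (blockwise (τ ∘ suc) i)) x y
    entries x y with splitAt p x | splitAt p y in eq
    ... | inj₁ i | inj₁ j rewrite ≡.sym (Fin.splitAt⁻¹-↑ˡ eq) = reflexive (δ-↑ˡ-↑ˡ (m ℕ.* p) (τ zero i) j)
    ... | inj₁ i | inj₂ j rewrite ≡.sym (Fin.splitAt⁻¹-↑ʳ eq) = reflexive (δ-↑ˡ-↑ʳ (τ zero i) j)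
    ... | inj₂ i | inj₁ j rewrite ≡.sym (Fin.splitAt⁻¹-↑ˡ eq) = reflexive (≡.trans (δ-sym (p ↑ʳ blockwise (τ ∘ suc) i) (j ↑ˡ (m ℕ.* p))) (δ-↑ˡ-↑ʳ j (blockwise (τ ∘ suc) i)))
    ... | inj₂ i | inj₂ j rewrite ≡.sym (Fin.splitAt⁻¹-↑ʳ eq) = reflexive (δ-↑ʳ-↑ʳ p (blockwise (τ ∘ suc) i) j)

  -- Two explicit determinants: a rank-one perturbation of the identity and the step matrix.

  bordered : ∀ {n} → Carrier → Vector Carrier n → Vector Carrier n → Matrix n → Matrix (suc n)
  bordered a v w A zero    zero    = a
  bordered a v w A zero    (suc j) = v j
  bordered a v w A (suc i) zero    = w i
  bordered a v w A (suc i) (suc j) = A i j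

  -- Factor the matrix bordered by a row of ones, a column z and the corner
  -- 1# in both block LU and block UL form.
  det-δ-rank-one : ∀ {n} (z : Vector Carrier n) → det (λ i j → δ i j - z i) ≈ 1# - sum z
  det-δ-rank-one {n} z = begin
    det A                  ≈⟨ trans (det-upper U (λ i → refl)) (*-identityˡ _) ⟨
    det U                  ≈⟨ trans (*-congʳ det-L) (*-identityˡ _) ⟨
    det L * det U          ≈⟨ det-· L U ⟨
    det (L · U)            ≈⟨ det-cong L·U≈U′·L ⟩
    det (U′ · L)           ≈⟨ det-· U′ L ⟩
    det U′ * det L         ≈⟨ trans (*-congˡ det-L) (*-identityʳ _) ⟩
    det U′                 ≈⟨ trans (det-upper U′ (λ i → refl)) (trans (*-congˡ (det-δ n)) (*-identityʳ _)) ⟩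
    1# - sum z             ∎
    where
    A : Matrix n
    A i j = δ i j - z i
    L U U′ : Matrix (suc n)
    L  = bordered 1# (λ _ → 0#) z δ
    U  = bordered 1# (λ _ → 1#) (λ _ → 0#) A
    U′ = bordered (1# - sum z) (λ _ → 1#) (λ _ → 0#) δ
    det-L : det L ≈ 1#
    det-L = trans (det-lower L (λ k → refl)) (trans (*-identityˡ _) (det-δ n))
    L·U≈U′·L : ∀ i j → (L · U) i j ≈ (U′ · L) i j
    L·U≈U′·L zero zero = begin
      1# * 1# + sum {n} (λ k → 0# * 0#)                ≈⟨ +-congˡ (sum-zero {n} {λ k → 0# * 0#} λ k → zeroˡ 0#) ⟩
      1# * 1# + 0#
        ≈⟨ solve 1 (λ s → con (+ 1) :* con (+ 1) :+ con (+ 0) := (con (+ 1) :- s) :* con (+ 1) :+ s) refl (sum z) ⟩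
      (1# - sum z) * 1# + sum z                    ≈⟨ +-congˡ (sum-cong λ k → *-identityˡ (z k)) ⟨
      (1# - sum z) * 1# + sum (λ k → 1# * z k)     ∎
    L·U≈U′·L zero (suc j) = begin
      1# * 1# + sum (λ k → 0# * A k j)             ≈⟨ +-congˡ (sum-zero λ k → zeroˡ (A k j)) ⟩
      1# * 1# + 0#
        ≈⟨ solve 1 (λ s → con (+ 1) :* con (+ 1) :+ con (+ 0) := s :* con (+ 0) :+ con (+ 1)) refl (1# - sum z) ⟩
      (1# - sum z) * 0# + 1#                       ≈⟨ +-congˡ (sum-δʳ j (λ _ → 1#)) ⟨
      (1# - sum z) * 0# + sum (λ k → 1# * δ k j)   ∎
    L·U≈U′·L (suc i) zero = begin
      z i * 1# + sum (λ k → δ i k * 0#)            ≈⟨ +-congˡ (sum-δˡ i (λ _ → 0#)) ⟩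
      z i * 1# + 0#
        ≈⟨ solve 1 (λ z → z :* con (+ 1) :+ con (+ 0) := con (+ 0) :* con (+ 1) :+ z) refl (z i) ⟩
      0# * 1# + z i                                ≈⟨ +-congˡ (sum-δˡ i z) ⟨
      0# * 1# + sum (λ k → δ i k * z k)            ∎
    L·U≈U′·L (suc i) (suc j) = begin
      z i * 1# + sum (λ k → δ i k * A k j)         ≈⟨ +-congˡ (sum-δˡ i (λ k → A k j)) ⟩
      z i * 1# + (δ i j - z i)
        ≈⟨ solve 2 (λ z d → z :* con (+ 1) :+ (d :- z) := con (+ 0) :* con (+ 0) :+ d) refl (z i) (δ i j) ⟩
      0# * 0# + δ i j                              ≈⟨ +-congˡ (sum-δˡ i (λ k → δ k j)) ⟨
      0# * 0# + sum (λ k → δ i k * δ k j)          ∎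

  -- `1#` on and above the diagonal and `t` below it. `Q` involves the transpose, whose determinant
  -- is the same.
  step-matrix : ∀ {n} → Carrier → Matrix n
  step-matrix t zero    j       = 1#
  step-matrix t (suc i) zero    = t
  step-matrix t (suc i) (suc j) = step-matrix t i j

  -- The first two rows differ only in their first entry, by `1# - t`. Subtracting the second from
  -- the first makes the top row of the matrix a multiple of a unit vector.
  det-step-matrix : ∀ n t → det (step-matrix {suc n} t) ≈ (1# - t) ^ n
  det-step-matrix zero    t = trans (det-lower (step-matrix {1} t) λ ()) (*-identityˡ _)
  det-step-matrix (suc n) t = begin
    det S                                   ≈⟨ linear zero 1# 1# {S} {S [ zero ↦ d ]} {S [ zero ↦ S (suc zero) ]}
                                                 (λ i i≢0 j → sym (↦-off i i≢0 j)) (λ i i≢0 j → sym (↦-off i i≢0 j)) row ⟩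
    1# * det (S [ zero ↦ d ]) + 1# * det (S [ zero ↦ S (suc zero) ])
                                            ≈⟨ +-cong (*-identityˡ _) (trans (*-identityˡ _) (alternates {zero} {suc zero} (λ ()) {S [ zero ↦ S (suc zero) ]} (λ j → refl))) ⟩
    det (S [ zero ↦ d ]) + 0#               ≈⟨ +-identityʳ _ ⟩
    det (S [ zero ↦ d ])                    ≈⟨ det-lower (S [ zero ↦ d ]) (λ k → refl) ⟩
    (1# - t) * det (step-matrix {suc n} t)  ≈⟨ *-congˡ (det-step-matrix n t) ⟩
    (1# - t) ^ suc n                        ∎
    where
    open Alternating det-alternating
    S : Matrix (suc (suc n))
    S = step-matrix t
    d : Vector Carrier (suc (suc n))
    d zero    = 1# - t
    d (suc j) = 0#
    row : ∀ j → S zero j ≈ 1# * d j + 1# * S (suc zero) j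
    row zero    = solve 1 (λ t → con (+ 1) := con (+ 1) :* (con (+ 1) :- t) :+ con (+ 1) :* t) refl t
    row (suc j) = solve 0 (con (+ 1) := con (+ 1) :* con (+ 0) :+ con (+ 1) :* con (+ 1)) refl

-- Arithmetic modulo n

infix 4 _≡_[mod_]
-- A record, so that `x` and `y` can be inferred from a proof; they cannot be recovered from the
-- difference `x ℤ.- y`.
record _≡_[mod_] (x y : ℤ) (n : ℕ) : Set where
  constructor mod
  field divisible : + n ∣ x ℤ.- y

module _ {n : ℕ} where
  open ≡-Reasoning

  ≡⇒≡[mod] : ∀ {x y} → x ≡ y → x ≡ y [mod n ]
  ≡⇒≡[mod] {x} ≡.refl = mod (divides 0ℤ (ℤ.+-inverseʳ x))

  mod-refl : ∀ {x} → x ≡ x [mod n ]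
  mod-refl = ≡⇒≡[mod] ≡.refl

  mod-sym : ∀ {x y} → x ≡ y [mod n ] → y ≡ x [mod n ]
  mod-sym {x} {y} (mod (divides k eq)) = mod (divides (ℤ.- k) (begin
    y ℤ.- x               ≡⟨ lemma x y ⟩
    ℤ.- (x ℤ.- y)         ≡⟨ ≡.cong ℤ.-_ eq ⟩
    ℤ.- (k ℤ.* + n)       ≡⟨ ℤ.neg-distribˡ-* k (+ n) ⟩
    ℤ.- k ℤ.* + n         ∎))
    where
    lemma : ∀ x y → y ℤ.- x ≡ ℤ.- (x ℤ.- y)
    lemma = solve-∀

  mod-trans : ∀ {x y z} → x ≡ y [mod n ] → y ≡ z [mod n ] → x ≡ z [mod n ]
  mod-trans {x} {y} {z} (mod (divides k eq)) (mod (divides l eq′)) = mod (divides (k ℤ.+ l) (begin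
    x ℤ.- z                    ≡⟨ lemma x y z ⟩
    (x ℤ.- y) ℤ.+ (y ℤ.- z)    ≡⟨ ≡.cong₂ ℤ._+_ eq eq′ ⟩
    k ℤ.* + n ℤ.+ l ℤ.* + n    ≡⟨ ℤ.*-distribʳ-+ (+ n) k l ⟨
    (k ℤ.+ l) ℤ.* + n          ∎))
    where
    lemma : ∀ x y z → x ℤ.- z ≡ (x ℤ.- y) ℤ.+ (y ℤ.- z)
    lemma = solve-∀

  mod-+ : ∀ {x y u v} → x ≡ y [mod n ] → u ≡ v [mod n ] → x ℤ.+ u ≡ y ℤ.+ v [mod n ]
  mod-+ {x} {y} {u} {v} (mod (divides k eq)) (mod (divides l eq′)) = mod (divides (k ℤ.+ l) (begin
    x ℤ.+ u ℤ.- (y ℤ.+ v)      ≡⟨ lemma x y u v ⟩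
    (x ℤ.- y) ℤ.+ (u ℤ.- v)    ≡⟨ ≡.cong₂ ℤ._+_ eq eq′ ⟩
    k ℤ.* + n ℤ.+ l ℤ.* + n    ≡⟨ ℤ.*-distribʳ-+ (+ n) k l ⟨
    (k ℤ.+ l) ℤ.* + n          ∎))
    where
    lemma : ∀ x y u v → x ℤ.+ u ℤ.- (y ℤ.+ v) ≡ (x ℤ.- y) ℤ.+ (u ℤ.- v)
    lemma = solve-∀

  mod-* : ∀ {x y u v} → x ≡ y [mod n ] → u ≡ v [mod n ] → x ℤ.* u ≡ y ℤ.* v [mod n ]
  mod-* {x} {y} {u} {v} (mod (divides k eq)) (mod (divides l eq′)) = mod (divides (k ℤ.* u ℤ.+ y ℤ.* l) (begin
    x ℤ.* u ℤ.- y ℤ.* v                        ≡⟨ lemma x y u v ⟩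
    (x ℤ.- y) ℤ.* u ℤ.+ y ℤ.* (u ℤ.- v)        ≡⟨ ≡.cong₂ (λ s t → s ℤ.* u ℤ.+ y ℤ.* t) eq eq′ ⟩
    k ℤ.* + n ℤ.* u ℤ.+ y ℤ.* (l ℤ.* + n)      ≡⟨ lemma′ k (+ n) u y l ⟩
    (k ℤ.* u ℤ.+ y ℤ.* l) ℤ.* + n              ∎))
    where
    lemma : ∀ x y u v → x ℤ.* u ℤ.- y ℤ.* v ≡ (x ℤ.- y) ℤ.* u ℤ.+ y ℤ.* (u ℤ.- v)
    lemma = solve-∀
    lemma′ : ∀ k n u y l → k ℤ.* n ℤ.* u ℤ.+ y ℤ.* (l ℤ.* n) ≡ (k ℤ.* u ℤ.+ y ℤ.* l) ℤ.* n
    lemma′ = solve-∀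

  mod-+ˡ : ∀ x {u v} → u ≡ v [mod n ] → x ℤ.+ u ≡ x ℤ.+ v [mod n ]
  mod-+ˡ x = mod-+ {x} mod-refl

  mod-+ʳ : ∀ u {x y} → x ≡ y [mod n ] → x ℤ.+ u ≡ y ℤ.+ u [mod n ]
  mod-+ʳ u x≡y = mod-+ x≡y (mod-refl {u})

  mod-*ˡ : ∀ x {u v} → u ≡ v [mod n ] → x ℤ.* u ≡ x ℤ.* v [mod n ]
  mod-*ˡ x = mod-* {x} mod-refl

  mod-*ʳ : ∀ u {x y} → x ≡ y [mod n ] → x ℤ.* u ≡ y ℤ.* u [mod n ]
  mod-*ʳ u x≡y = mod-* x≡y (mod-refl {u})

  mod-+n : ∀ x k → x ℤ.+ k ℤ.* + n ≡ x [mod n ]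
  mod-+n x k = mod (divides k (lemma x (k ℤ.* + n)))
    where
    lemma : ∀ x y → x ℤ.+ y ℤ.- x ≡ y
    lemma = solve-∀

  -- The multiple `(k ℤ.- k′) ℤ.* + n` is a difference of two remainders and thus smaller than `n`
  -- in absolute value, so it is 0.
  divMod-unique : ∀ {r r′} k k′ → r ℕ.< n → r′ ℕ.< n → + r ℤ.+ k ℤ.* + n ≡ + r′ ℤ.+ k′ ℤ.* + n → r ≡ r′ × k ≡ k′
  divMod-unique {r} {r′} k k′ r<n r′<n eq = ℤ.+-injective r≡r′ , k≡k′
    where
    lemma : ∀ r r′ k k′ n → r ℤ.+ k ℤ.* n ≡ r′ ℤ.+ k′ ℤ.* n → (k ℤ.- k′) ℤ.* n ≡ r′ ℤ.- r
    lemma r r′ k k′ n eq = begin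
      (k ℤ.- k′) ℤ.* n                             ≡⟨ lemma₁ r k k′ n ⟩
      (r ℤ.+ k ℤ.* n) ℤ.- (r ℤ.+ k′ ℤ.* n)         ≡⟨ ≡.cong (ℤ._- (r ℤ.+ k′ ℤ.* n)) eq ⟩
      (r′ ℤ.+ k′ ℤ.* n) ℤ.- (r ℤ.+ k′ ℤ.* n)       ≡⟨ lemma₂ r r′ k′ n ⟩
      r′ ℤ.- r                                     ∎
      where
      lemma₁ : ∀ r k k′ n → (k ℤ.- k′) ℤ.* n ≡ (r ℤ.+ k ℤ.* n) ℤ.- (r ℤ.+ k′ ℤ.* n)
      lemma₁ = solve-∀
      lemma₂ : ∀ r r′ k′ n → (r′ ℤ.+ k′ ℤ.* n) ℤ.- (r ℤ.+ k′ ℤ.* n) ≡ r′ ℤ.- r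
      lemma₂ = solve-∀

    bound : ℤ.∣ k ℤ.- k′ ∣ ℕ.* n ℕ.< n
    bound = ≡.subst (ℕ._< n) (begin
      ℤ.∣ r′ ℤ.⊖ r ∣              ≡⟨ ≡.cong ℤ.∣_∣ (ℤ.m-n≡m⊖n r′ r) ⟨
      ℤ.∣ + r′ ℤ.- + r ∣          ≡⟨ ≡.cong ℤ.∣_∣ (lemma (+ r) (+ r′) k k′ (+ n) eq) ⟨
      ℤ.∣ (k ℤ.- k′) ℤ.* + n ∣    ≡⟨ ℤ.abs-* (k ℤ.- k′) (+ n) ⟩
      ℤ.∣ k ℤ.- k′ ∣ ℕ.* n        ∎)
      (ℕ.≤-<-trans (ℤ.∣m⊝n∣≤m⊔n r′ r) (ℕ.⊔-lub r′<n r<n))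

    small : ∀ m → m ℕ.* n ℕ.< n → m ≡ 0
    small zero    _   = ≡.refl
    small (suc m) m*n<n = contradiction (ℕ.m≤m+n n (m ℕ.* n)) (ℕ.<⇒≱ m*n<n)

    k-k′≡0 : k ℤ.- k′ ≡ 0ℤ
    k-k′≡0 = ℤ.∣i∣≡0⇒i≡0 (small _ bound)

    k≡k′ : k ≡ k′
    k≡k′ = ℤ.i-j≡0⇒i≡j k k′ k-k′≡0

    r≡r′ : + r ≡ + r′
    r≡r′ = ≡.sym (ℤ.i-j≡0⇒i≡j (+ r′) (+ r) (≡.trans (≡.sym (lemma (+ r) (+ r′) k k′ (+ n) eq)) (≡.cong (ℤ._* + n) k-k′≡0)))

  toℕ-injective-mod : ∀ {i j : Fin n} → + toℕ i ≡ + toℕ j [mod n ] → i ≡ j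
  toℕ-injective-mod {i} {j} (mod (divides k eq)) = Fin.toℕ-injective (proj₁ (divMod-unique 0ℤ k (Fin.toℕ<n i) (Fin.toℕ<n j) (begin
    + toℕ i ℤ.+ 0ℤ                         ≡⟨ lemma (+ toℕ i) (+ toℕ j) ⟩
    + toℕ j ℤ.+ (+ toℕ i ℤ.- + toℕ j)      ≡⟨ ≡.cong (λ z → + toℕ j ℤ.+ z) eq ⟩
    + toℕ j ℤ.+ k ℤ.* + n                  ∎)))
    where
    lemma : ∀ x y → x ℤ.+ 0ℤ ≡ y ℤ.+ (x ℤ.- y)
    lemma = solve-∀

module _ (n : ℕ) .{{_ : NonZero n}} where
  open ≡-Reasoning

  -- Residues never unfold outside this block; `red-divMod` is their specification.
  abstract
    red : ℤ → Fin n
    red x = fromℕ< (n%ℕd<d x n)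

    red-divMod : ∀ x → x ≡ + toℕ (red x) ℤ.+ (x /ℕ n) ℤ.* + n
    red-divMod x = ≡.trans (a≡a%ℕn+[a/ℕn]*n x n)
      (≡.cong (λ r → + r ℤ.+ (x /ℕ n) ℤ.* + n) (≡.sym (Fin.toℕ-fromℕ< (n%ℕd<d x n))))

  red-mod : ∀ x → + toℕ (red x) ≡ x [mod n ]
  red-mod x = mod-sym (≡.subst (_≡ + toℕ (red x) [mod n ]) (≡.sym (red-divMod x)) (mod-+n (+ toℕ (red x)) (x /ℕ n)))

  red-unique : ∀ {x} i → x ≡ + toℕ i [mod n ] → red x ≡ i
  red-unique {x} i x≡i = toℕ-injective-mod (mod-trans (red-mod x) x≡i)

  red-cong : ∀ {x y} → x ≡ y [mod n ] → red x ≡ red y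
  red-cong {x} {y} x≡y = red-unique (red y) (mod-trans x≡y (mod-sym (red-mod y)))

  red-cancel : ∀ {x y} → red x ≡ red y → x ≡ y [mod n ]
  red-cancel {x} {y} eq = mod-trans (mod-sym (red-mod x)) (≡.subst (λ i → + toℕ i ≡ y [mod n ]) (≡.sym eq) (red-mod y))

  /ℕ-unique : ∀ {x r} k → r ℕ.< n → x ≡ + r ℤ.+ k ℤ.* + n → x /ℕ n ≡ k
  /ℕ-unique {x} k r<n eq = proj₂ (divMod-unique (x /ℕ n) k (n%ℕd<d x n) r<n (≡.trans (≡.sym (a≡a%ℕn+[a/ℕn]*n x n)) eq))

  /ℕ-+ : ∀ x k → (x ℤ.+ k ℤ.* + n) /ℕ n ≡ x /ℕ n ℤ.+ k
  /ℕ-+ x k = /ℕ-unique (x /ℕ n ℤ.+ k) (n%ℕd<d x n) (begin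
    x ℤ.+ k ℤ.* + n                                           ≡⟨ ≡.cong (ℤ._+ k ℤ.* + n) (a≡a%ℕn+[a/ℕn]*n x n) ⟩
    + (x %ℕ n) ℤ.+ (x /ℕ n) ℤ.* + n ℤ.+ k ℤ.* + n             ≡⟨ lemma (+ (x %ℕ n)) (x /ℕ n) k (+ n) ⟩
    + (x %ℕ n) ℤ.+ (x /ℕ n ℤ.+ k) ℤ.* + n                     ∎)
    where
    lemma : ∀ r q k n → r ℤ.+ q ℤ.* n ℤ.+ k ℤ.* n ≡ r ℤ.+ (q ℤ.+ k) ℤ.* n
    lemma = solve-∀

  /ℕ-exact : ∀ k → (k ℤ.* + n) /ℕ n ≡ k
  /ℕ-exact k = /ℕ-unique {k ℤ.* + n} {0} k (ℕ.>-nonZero⁻¹ n) (≡.sym (ℤ.+-identityˡ _))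

  -- A nonzero remainder absorbs the subtraction of 1. This makes all terms but one cancel in each
  -- row of Q z.
  /ℕ-pred : ∀ x → ¬ (+ n ∣ x) → (x ℤ.- 1ℤ) /ℕ n ≡ x /ℕ n
  /ℕ-pred x n∤x with x %ℕ n in eq | n%ℕd<d x n
  ... | zero  | _ = contradiction (divides (x /ℕ n) (begin
    x                                      ≡⟨ a≡a%ℕn+[a/ℕn]*n x n ⟩
    + (x %ℕ n) ℤ.+ (x /ℕ n) ℤ.* + n        ≡⟨ ≡.cong (λ r → + r ℤ.+ (x /ℕ n) ℤ.* + n) eq ⟩
    0ℤ ℤ.+ (x /ℕ n) ℤ.* + n                ≡⟨ ℤ.+-identityˡ _ ⟩
    (x /ℕ n) ℤ.* + n                       ∎)) n∤x
  ... | suc r | r<n = /ℕ-unique (x /ℕ n) (ℕ.<-trans (ℕ.n<1+n r) r<n) (begin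
    x ℤ.- 1ℤ                               ≡⟨ ≡.cong (ℤ._- 1ℤ) (a≡a%ℕn+[a/ℕn]*n x n) ⟩
    + (x %ℕ n) ℤ.+ (x /ℕ n) ℤ.* + n ℤ.- 1ℤ ≡⟨ ≡.cong (λ r → + r ℤ.+ (x /ℕ n) ℤ.* + n ℤ.- 1ℤ) eq ⟩
    + suc r ℤ.+ (x /ℕ n) ℤ.* + n ℤ.- 1ℤ    ≡⟨ lemma (+ r) ((x /ℕ n) ℤ.* + n) ⟩
    + r ℤ.+ (x /ℕ n) ℤ.* + n               ∎)
    where
    lemma : ∀ r y → 1ℤ ℤ.+ r ℤ.+ y ℤ.- 1ℤ ≡ r ℤ.+ y
    lemma = solve-∀

  -1/ℕn≡-1 : -1ℤ /ℕ n ≡ -1ℤ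
  -1/ℕn≡-1 = /ℕ-unique -1ℤ (ℕ.≤-reflexive (ℕ.suc-pred n)) (begin
    -1ℤ                                      ≡⟨ lemma (+ ℕ.pred n) ⟩
    + ℕ.pred n ℤ.+ -1ℤ ℤ.* (1ℤ ℤ.+ + ℕ.pred n) ≡⟨ ≡.cong (λ m → + ℕ.pred n ℤ.+ -1ℤ ℤ.* + m) (ℕ.suc-pred n) ⟩
    + ℕ.pred n ℤ.+ -1ℤ ℤ.* + n               ∎)
    where
    lemma : ∀ m → -1ℤ ≡ m ℤ.+ -1ℤ ℤ.* (1ℤ ℤ.+ m)
    lemma = solve-∀

  -- Subtraction with remainders either needs no borrow, as here, or borrows once, as in
  -- `/ℕ-difference-<`. The two cases become the entries `1#` and `t` of the step matrix.
  /ℕ-difference-≥ : ∀ x y → toℕ (red y) ℕ.≤ toℕ (red x) → (x ℤ.- y) /ℕ n ≡ x /ℕ n ℤ.- y /ℕ n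
  /ℕ-difference-≥ x y y≤x = /ℕ-unique {r = toℕ (red x) ℕ.∸ toℕ (red y)} _ (ℕ.≤-<-trans (ℕ.m∸n≤m (toℕ (red x)) (toℕ (red y))) (Fin.toℕ<n (red x))) (begin
    x ℤ.- y                                                         ≡⟨ ≡.cong₂ ℤ._-_ (red-divMod x) (red-divMod y) ⟩
    (+ toℕ (red x) ℤ.+ (x /ℕ n) ℤ.* + n) ℤ.- (+ toℕ (red y) ℤ.+ (y /ℕ n) ℤ.* + n)
                                                                    ≡⟨ lemma (+ toℕ (red x)) (x /ℕ n) (+ toℕ (red y)) (y /ℕ n) (+ n) ⟩
    (+ toℕ (red x) ℤ.- + toℕ (red y)) ℤ.+ (x /ℕ n ℤ.- y /ℕ n) ℤ.* + n
      ≡⟨ ≡.cong (ℤ._+ (x /ℕ n ℤ.- y /ℕ n) ℤ.* + n) (≡.trans (ℤ.m-n≡m⊖n (toℕ (red x)) (toℕ (red y))) (ℤ.⊖-≥ y≤x)) ⟩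
    + (toℕ (red x) ℕ.∸ toℕ (red y)) ℤ.+ (x /ℕ n ℤ.- y /ℕ n) ℤ.* + n ∎)
    where
    lemma : ∀ r k s l n → (r ℤ.+ k ℤ.* n) ℤ.- (s ℤ.+ l ℤ.* n) ≡ (r ℤ.- s) ℤ.+ (k ℤ.- l) ℤ.* n
    lemma = solve-∀

  /ℕ-difference-< : ∀ x y → toℕ (red x) ℕ.< toℕ (red y) → (x ℤ.- y) /ℕ n ≡ x /ℕ n ℤ.- y /ℕ n ℤ.+ -1ℤ
  /ℕ-difference-< x y x<y = /ℕ-unique {r = (n ℕ.∸ toℕ (red y)) ℕ.+ toℕ (red x)} _ bound (begin
    x ℤ.- y                                                         ≡⟨ ≡.cong₂ ℤ._-_ (red-divMod x) (red-divMod y) ⟩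
    (+ toℕ (red x) ℤ.+ (x /ℕ n) ℤ.* + n) ℤ.- (+ toℕ (red y) ℤ.+ (y /ℕ n) ℤ.* + n)
                                                                    ≡⟨ lemma (+ toℕ (red x)) (x /ℕ n) (+ toℕ (red y)) (y /ℕ n) (+ n) ⟩
    ((+ n ℤ.- + toℕ (red y)) ℤ.+ + toℕ (red x)) ℤ.+ (x /ℕ n ℤ.- y /ℕ n ℤ.+ -1ℤ) ℤ.* + n
                                                                    ≡⟨ ≡.cong (λ z → (z ℤ.+ + toℕ (red x)) ℤ.+ (x /ℕ n ℤ.- y /ℕ n ℤ.+ -1ℤ) ℤ.* + n) (≡.trans (ℤ.m-n≡m⊖n n (toℕ (red y))) (ℤ.⊖-≥ (ℕ.<⇒≤ (Fin.toℕ<n (red y))))) ⟩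
    + ((n ℕ.∸ toℕ (red y)) ℕ.+ toℕ (red x)) ℤ.+ (x /ℕ n ℤ.- y /ℕ n ℤ.+ -1ℤ) ℤ.* + n ∎)
    where
    lemma : ∀ r k s l n → (r ℤ.+ k ℤ.* n) ℤ.- (s ℤ.+ l ℤ.* n) ≡ ((n ℤ.- s) ℤ.+ r) ℤ.+ (k ℤ.- l ℤ.+ -1ℤ) ℤ.* n
    lemma = solve-∀
    bound : (n ℕ.∸ toℕ (red y)) ℕ.+ toℕ (red x) ℕ.< n
    bound = ≡.subst ((n ℕ.∸ toℕ (red y)) ℕ.+ toℕ (red x) ℕ.<_) (ℕ.m∸n+n≡m (ℕ.<⇒≤ (Fin.toℕ<n (red y)))) (ℕ.+-monoʳ-< (n ℕ.∸ toℕ (red y)) x<y)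

  -- The translation `b` is there because rows and columns are numbered from 1, which makes the
  -- residues those of `a i + a`, and because carries appear as translations in `sgn-aff-product`.
  aff : ℤ → ℤ → Fin n → Fin n
  aff a b i = red (a ℤ.* + toℕ i ℤ.+ b)

  aff-cong : ∀ {a a′ b b′} → a ≡ a′ [mod n ] → b ≡ b′ [mod n ] → ∀ i → aff a b i ≡ aff a′ b′ i
  aff-cong a≡a′ b≡b′ i = red-cong (mod-+ (mod-*ʳ (+ toℕ i) a≡a′) b≡b′)

  aff-∘ : ∀ a b a′ b′ i → aff a b (aff a′ b′ i) ≡ aff (a ℤ.* a′) (a ℤ.* b′ ℤ.+ b) i
  aff-∘ a b a′ b′ i = red-cong (mod-trans (mod-+ʳ b (mod-*ˡ a (red-mod (a′ ℤ.* + toℕ i ℤ.+ b′)))) (≡⇒≡[mod] (lemma a b a′ b′ (+ toℕ i))))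
    where
    lemma : ∀ a b a′ b′ i → a ℤ.* (a′ ℤ.* i ℤ.+ b′) ℤ.+ b ≡ (a ℤ.* a′) ℤ.* i ℤ.+ (a ℤ.* b′ ℤ.+ b)
    lemma = solve-∀

  aff-id : ∀ {a b} → a ≡ 1ℤ [mod n ] → b ≡ 0ℤ [mod n ] → ∀ i → aff a b i ≡ i
  aff-id {a} {b} a≡1 b≡0 i = red-unique i (mod-trans (mod-+ (mod-*ʳ (+ toℕ i) a≡1) b≡0) (≡⇒≡[mod] (lemma (+ toℕ i))))
    where
    lemma : ∀ i → 1ℤ ℤ.* i ℤ.+ 0ℤ ≡ i
    lemma = solve-∀

  aff-inverse : ∀ {a a′} b → a ℤ.* a′ ≡ 1ℤ [mod n ] → ∀ i → aff a b (aff a′ (ℤ.- (a′ ℤ.* b)) i) ≡ i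
  aff-inverse {a} {a′} b aa′≡1 i = ≡.trans (aff-∘ a b a′ (ℤ.- (a′ ℤ.* b)) i)
    (aff-id aa′≡1 (mod-trans (≡⇒≡[mod] (lemma a a′ b)) (mod-trans (mod-+ʳ b (mod-*ʳ (ℤ.- b) aa′≡1)) (≡⇒≡[mod] (lemma′ b)))) i)
    where
    lemma : ∀ a a′ b → a ℤ.* ℤ.- (a′ ℤ.* b) ℤ.+ b ≡ (a ℤ.* a′) ℤ.* ℤ.- b ℤ.+ b
    lemma = solve-∀
    lemma′ : ∀ b → 1ℤ ℤ.* ℤ.- b ℤ.+ b ≡ 0ℤ
    lemma′ = solve-∀

  aff-inverse′ : ∀ {a a′} b → a ℤ.* a′ ≡ 1ℤ [mod n ] → ∀ i → aff a′ (ℤ.- (a′ ℤ.* b)) (aff a b i) ≡ i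
  aff-inverse′ {a} {a′} b aa′≡1 i = ≡.trans (aff-∘ a′ (ℤ.- (a′ ℤ.* b)) a b i)
    (aff-id (mod-trans (≡⇒≡[mod] (ℤ.*-comm a′ a)) aa′≡1) (≡⇒≡[mod] (ℤ.+-inverseʳ (a′ ℤ.* b))) i)

-- Odd numbers and prime moduli.

Odd : ℕ → Set
Odd n = ∃[ h ] n ≡ suc (h ℕ.* 2)

%2≡1⇒odd : ∀ {n} → n ℕ.% 2 ≡ 1 → Odd n
%2≡1⇒odd {n} eq = n ℕ./ 2 , ≡.trans (ℕ.m≡m%n+[m/n]*n n 2) (≡.cong (ℕ._+ n ℕ./ 2 ℕ.* 2) eq)

odd-*ˡ : ∀ m n → (m ℕ.* n) ℕ.% 2 ≡ 1 → m ℕ.% 2 ≡ 1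
odd-*ˡ m n mn%2≡1 with m ℕ.% 2 in eq | ℕ.m%n<n m 2
... | 0 | _ = contradiction (≡.trans (≡.sym mn%2≡1) (ℕ.n∣m⇒m%n≡0 (m ℕ.* n) 2 (ℕ.∣m⇒∣m*n n (ℕ.m%n≡0⇒n∣m m 2 eq)))) λ ()
... | 1 | _ = ≡.refl
... | suc (suc _) | ℕ.s≤s (ℕ.s≤s ())

odd-*ʳ : ∀ m n → (m ℕ.* n) ℕ.% 2 ≡ 1 → n ℕ.% 2 ≡ 1
odd-*ʳ m n mn%2≡1 = odd-*ˡ n m (≡.trans (≡.cong (ℕ._% 2) (ℕ.*-comm n m)) mn%2≡1)

-- The form `3 + 2 s` suits the count for inversion modulo `p`: 3 fixed points and `s` exchanged
-- pairs.
odd-prime≥3 : ∀ {p} → Prime p → Odd p → ∃[ s ] p ≡ suc (suc (suc (s ℕ.* 2)))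
odd-prime≥3 p-prime (zero  , ≡.refl) = contradiction p-prime ¬prime[1]
odd-prime≥3 p-prime (suc s , eq)     = s , eq

mod-≡0⇒∣ : ∀ {n x} → x ≡ 0ℤ [mod n ] → + n ∣ x
mod-≡0⇒∣ {n} {x} (mod n∣x-0) = ≡.subst (+ n ∣_) (ℤ.+-identityʳ x) n∣x-0

∣⇒mod-≡0 : ∀ {n x} → + n ∣ x → x ≡ 0ℤ [mod n ]
∣⇒mod-≡0 {n} {x} n∣x = mod (≡.subst (+ n ∣_) (≡.sym (ℤ.+-identityʳ x)) n∣x)

euclidsLemma-ℤ : ∀ {p} → Prime p → ∀ x y → + p ∣ x ℤ.* y → + p ∣ x ⊎ + p ∣ y
euclidsLemma-ℤ {p} p-prime x y p∣xy = Sum.map ∣ᵤ⇒∣ ∣ᵤ⇒∣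
  (euclidsLemma ℤ.∣ x ∣ ℤ.∣ y ∣ p-prime (≡.subst (p ℕ.∣_) (ℤ.abs-* x y) (∣⇒∣ᵤ p∣xy)))

toℕ≢0⇒∤ : ∀ {n} (i : Fin n) → toℕ i ≢ 0 → ¬ (+ n ∣ + toℕ i)
toℕ≢0⇒∤ {n} i i≢0 n∣i = ℕ.<⇒≱ (Fin.toℕ<n i) (ℕ.∣⇒≤ {{ℕ.≢-nonZero i≢0}} (∣⇒∣ᵤ n∣i))

module _ {p} (p-prime : Prime p) where
  open ≡-Reasoning
  private instance
    p≢0 : NonZero p
    p≢0 = prime⇒nonZero p-prime

  abstract
    fin-inverse : ∀ (i : Fin p) → toℕ i ≢ 0 → ∃[ y ] + toℕ i ℤ.* y ≡ 1ℤ [mod p ]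
    fin-inverse i i≢0 with coprime-Bézout (prime⇒coprime p-prime {{ℕ.≢-nonZero i≢0}} (Fin.toℕ<n i))
    ... | Bézout.+- x y eq = ℤ.- + y , mod (divides (ℤ.- + x) (begin
      + toℕ i ℤ.* ℤ.- + y ℤ.- 1ℤ           ≡⟨ lemma (+ toℕ i) (+ y) ⟩
      ℤ.- (1ℤ ℤ.+ + y ℤ.* + toℕ i)         ≡⟨ ≡.cong (λ z → ℤ.- (1ℤ ℤ.+ z)) (ℤ.pos-* y (toℕ i)) ⟨
      ℤ.- + (1 ℕ.+ y ℕ.* toℕ i)            ≡⟨ ≡.cong (λ z → ℤ.- + z) eq ⟩
      ℤ.- + (x ℕ.* p)                      ≡⟨ ≡.cong ℤ.-_ (ℤ.pos-* x p) ⟩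
      ℤ.- (+ x ℤ.* + p)                    ≡⟨ ℤ.neg-distribˡ-* (+ x) (+ p) ⟩
      ℤ.- + x ℤ.* + p                      ∎))
      where
      lemma : ∀ i y → i ℤ.* ℤ.- y ℤ.- 1ℤ ≡ ℤ.- (1ℤ ℤ.+ y ℤ.* i)
      lemma = solve-∀
    ... | Bézout.-+ x y eq = + y , mod (divides (+ x) (begin
      + toℕ i ℤ.* + y ℤ.- 1ℤ               ≡⟨ ≡.cong (ℤ._- 1ℤ) (ℤ.*-comm (+ toℕ i) (+ y)) ⟩
      + y ℤ.* + toℕ i ℤ.- 1ℤ               ≡⟨ ≡.cong (ℤ._- 1ℤ) (ℤ.pos-* y (toℕ i)) ⟨
      + (y ℕ.* toℕ i) ℤ.- 1ℤ               ≡⟨ ≡.cong (λ z → + z ℤ.- 1ℤ) eq ⟨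
      1ℤ ℤ.+ + (x ℕ.* p) ℤ.- 1ℤ            ≡⟨ ≡.cong (λ z → 1ℤ ℤ.+ z ℤ.- 1ℤ) (ℤ.pos-* x p) ⟩
      1ℤ ℤ.+ + x ℤ.* + p ℤ.- 1ℤ            ≡⟨ lemma (+ x ℤ.* + p) ⟩
      + x ℤ.* + p                          ∎))
      where
      lemma : ∀ z → 1ℤ ℤ.+ z ℤ.- 1ℤ ≡ z
      lemma = solve-∀

  red≢0 : ∀ {x} → ¬ (+ p ∣ x) → toℕ (red p x) ≢ 0
  red≢0 {x} p∤x eq = p∤x (mod-≡0⇒∣ (≡.subst (λ r → x ≡ + r [mod p ]) eq (mod-sym (red-mod p x))))

  mod-inverse : ∀ {x} → ¬ (+ p ∣ x) → ∃[ y ] x ℤ.* y ≡ 1ℤ [mod p ]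
  mod-inverse {x} p∤x = proj₁ r-inverse , mod-trans (mod-*ʳ (proj₁ r-inverse) (mod-sym (red-mod p x))) (proj₂ r-inverse)
    where
    r-inverse : ∃[ y ] + toℕ (red p x) ℤ.* y ≡ 1ℤ [mod p ]
    r-inverse = fin-inverse (red p x) (red≢0 p∤x)

  -- The junk value 0 at 0 makes 0 a fixed point of quotient-map.
  abstract
    inverse-of : Fin p → ℤ
    inverse-of i with toℕ i ℕ.≟ 0
    ... | yes _   = 0ℤ
    ... | no  i≢0 = proj₁ (fin-inverse i i≢0)

    inverse-of-0 : ∀ i → toℕ i ≡ 0 → inverse-of i ≡ 0ℤ
    inverse-of-0 i i≡0 with toℕ i ℕ.≟ 0
    ... | yes _   = ≡.refl
    ... | no  i≢0 = contradiction i≡0 i≢0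

    inverse-of-≢0 : ∀ i → toℕ i ≢ 0 → + toℕ i ℤ.* inverse-of i ≡ 1ℤ [mod p ]
    inverse-of-≢0 i i≢0 with toℕ i ℕ.≟ 0
    ... | yes i≡0  = contradiction i≡0 i≢0
    ... | no  i≢0′ = proj₂ (fin-inverse i i≢0′)

  mod-cancelˡ : ∀ {x y z} → ¬ (+ p ∣ x) → x ℤ.* y ≡ x ℤ.* z [mod p ] → y ≡ z [mod p ]
  mod-cancelˡ {x} {y} {z} p∤x xy≡xz = mod-trans (mod-sym (strip y)) (mod-trans (mod-*ˡ w xy≡xz) (strip z))
    where
    w : ℤ
    w = proj₁ (mod-inverse p∤x)
    xw≡1 : x ℤ.* w ≡ 1ℤ [mod p ]
    xw≡1 = proj₂ (mod-inverse p∤x)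
    lemma : ∀ w x y → w ℤ.* (x ℤ.* y) ≡ (x ℤ.* w) ℤ.* y
    lemma = solve-∀
    strip : ∀ y → w ℤ.* (x ℤ.* y) ≡ y [mod p ]
    strip y = mod-trans (≡⇒≡[mod] (lemma w x y)) (mod-trans (mod-*ʳ y xw≡1) (≡⇒≡[mod] (ℤ.*-identityˡ y)))

  -- Division x ↦ a / x modulo `p`, with 0 ↦ 0. For `a` prime to `p` it is an involution, so that
  -- its sign follows from the number of its fixed points.
  quotient-map : ℤ → Fin p → Fin p
  quotient-map a i = red p (a ℤ.* inverse-of i)

  quotient-map-0 : ∀ a {i} → toℕ i ≡ 0 → quotient-map a i ≡ i
  quotient-map-0 a {i} i≡0 = red-unique p i (≡⇒≡[mod] (begin
    a ℤ.* inverse-of i  ≡⟨ ≡.cong (a ℤ.*_) (inverse-of-0 i i≡0) ⟩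
    a ℤ.* 0ℤ            ≡⟨ ℤ.*-zeroʳ a ⟩
    0ℤ                  ≡⟨ ≡.cong +_ i≡0 ⟨
    + toℕ i             ∎))

  quotient-map-product : ∀ a i → toℕ i ≢ 0 → + toℕ i ℤ.* + toℕ (quotient-map a i) ≡ a [mod p ]
  quotient-map-product a i i≢0 =
    mod-trans (mod-*ˡ (+ toℕ i) (red-mod p (a ℤ.* inverse-of i)))
    (mod-trans (≡⇒≡[mod] (lemma (+ toℕ i) a (inverse-of i)))
    (mod-trans (mod-*ˡ a (inverse-of-≢0 i i≢0)) (≡⇒≡[mod] (ℤ.*-identityʳ a))))
    where
    lemma : ∀ i a y → i ℤ.* (a ℤ.* y) ≡ a ℤ.* (i ℤ.* y)
    lemma = solve-∀

  quotient-map-unique : ∀ a i j → toℕ i ≢ 0 → + toℕ i ℤ.* + toℕ j ≡ a [mod p ] → quotient-map a i ≡ j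
  quotient-map-unique a i j i≢0 ij≡a = toℕ-injective-mod
    (mod-cancelˡ (toℕ≢0⇒∤ i i≢0) (mod-trans (quotient-map-product a i i≢0) (mod-sym ij≡a)))

  quotient-map-involutive : ∀ {a} → ¬ (+ p ∣ a) → ∀ i → quotient-map a (quotient-map a i) ≡ i
  quotient-map-involutive {a} p∤a i with toℕ i ℕ.≟ 0
  ... | yes i≡0 = ≡.trans (≡.cong (quotient-map a) (quotient-map-0 a i≡0)) (quotient-map-0 a i≡0)
  ... | no  i≢0 = quotient-map-unique a (quotient-map a i) i q≢0
                    (mod-trans (≡⇒≡[mod] (ℤ.*-comm (+ toℕ (quotient-map a i)) (+ toℕ i))) (quotient-map-product a i i≢0))
    where
    q≢0 : toℕ (quotient-map a i) ≢ 0
    q≢0 q≡0 = p∤a (mod-≡0⇒∣ (mod-trans (mod-sym (quotient-map-product a i i≢0))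
      (≡⇒≡[mod] (≡.trans (≡.cong (λ r → + toℕ i ℤ.* + r) q≡0) (ℤ.*-zeroʳ (+ toℕ i))))))

  aff∘quotient-map : ∀ a i → aff p a 0ℤ (quotient-map 1ℤ i) ≡ quotient-map a i
  aff∘quotient-map a i = red-cong p
    (mod-trans (mod-+ʳ 0ℤ (mod-*ˡ a (red-mod p (1ℤ ℤ.* inverse-of i)))) (≡⇒≡[mod] (lemma a (inverse-of i))))
    where
    lemma : ∀ a y → a ℤ.* (1ℤ ℤ.* y) ℤ.+ 0ℤ ≡ a ℤ.* y
    lemma = solve-∀

  square≡1 : ∀ {x} → x ℤ.* x ≡ 1ℤ [mod p ] → x ≡ 1ℤ [mod p ] ⊎ x ≡ -1ℤ [mod p ]
  square≡1 {x} (mod p∣x²-1) = Sum.map mod mod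
    (euclidsLemma-ℤ p-prime (x ℤ.- 1ℤ) (x ℤ.- -1ℤ) (≡.subst (+ p ∣_) (lemma x) p∣x²-1))
    where
    lemma : ∀ x → x ℤ.* x ℤ.- 1ℤ ≡ (x ℤ.- 1ℤ) ℤ.* (x ℤ.- -1ℤ)
    lemma = solve-∀

-- Zolotarev's lemma

indicator : ∀ {p} {P : Set p} → Dec P → ℕ
indicator P? = if does P? then 1 else 0

indicator-yes : ∀ {p} {P : Set p} (P? : Dec P) → P → indicator P? ≡ 1
indicator-yes (yes _) _ = ≡.refl
indicator-yes (no ¬P) P = contradiction P ¬P

indicator-no : ∀ {p} {P : Set p} (P? : Dec P) → ¬ P → indicator P? ≡ 0
indicator-no (yes P) ¬P = contradiction P ¬P
indicator-no (no _)  _  = ≡.refl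

sum-indicator-≟ : ∀ {n} (i : Fin n) → sumℕ (λ j → indicator (i Fin.≟ j)) ≡ 1
sum-indicator-≟ {suc n} zero    = ≡.cong suc (sum-0 n)
  where
  sum-0 : ∀ n → sumℕ {n} (λ _ → 0) ≡ 0
  sum-0 zero    = ≡.refl
  sum-0 (suc n) = sum-0 n
sum-indicator-≟ {suc n} (suc i) = sum-indicator-≟ i

sum-ones : ∀ {n} (f : Fin n → ℕ) → (∀ i → f i ≡ 1) → sumℕ f ≡ n
sum-ones {zero}  f f≡1 = ≡.refl
sum-ones {suc n} f f≡1 = ≡.cong₂ ℕ._+_ (f≡1 zero) (sum-ones (f ∘ suc) (f≡1 ∘ suc))

sum-≤ : ∀ {n} (f : Fin n → ℕ) → (∀ i → f i ℕ.≤ 1) → sumℕ f ℕ.≤ n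
sum-≤ {zero}  f f≤1 = ℕ.z≤n
sum-≤ {suc n} f f≤1 = ℕ.+-mono-≤ (f≤1 zero) (sum-≤ (f ∘ suc) (f≤1 ∘ suc))

indicator≤1 : ∀ {p} {P : Set p} (P? : Dec P) → indicator P? ℕ.≤ 1
indicator≤1 (yes _) = ℕ.≤-refl
indicator≤1 (no _)  = ℕ.z≤n

fixed-points : ∀ {n} → (Fin n → Fin n) → ℕ
fixed-points σ = sumℕ λ i → indicator (σ i Fin.≟ i)

-- Undoes one 2-cycle of an involution, as the induction step of `sgn-involution`: `fix-pair` is
-- again an involution, has two more fixed points, and arises from `σ` by exchanging two rows of the
-- 0-1 matrix.
module FixPair {n} (σ : Fin n → Fin n) (σ-inv : ∀ i → σ (σ i) ≡ i) (i : Fin n) (σi≢i : σ i ≢ i) where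
  fix-pair : Fin n → Fin n
  fix-pair j with j Fin.≟ i | j Fin.≟ σ i
  ... | yes _ | _     = j
  ... | no _  | yes _ = j
  ... | no _  | no _  = σ j

  fix-pair-i : fix-pair i ≡ i
  fix-pair-i with i Fin.≟ i | i Fin.≟ σ i
  ... | yes _  | _ = ≡.refl
  ... | no i≢i | _ = contradiction ≡.refl i≢i

  fix-pair-σi : fix-pair (σ i) ≡ σ i
  fix-pair-σi with σ i Fin.≟ i | σ i Fin.≟ σ i
  ... | yes _ | _        = ≡.refl
  ... | no _  | yes _    = ≡.refl
  ... | no _  | no σi≢σi = contradiction ≡.refl σi≢σi

  fix-pair-off : ∀ j → j ≢ i → j ≢ σ i → fix-pair j ≡ σ j
  fix-pair-off j j≢i j≢σi with j Fin.≟ i | j Fin.≟ σ i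
  ... | yes j≡i | _        = contradiction j≡i j≢i
  ... | no _    | yes j≡σi = contradiction j≡σi j≢σi
  ... | no _    | no _     = ≡.refl

  fix-pair-involutive : ∀ j → fix-pair (fix-pair j) ≡ j
  fix-pair-involutive j = by-cases (j Fin.≟ i) (j Fin.≟ σ i)
    where
    by-cases : Dec (j ≡ i) → Dec (j ≡ σ i) → fix-pair (fix-pair j) ≡ j
    by-cases (yes ≡.refl) _            = ≡.trans (≡.cong fix-pair fix-pair-i) fix-pair-i
    by-cases (no _)       (yes ≡.refl) = ≡.trans (≡.cong fix-pair fix-pair-σi) fix-pair-σi
    by-cases (no j≢i)     (no j≢σi)    = ≡.trans (≡.cong fix-pair (fix-pair-off j j≢i j≢σi))
      (≡.trans (fix-pair-off (σ j) (λ σj≡i → j≢σi (≡.trans (≡.sym (σ-inv j)) (≡.cong σ σj≡i)))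
                                   (λ σj≡σi → j≢i (≡.trans (≡.sym (σ-inv j)) (≡.trans (≡.cong σ σj≡σi) (σ-inv i)))))
               (σ-inv j))

  fixed-points-fix-pair : fixed-points fix-pair ≡ fixed-points σ ℕ.+ 2
  fixed-points-fix-pair = begin
    sumℕ (λ j → indicator (fix-pair j Fin.≟ j))
      ≡⟨ sumℕ-cong pointwise ⟩
    sumℕ (λ j → indicator (σ j Fin.≟ j) ℕ.+ (indicator (i Fin.≟ j) ℕ.+ indicator (σ i Fin.≟ j)))
      ≡⟨ sumℕ-+ (λ j → indicator (σ j Fin.≟ j)) (λ j → indicator (i Fin.≟ j) ℕ.+ indicator (σ i Fin.≟ j)) ⟩
    fixed-points σ ℕ.+ sumℕ (λ j → indicator (i Fin.≟ j) ℕ.+ indicator (σ i Fin.≟ j))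
      ≡⟨ ≡.cong (fixed-points σ ℕ.+_) (≡.trans (sumℕ-+ (λ j → indicator (i Fin.≟ j)) (λ j → indicator (σ i Fin.≟ j)))
           (≡.cong₂ ℕ._+_ (sum-indicator-≟ i) (sum-indicator-≟ (σ i)))) ⟩
    fixed-points σ ℕ.+ 2 ∎
    where
    open ≡-Reasoning
    pointwise : ∀ j → indicator (fix-pair j Fin.≟ j) ≡ indicator (σ j Fin.≟ j) ℕ.+ (indicator (i Fin.≟ j) ℕ.+ indicator (σ i Fin.≟ j))
    pointwise j = by-cases (j Fin.≟ i) (j Fin.≟ σ i)
      where
      by-cases : Dec (j ≡ i) → Dec (j ≡ σ i) → _
      by-cases (yes ≡.refl) _            = ≡.trans (indicator-yes (fix-pair j Fin.≟ j) fix-pair-i)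
        (≡.sym (≡.cong₂ ℕ._+_ (indicator-no (σ j Fin.≟ j) σi≢i) (≡.cong₂ ℕ._+_ (indicator-yes (j Fin.≟ j) ≡.refl) (indicator-no (σ j Fin.≟ j) σi≢i))))
      by-cases (no j≢i)     (yes ≡.refl) = ≡.trans (indicator-yes (fix-pair j Fin.≟ j) fix-pair-σi)
        (≡.sym (≡.cong₂ ℕ._+_ (indicator-no (σ j Fin.≟ j) (λ e → σi≢i (≡.trans (≡.sym e) (σ-inv i))))
                              (≡.cong₂ ℕ._+_ (indicator-no (i Fin.≟ j) (j≢i ∘ ≡.sym)) (indicator-yes (j Fin.≟ j) ≡.refl))))
      by-cases (no j≢i)     (no j≢σi)    = ≡.trans (≡.cong (λ k → indicator (k Fin.≟ j)) (fix-pair-off j j≢i j≢σi))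
        (≡.sym (≡.trans (≡.cong (indicator (σ j Fin.≟ j) ℕ.+_) (≡.cong₂ ℕ._+_ (indicator-no (i Fin.≟ j) (j≢i ∘ ≡.sym)) (indicator-no (σ i Fin.≟ j) (j≢σi ∘ ≡.sym))))
                        (ℕ.+-identityʳ _)))

-- Sends `m * s + r` to `p * r + s`. After this change of numbering a map of the leading digit `s`
-- that depends on `r` is blockwise.
transpose-index : ∀ p m → Fin (p ℕ.* m) → Fin (m ℕ.* p)
transpose-index p m x = combine (proj₂ (remQuot {p} m x)) (proj₁ (remQuot {p} m x))

transpose-index-combine : ∀ {p m} (s : Fin p) (r : Fin m) → transpose-index p m (combine s r) ≡ combine r s
transpose-index-combine s r = ≡.cong (λ x → combine (proj₂ x) (proj₁ x)) (Fin.remQuot-combine s r)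

transpose-index-involutive : ∀ p m (x : Fin (p ℕ.* m)) → transpose-index m p (transpose-index p m x) ≡ x
transpose-index-involutive p m x = ≡.trans (transpose-index-combine (proj₂ (remQuot {p} m x)) (proj₁ (remQuot {p} m x))) (Fin.combine-remQuot {p} m x)

module _ {p} (p-prime : Prime p) where
  private
    instance
      p≢0 : NonZero p
      p≢0 = prime⇒nonZero p-prime

    zero-index : Fin p
    zero-index = fromℕ< (ℕ.>-nonZero⁻¹ p)

    toℕ-zero-index : toℕ zero-index ≡ 0
    toℕ-zero-index = Fin.toℕ-fromℕ< (ℕ.>-nonZero⁻¹ p)

    zero-index-unique : ∀ {i} → toℕ i ≡ 0 → zero-index ≡ i
    zero-index-unique i≡0 = Fin.toℕ-injective (≡.trans toℕ-zero-index (≡.sym i≡0))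

    zero-index-≢ : ∀ {i} → toℕ i ≢ 0 → zero-index ≢ i
    zero-index-≢ i≢0 z≡i = i≢0 (≡.trans (≡.cong toℕ (≡.sym z≡i)) toℕ-zero-index)

  fixed⇒square : ∀ a i → toℕ i ≢ 0 → quotient-map p-prime a i ≡ i → + toℕ i ℤ.* + toℕ i ≡ a [mod p ]
  fixed⇒square a i i≢0 eq = ≡.subst (λ j → + toℕ i ℤ.* + toℕ j ≡ a [mod p ]) eq (quotient-map-product p-prime a i i≢0)

  fixed-points-nonresidue : ∀ {a} → (∀ (x : Fin p) → ¬ (+ p ∣ + toℕ x ℤ.* + toℕ x ℤ.- a)) → fixed-points (quotient-map p-prime a) ≡ 1
  fixed-points-nonresidue {a} nonresidue = ≡.trans (sumℕ-cong pointwise) (sum-indicator-≟ zero-index)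
    where
    pointwise : ∀ i → indicator (quotient-map p-prime a i Fin.≟ i) ≡ indicator (zero-index Fin.≟ i)
    pointwise i = by-cases (toℕ i ℕ.≟ 0)
      where
      by-cases : Dec (toℕ i ≡ 0) → indicator (quotient-map p-prime a i Fin.≟ i) ≡ indicator (zero-index Fin.≟ i)
      by-cases (yes i≡0) = ≡.trans (indicator-yes (quotient-map p-prime a i Fin.≟ i) (quotient-map-0 p-prime a i≡0))
                                   (≡.sym (indicator-yes (zero-index Fin.≟ i) (zero-index-unique i≡0)))
      by-cases (no i≢0)  = ≡.trans (indicator-no (quotient-map p-prime a i Fin.≟ i) (λ eq → nonresidue i (_≡_[mod_].divisible (fixed⇒square a i i≢0 eq))))
                                   (≡.sym (indicator-no (zero-index Fin.≟ i) (zero-index-≢ i≢0)))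

  module _ (p≥3 : 3 ℕ.≤ p) where
    private
      ∤small : ∀ {x} → ℤ.∣ x ∣ ℕ.< 3 → .{{NonZero ℤ.∣ x ∣}} → ¬ (+ p ∣ x)
      ∤small x<3 p∣x = ℕ.<⇒≱ x<3 (ℕ.≤-trans p≥3 (ℕ.∣⇒≤ (∣⇒∣ᵤ p∣x)))

    p∤1 : ¬ (+ p ∣ 1ℤ)
    p∤1 = ∤small (ℕ.s≤s (ℕ.s≤s ℕ.z≤n))

    -- The fixed points are 0 and the square roots 1 and -1 of 1. They are distinct because a prime
    -- `p ≥ 3` divides none of 1, -1 and 2.
    fixed-points-inversion : fixed-points (quotient-map p-prime 1ℤ) ≡ 3
    fixed-points-inversion = begin
      fixed-points (quotient-map p-prime 1ℤ)
        ≡⟨ sumℕ-cong pointwise ⟩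
      sumℕ (λ i → indicator (zero-index Fin.≟ i) ℕ.+ (indicator (one Fin.≟ i) ℕ.+ indicator (neg Fin.≟ i)))
        ≡⟨ sumℕ-+ (λ i → indicator (zero-index Fin.≟ i)) (λ i → indicator (one Fin.≟ i) ℕ.+ indicator (neg Fin.≟ i)) ⟩
      sumℕ (λ i → indicator (zero-index Fin.≟ i)) ℕ.+ sumℕ (λ i → indicator (one Fin.≟ i) ℕ.+ indicator (neg Fin.≟ i))
        ≡⟨ ≡.cong₂ ℕ._+_ (sum-indicator-≟ zero-index) (≡.trans (sumℕ-+ (λ i → indicator (one Fin.≟ i)) (λ i → indicator (neg Fin.≟ i)))
             (≡.cong₂ ℕ._+_ (sum-indicator-≟ one) (sum-indicator-≟ neg))) ⟩
      3 ∎
      where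
      open ≡-Reasoning
      one neg : Fin p
      one = red p 1ℤ
      neg = red p -1ℤ
      one≢0 : toℕ one ≢ 0
      one≢0 = red≢0 p-prime p∤1
      neg≢0 : toℕ neg ≢ 0
      neg≢0 = red≢0 p-prime (∤small (ℕ.s≤s (ℕ.s≤s ℕ.z≤n)))
      one≢neg : one ≢ neg
      one≢neg eq = ∤small (ℕ.s≤s (ℕ.s≤s (ℕ.s≤s ℕ.z≤n))) (_≡_[mod_].divisible (red-cancel p {1ℤ} { -1ℤ} eq))
      fixed-unit : ∀ x → x ℤ.* x ≡ 1ℤ → toℕ (red p x) ≢ 0 → quotient-map p-prime 1ℤ (red p x) ≡ red p x
      fixed-unit x x²≡1 x≢0 = quotient-map-unique p-prime 1ℤ (red p x) (red p x) x≢0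
        (mod-trans (mod-* (red-mod p x) (red-mod p x)) (≡⇒≡[mod] x²≡1))
      pointwise : ∀ i → indicator (quotient-map p-prime 1ℤ i Fin.≟ i) ≡ indicator (zero-index Fin.≟ i) ℕ.+ (indicator (one Fin.≟ i) ℕ.+ indicator (neg Fin.≟ i))
      pointwise i = by-cases (toℕ i ℕ.≟ 0) (one Fin.≟ i) (neg Fin.≟ i)
        where
        by-cases : Dec (toℕ i ≡ 0) → (one? : Dec (one ≡ i)) (neg? : Dec (neg ≡ i)) →
                   indicator (quotient-map p-prime 1ℤ i Fin.≟ i) ≡ indicator (zero-index Fin.≟ i) ℕ.+ (indicator one? ℕ.+ indicator neg?)
        by-cases (yes i≡0) (yes ≡.refl) _            = contradiction i≡0 one≢0
        by-cases (yes i≡0) (no _)       (yes ≡.refl) = contradiction i≡0 neg≢0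
        by-cases (yes i≡0) (no _)       (no _)       =
          ≡.trans (indicator-yes (quotient-map p-prime 1ℤ i Fin.≟ i) (quotient-map-0 p-prime 1ℤ i≡0))
                  (≡.sym (≡.cong (ℕ._+ 0) (indicator-yes (zero-index Fin.≟ i) (zero-index-unique i≡0))))
        by-cases (no i≢0) (yes one≡i) (yes neg≡i) = contradiction (≡.trans one≡i (≡.sym neg≡i)) one≢neg
        by-cases (no i≢0) (yes ≡.refl) (no _) =
          ≡.trans (indicator-yes (quotient-map p-prime 1ℤ i Fin.≟ i) (fixed-unit 1ℤ ≡.refl i≢0))
                  (≡.sym (≡.cong (ℕ._+ 1) (indicator-no (zero-index Fin.≟ i) (zero-index-≢ i≢0))))
        by-cases (no i≢0) (no _) (yes ≡.refl) =
          ≡.trans (indicator-yes (quotient-map p-prime 1ℤ i Fin.≟ i) (fixed-unit -1ℤ ≡.refl i≢0))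
                  (≡.sym (≡.cong (ℕ._+ 1) (indicator-no (zero-index Fin.≟ i) (zero-index-≢ i≢0))))
        by-cases (no i≢0) (no one≢i) (no neg≢i) =
          ≡.trans (indicator-no (quotient-map p-prime 1ℤ i Fin.≟ i) not-fixed)
                  (≡.sym (≡.cong (ℕ._+ 0) (indicator-no (zero-index Fin.≟ i) (zero-index-≢ i≢0))))
          where
          not-fixed : quotient-map p-prime 1ℤ i ≢ i
          not-fixed eq = Sum.[ (λ i≡1 → one≢i (red-unique p i (mod-sym i≡1))) , (λ i≡-1 → neg≢i (red-unique p i (mod-sym i≡-1))) ]
            (square≡1 p-prime {+ toℕ i} (fixed⇒square 1ℤ i i≢0 eq))

-- The sign of multiplication modulo an odd number.

module Zolotarev {c ℓ} (R : CommutativeRing c ℓ) where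
  open CommutativeRing R hiding (zero)
  open Determinants R public
  open RingProperties ring
  open SetoidReasoning setoid

  -- Induction on the number `t` of 2-cycles; each is removed by `fix-pair` at the cost of one sign.
  sgn-involution : ∀ t {n} (σ : Fin n → Fin n) → (∀ i → σ (σ i) ≡ i) → fixed-points σ ℕ.+ t ℕ.* 2 ≡ n → sgn σ ≈ (- 1#) ^ t
  sgn-involution t {n} σ σ-inv count with Fin.any? (λ i → ¬? (σ i Fin.≟ i))
  ... | no none = trans (trans (sgn-cong all-fixed) (det-δ n)) (reflexive (≡.cong ((- 1#) ^_) (≡.sym t≡0)))
    where
    all-fixed : ∀ i → σ i ≡ i
    all-fixed i = decidable-stable (σ i Fin.≟ i) (λ σi≢i → none (i , σi≢i))
    t≡0 : t ≡ 0
    t≡0 = ℕ.m*n≡0⇒m≡0 t 2 (ℕ.+-cancelˡ-≡ n _ _ (≡.trans (≡.cong (ℕ._+ t ℕ.* 2) (≡.sym (sum-ones _ (λ i → indicator-yes (σ i Fin.≟ i) (all-fixed i)))))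
            (≡.trans count (≡.sym (ℕ.+-identityʳ n)))))
  ... | yes (i , σi≢i) = by-pairs t count
    where
    open FixPair σ σ-inv i σi≢i
    by-pairs : ∀ t → fixed-points σ ℕ.+ t ℕ.* 2 ≡ n → sgn σ ≈ (- 1#) ^ t
    -- A moved point without any pair is absurd: `fix-pair` would have `n + 2` fixed points among
    -- `n`.
    by-pairs zero count = contradiction
      (≡.subst (ℕ._≤ n) (≡.trans fixed-points-fix-pair (≡.cong (ℕ._+ 2) (≡.trans (≡.sym (ℕ.+-identityʳ _)) count)))
        (sum-≤ _ (λ j → indicator≤1 (fix-pair j Fin.≟ j))))
      (ℕ.m+1+n≰m n)
    by-pairs (suc t) count = begin
      sgn σ            ≈⟨ swap multilinear (σi≢i ∘ ≡.sym) (alternates (σi≢i ∘ ≡.sym))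
                            (λ j → reflexive (≡.cong (λ k → δ k j) (≡.sym fix-pair-σi)))
                            (λ j → reflexive (≡.cong (λ k → δ k j) (≡.trans (σ-inv i) (≡.sym fix-pair-i))))
                            (λ k k≢i k≢σi j → reflexive (≡.cong (λ l → δ l j) (≡.sym (fix-pair-off k k≢i k≢σi)))) ⟩
      - sgn fix-pair   ≈⟨ -‿cong (sgn-involution t fix-pair fix-pair-involutive
                            (≡.trans (≡.cong (ℕ._+ t ℕ.* 2) fixed-points-fix-pair) (≡.trans (ℕ.+-assoc (fixed-points σ) 2 (t ℕ.* 2)) count))) ⟩
      - ((- 1#) ^ t)   ≈⟨ -1*x≈-x _ ⟨
      (- 1#) ^ suc t   ∎
      where open Alternating (det-alternating {n})

  -- Equality with an integer in {0, 1, -1}, the only values of the symbols.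
  data Represents (x : Carrier) : ℤ → Set (c ⊔ ℓ) where
    rep-0  : x ≈ 0#   → Represents x 0ℤ
    rep-1  : x ≈ 1#   → Represents x 1ℤ
    rep--1 : x ≈ - 1# → Represents x -1ℤ

  represents-cong : ∀ {x y i} → x ≈ y → Represents y i → Represents x i
  represents-cong x≈y (rep-0 y≈)  = rep-0 (trans x≈y y≈)
  represents-cong x≈y (rep-1 y≈)  = rep-1 (trans x≈y y≈)
  represents-cong x≈y (rep--1 y≈) = rep--1 (trans x≈y y≈)

  represents-* : ∀ {x y i j} → Represents x i → Represents y j → Represents (x * y) (i ℤ.* j)
  represents-* (rep-0 x≈)  _           = rep-0 (trans (*-congʳ x≈) (zeroˡ _))
  represents-* (rep-1 x≈) (rep-0 y≈)   = rep-0 (trans (*-cong x≈ y≈) (zeroʳ _))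
  represents-* (rep-1 x≈) (rep-1 y≈)   = rep-1 (trans (*-cong x≈ y≈) (*-identityˡ _))
  represents-* (rep-1 x≈) (rep--1 y≈)  = rep--1 (trans (*-cong x≈ y≈) (*-identityˡ _))
  represents-* (rep--1 x≈) (rep-0 y≈)  = rep-0 (trans (*-cong x≈ y≈) (zeroʳ _))
  represents-* (rep--1 x≈) (rep-1 y≈)  = rep--1 (trans (*-cong x≈ y≈) (*-identityʳ _))
  represents-* (rep--1 x≈) (rep--1 y≈) = rep-1 (trans (*-cong x≈ y≈) (trans (-1*x≈-x _) (-‿involutive _)))

  -- True of 0, 1 and -1 alike. Thus `product-odd` can reduce an odd power of a sign to the sign
  -- even if it vanishes.
  represents-cube : ∀ {x i} → Represents x i → x * (x * x) ≈ x
  represents-cube (rep-0 x≈)  = trans (*-congʳ x≈) (trans (zeroˡ _) (sym x≈))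
  represents-cube (rep-1 x≈)  = trans (*-cong x≈ (*-cong x≈ x≈)) (trans (solve 0 (con (+ 1) :* (con (+ 1) :* con (+ 1)) := con (+ 1)) refl) (sym x≈))
  represents-cube (rep--1 x≈) = trans (*-cong x≈ (*-cong x≈ x≈)) (trans (solve 0 (:- con (+ 1) :* (:- con (+ 1) :* :- con (+ 1)) := :- con (+ 1)) refl) (sym x≈))

  product-odd : ∀ {k x} {f : Vector Carrier k} → x * (x * x) ≈ x → Odd k → (∀ i → f i ≈ x) → product f ≈ x
  product-odd {x = x} x³≈x (h , ≡.refl) f≈x = trans (product-cong f≈x) (go h)
    where
    go : ∀ h → product {suc (h ℕ.* 2)} (λ _ → x) ≈ x
    go zero    = *-identityʳ x
    go (suc h) = trans (*-congˡ (*-congˡ (go h))) x³≈x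

  module _ (n : ℕ) .{{_ : NonZero n}} where
    sgn-aff-square : ∀ {a a′} b → a ℤ.* a′ ≡ 1ℤ [mod n ] → sgn (aff n a b) * sgn (aff n a b) ≈ 1#
    sgn-aff-square {a} {a′} b aa′≡1 = sgn-square (aff n a b) (aff n a′ (ℤ.- (a′ ℤ.* b))) (aff-inverse′ n {a} {a′} b aa′≡1) (aff-inverse n {a} {a′} b aa′≡1)

    -- A translation of ℤ/n is the square of another one, as 2 is invertible.
    sgn-translation : Odd n → ∀ b → sgn (aff n 1ℤ b) ≈ 1#
    sgn-translation (h , n≡1+2h) b = begin
      sgn (aff n 1ℤ b)
        ≈⟨ sgn-cong (λ i → ≡.sym (≡.trans (aff-∘ n 1ℤ γ 1ℤ γ i) (aff-cong n {1ℤ} mod-refl 2γ≡b i))) ⟩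
      sgn (aff n 1ℤ γ ∘ aff n 1ℤ γ)           ≈⟨ sgn-∘ (aff n 1ℤ γ) (aff n 1ℤ γ) ⟩
      sgn (aff n 1ℤ γ) * sgn (aff n 1ℤ γ)     ≈⟨ sgn-aff-square {1ℤ} {1ℤ} γ mod-refl ⟩
      1#                                      ∎
      where
      γ : ℤ
      -- As `n = 1 + 2 h`, the inverse of 2 modulo `n` is `- h`.
      γ = b ℤ.* ℤ.- + h
      lemma : ∀ b h n → n ≡ 1ℤ ℤ.+ h ℤ.* + 2 → 1ℤ ℤ.* (b ℤ.* ℤ.- h) ℤ.+ b ℤ.* ℤ.- h ℤ.- b ≡ ℤ.- b ℤ.* n
      lemma b h .(1ℤ ℤ.+ h ℤ.* + 2) ≡.refl = lemma′ b h
        where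
        lemma′ : ∀ b h → 1ℤ ℤ.* (b ℤ.* ℤ.- h) ℤ.+ b ℤ.* ℤ.- h ℤ.- b ≡ ℤ.- b ℤ.* (1ℤ ℤ.+ h ℤ.* + 2)
        lemma′ = solve-∀
      2γ≡b : 1ℤ ℤ.* γ ℤ.+ γ ≡ b [mod n ]
      2γ≡b = mod (divides (ℤ.- b) (lemma b (+ h) (+ n) (≡.trans (≡.cong +_ n≡1+2h) (≡.cong (λ z → 1ℤ ℤ.+ z) (ℤ.pos-* h 2)))))

    sgn-aff : Odd n → ∀ a b → sgn (aff n a b) ≈ sgn (aff n a 0ℤ)
    sgn-aff n-odd a b = begin
      sgn (aff n a b)
        ≈⟨ sgn-cong (λ i → ≡.sym (≡.trans (aff-∘ n 1ℤ b a 0ℤ i) (aff-cong n (≡⇒≡[mod] (ℤ.*-identityˡ a)) (≡⇒≡[mod] (ℤ.+-identityˡ b)) i))) ⟩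
      sgn (aff n 1ℤ b ∘ aff n a 0ℤ)           ≈⟨ sgn-∘ (aff n a 0ℤ) (aff n 1ℤ b) ⟩
      sgn (aff n a 0ℤ) * sgn (aff n 1ℤ b)     ≈⟨ *-congˡ (sgn-translation n-odd b) ⟩
      sgn (aff n a 0ℤ) * 1#                   ≈⟨ *-identityʳ _ ⟩
      sgn (aff n a 0ℤ)                        ∎

    sgn-aff-* : ∀ a a′ → sgn (aff n (a ℤ.* a′) 0ℤ) ≈ sgn (aff n a 0ℤ) * sgn (aff n a′ 0ℤ)
    sgn-aff-* a a′ = begin
      sgn (aff n (a ℤ.* a′) 0ℤ)
        ≈⟨ sgn-cong (λ i → ≡.sym (≡.trans (aff-∘ n a 0ℤ a′ 0ℤ i) (aff-cong n {a ℤ.* a′} mod-refl (≡⇒≡[mod] (≡.trans (ℤ.+-identityʳ _) (ℤ.*-zeroʳ a))) i))) ⟩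
      sgn (aff n a 0ℤ ∘ aff n a′ 0ℤ)          ≈⟨ sgn-∘ (aff n a′ 0ℤ) (aff n a 0ℤ) ⟩
      sgn (aff n a′ 0ℤ) * sgn (aff n a 0ℤ)    ≈⟨ *-comm _ _ ⟩
      sgn (aff n a 0ℤ) * sgn (aff n a′ 0ℤ)    ∎

  -- Writing x = m s + r, multiplication by a sends r to a r mod m and s to
  -- a s + ⌊a r / m⌋ mod p.
  module _ (p m : ℕ) .{{_ : NonZero p}} .{{_ : NonZero m}} .{{_ : NonZero (p ℕ.* m)}} (a : ℤ) where
    private
      τ : Fin m → Fin p → Fin p
      τ r = aff p a ((a ℤ.* + toℕ r ℤ.+ 0ℤ) /ℕ m)

      -- The carry into the leading digit depends on the old trailing digit `r`, so `high` has to
      -- act before `low` replaces it.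
      low high : Fin (p ℕ.* m) → Fin (p ℕ.* m)
      low = blockwise {p} {m} (λ _ → aff m a 0ℤ)
      high = transpose-index m p ∘ blockwise {m} {p} τ ∘ transpose-index p m

      low∘high-combine : ∀ s r → low (high (combine s r)) ≡ combine (τ r s) (aff m a 0ℤ r)
      low∘high-combine s r = ≡.trans (≡.cong low high-combine) (≡.cong (λ x → combine (proj₁ x) (aff m a 0ℤ (proj₂ x))) (Fin.remQuot-combine (τ r s) r))
        where
        high-combine : high (combine s r) ≡ combine (τ r s) r
        high-combine = ≡.trans (≡.cong (transpose-index m p ∘ blockwise {m} {p} τ) (transpose-index-combine s r))
          (≡.trans (≡.cong (λ x → transpose-index m p (combine (proj₁ x) (τ (proj₁ x) (proj₂ x)))) (Fin.remQuot-combine r s))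
                   (transpose-index-combine r (τ r s)))

      aff-combine : ∀ s r → aff (p ℕ.* m) a 0ℤ (combine s r) ≡ combine (τ r s) (aff m a 0ℤ r)
      aff-combine s r = red-unique (p ℕ.* m) (combine (τ r s) (aff m a 0ℤ r)) (congruence (red-mod p (a ℤ.* + toℕ s ℤ.+ c′)))
        where
        c′ : ℤ
        c′ = (a ℤ.* + toℕ r ℤ.+ 0ℤ) /ℕ m
        r′ : Fin m
        r′ = aff m a 0ℤ r
        toℤ-combine : ∀ (s : Fin p) (r : Fin m) → + toℕ (combine s r) ≡ + m ℤ.* + toℕ s ℤ.+ + toℕ r
        toℤ-combine s r = ≡.trans (≡.cong +_ (Fin.toℕ-combine s r)) (≡.cong (ℤ._+ + toℕ r) (ℤ.pos-* m (toℕ s)))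
        lemma₁ : ∀ a m s r s′ r′ → a ℤ.* (m ℤ.* s ℤ.+ r) ℤ.+ 0ℤ ℤ.- (m ℤ.* s′ ℤ.+ r′) ≡ a ℤ.* m ℤ.* s ℤ.+ (a ℤ.* r ℤ.+ 0ℤ) ℤ.- (m ℤ.* s′ ℤ.+ r′)
        lemma₁ = solve-∀
        lemma₂ : ∀ a m s c s′ r′ → a ℤ.* m ℤ.* s ℤ.+ (r′ ℤ.+ c ℤ.* m) ℤ.- (m ℤ.* s′ ℤ.+ r′) ≡ ℤ.- (s′ ℤ.- (a ℤ.* s ℤ.+ c)) ℤ.* m
        lemma₂ = solve-∀
        lemma₃ : ∀ k p m → ℤ.- (k ℤ.* p) ℤ.* m ≡ ℤ.- k ℤ.* (p ℤ.* m)
        lemma₃ = solve-∀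
        congruence : + toℕ (τ r s) ≡ a ℤ.* + toℕ s ℤ.+ c′ [mod p ] → a ℤ.* + toℕ (combine s r) ℤ.+ 0ℤ ≡ + toℕ (combine (τ r s) r′) [mod p ℕ.* m ]
        -- Once the carry `c′` is included, the trailing digits agree and the leading ones differ by
        -- `k p`, so the numbers differ by `- k (p m)`.
        congruence (mod (divides k eq)) = mod (divides (ℤ.- k) (
          ≡.trans (≡.cong₂ (λ x y → a ℤ.* x ℤ.+ 0ℤ ℤ.- y) (toℤ-combine s r) (toℤ-combine (τ r s) r′))
          (≡.trans (lemma₁ a (+ m) (+ toℕ s) (+ toℕ r) (+ toℕ (τ r s)) (+ toℕ r′))
          (≡.trans (≡.cong (λ x → a ℤ.* + m ℤ.* + toℕ s ℤ.+ x ℤ.- (+ m ℤ.* + toℕ (τ r s) ℤ.+ + toℕ r′)) (red-divMod m (a ℤ.* + toℕ r ℤ.+ 0ℤ)))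
          (≡.trans (lemma₂ a (+ m) (+ toℕ s) c′ (+ toℕ (τ r s)) (+ toℕ r′))
          (≡.trans (≡.cong (λ x → ℤ.- x ℤ.* + m) eq)
          (≡.trans (lemma₃ k (+ p) (+ m)) (≡.cong (ℤ.- k ℤ.*_) (≡.sym (ℤ.pos-* p m))))))))))

    -- `high` consists of `m` maps of the leading digit, with various translations, which do not
    -- affect the sign; `low` consists of `p` copies of one map. As `m` and `p` are odd and each
    -- sign equals its cube, a single factor remains of each product.
    sgn-aff-product : Odd p → Odd m → ∀ {i j} → Represents (sgn (aff p a 0ℤ)) i → Represents (sgn (aff m a 0ℤ)) j →
                      sgn (aff (p ℕ.* m) a 0ℤ) ≈ sgn (aff p a 0ℤ) * sgn (aff m a 0ℤ)
    sgn-aff-product p-odd m-odd p∼ m∼ = begin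
      sgn (aff (p ℕ.* m) a 0ℤ)
        ≈⟨ sgn-cong (λ x → ≡.subst (λ x → aff (p ℕ.* m) a 0ℤ x ≡ low (high x)) (Fin.combine-remQuot {p} m x)
                                                   (≡.trans (aff-combine _ _) (≡.sym (low∘high-combine (proj₁ (remQuot {p} m x)) (proj₂ (remQuot {p} m x)))))) ⟩
      sgn (low ∘ high)                       ≈⟨ sgn-∘ high low ⟩
      sgn high * sgn low
        ≈⟨ *-cong (sgn-conjugate (ℕ.*-comm p m) (transpose-index p m) (transpose-index m p) (transpose-index-involutive p m) (blockwise {m} {p} τ)) refl ⟩
      sgn (blockwise {m} {p} τ) * sgn low    ≈⟨ *-cong (sgn-blockwise τ) (sgn-blockwise {p} {m} (λ _ → aff m a 0ℤ)) ⟩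
      product (λ r → sgn (τ r)) * product {p} (λ _ → sgn (aff m a 0ℤ))
                                             ≈⟨ *-cong (product-odd (represents-cube p∼) m-odd (λ r → sgn-aff p p-odd a _))
                                                       (product-odd (represents-cube m∼) p-odd (λ _ → refl)) ⟩
      sgn (aff p a 0ℤ) * sgn (aff m a 0ℤ)    ∎

  represents-if : ∀ {x p q} {P : Set p} {Q : Set q} (P? : Dec P) (Q? : Dec Q) →
                  (P → x ≈ 0#) → (¬ P → Q → x ≈ 1#) → (¬ P → ¬ Q → x ≈ - 1#) →
                  Represents x (if does P? then 0ℤ else if does Q? then 1ℤ else -1ℤ)
  represents-if (yes P) _       x≈0 _   _    = rep-0 (x≈0 P)
  represents-if (no ¬P) (yes Q) _   x≈1 _    = rep-1 (x≈1 ¬P Q)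
  represents-if (no ¬P) (no ¬Q) _   _   x≈-1 = rep--1 (x≈-1 ¬P ¬Q)

  module _ {p} (p-prime : Prime p) (s : ℕ) (p≡ : p ≡ suc (suc (suc (s ℕ.* 2)))) where
    private
      instance
        p≢0 : NonZero p
        p≢0 = prime⇒nonZero p-prime

      p≥3 : 3 ℕ.≤ p
      p≥3 = ≡.subst (3 ℕ.≤_) (≡.sym p≡) (ℕ.s≤s (ℕ.s≤s (ℕ.s≤s ℕ.z≤n)))

    -- The map is constant, so its 0-1 matrix has equal rows.
    sgn-aff-∣ : ∀ {a} → + p ∣ a → sgn (aff p a 0ℤ) ≈ 0#
    sgn-aff-∣ {a} p∣a = Alternating.alternates (det-alternating {p}) 0≢1
      (λ j → reflexive (≡.cong (λ k → δ k j) (red-cong p (mod-trans (vanishes 0F) (mod-sym (vanishes 1F))))))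
      where
      0F 1F : Fin p
      0F = fromℕ< (ℕ.≤-trans (ℕ.s≤s ℕ.z≤n) p≥3)
      1F = fromℕ< (ℕ.≤-trans (ℕ.s≤s (ℕ.s≤s ℕ.z≤n)) p≥3)
      0≢1 : 0F ≢ 1F
      0≢1 eq = contradiction (≡.trans (≡.sym (Fin.toℕ-fromℕ< _)) (≡.trans (≡.cong toℕ eq) (Fin.toℕ-fromℕ< _))) λ ()
      vanishes : ∀ i → a ℤ.* + toℕ i ℤ.+ 0ℤ ≡ 0ℤ [mod p ]
      vanishes i = mod-trans (≡⇒≡[mod] (ℤ.+-identityʳ (a ℤ.* + toℕ i))) (∣⇒mod-≡0 (∣m⇒∣m*n (+ toℕ i) p∣a))

    -- Multiplication by a square `x²` is the square of multiplication by `x`, a permutation, and so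
    -- has the square of a sign.
    sgn-aff-residue : ∀ {a} → ¬ (+ p ∣ a) → ∃[ x ] (+ p ∣ + toℕ {p} x ℤ.* + toℕ x ℤ.- a) → sgn (aff p a 0ℤ) ≈ 1#
    sgn-aff-residue {a} p∤a (i , p∣x²-a) = begin
      sgn (aff p a 0ℤ)                      ≈⟨ sgn-cong (aff-cong p {a} {x ℤ.* x} (mod-sym x²≡a) mod-refl) ⟩
      sgn (aff p (x ℤ.* x) 0ℤ)              ≈⟨ sgn-aff-* p x x ⟩
      sgn (aff p x 0ℤ) * sgn (aff p x 0ℤ)   ≈⟨ sgn-aff-square p {x} 0ℤ (proj₂ (mod-inverse p-prime p∤x)) ⟩
      1#                                    ∎
      where
      x : ℤ
      x = + toℕ i
      x²≡a : x ℤ.* x ≡ a [mod p ]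
      x²≡a = mod p∣x²-a
      p∤x : ¬ (+ p ∣ x)
      p∤x p∣x = p∤a (mod-≡0⇒∣ (mod-trans (mod-sym x²≡a) (∣⇒mod-≡0 (∣m⇒∣m*n x p∣x))))

    -- Multiplication by a is x ↦ a / x after x ↦ 1 / x; these involutions
    -- have 1 and 3 fixed points, so their signs are opposite.
    sgn-aff-nonresidue : ∀ {a} → ¬ (+ p ∣ a) → ¬ (∃[ x ] (+ p ∣ + toℕ {p} x ℤ.* + toℕ x ℤ.- a)) → sgn (aff p a 0ℤ) ≈ - 1#
    sgn-aff-nonresidue {a} p∤a nonresidue = begin
      x               ≈⟨ trans (*-congʳ e²≈1) (*-identityˡ x) ⟨
      (e * e) * x     ≈⟨ *-assoc e e x ⟩
      e * (e * x)     ≈⟨ *-congˡ (sgn-∘ (quotient-map p-prime 1ℤ) (aff p a 0ℤ)) ⟨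
      e * sgn (aff p a 0ℤ ∘ quotient-map p-prime 1ℤ) ≈⟨ *-congˡ (sgn-cong (aff∘quotient-map p-prime a)) ⟩
      e * sgn (quotient-map p-prime a)
        -- One fixed point among `3 + 2 s` leaves `suc s` pairs; three, as in `e≈` below, leave `s`.
        ≈⟨ *-congˡ (sgn-involution (suc s) (quotient-map p-prime a) (quotient-map-involutive p-prime p∤a)
                                                (≡.trans (≡.cong (ℕ._+ suc s ℕ.* 2) (fixed-points-nonresidue p-prime (λ x p∣ → nonresidue (x , p∣)))) (≡.sym p≡))) ⟩
      e * (- 1# * (- 1#) ^ s)     ≈⟨ *-congˡ (*-congˡ e≈) ⟨
      e * (- 1# * e)              ≈⟨ solve 1 (λ e → e :* (:- con (+ 1) :* e) := :- (e :* e)) refl e ⟩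
      - (e * e)                   ≈⟨ -‿cong e²≈1 ⟩
      - 1#                        ∎
      where
      x e : Carrier
      x = sgn (aff p a 0ℤ)
      e = sgn (quotient-map p-prime 1ℤ)
      p∤1ℤ : ¬ (+ p ∣ 1ℤ)
      p∤1ℤ = p∤1 p-prime p≥3
      e≈ : e ≈ (- 1#) ^ s
      e≈ = sgn-involution s (quotient-map p-prime 1ℤ) (quotient-map-involutive p-prime p∤1ℤ)
             (≡.trans (≡.cong (ℕ._+ s ℕ.* 2) (fixed-points-inversion p-prime p≥3)) (≡.sym p≡))
      e²≈1 : e * e ≈ 1#
      e²≈1 = sgn-inverse (quotient-map p-prime 1ℤ) (quotient-map p-prime 1ℤ) (quotient-map-involutive p-prime p∤1ℤ)

    sgn-aff-legendre : ∀ a → Represents (sgn (aff p a 0ℤ)) (legendre a p)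
    sgn-aff-legendre a = represents-if (+ p ∣? a) (Fin.any? {n = p} λ x → + p ∣? (+ toℕ x ℤ.* + toℕ x ℤ.- a))
      sgn-aff-∣ sgn-aff-residue sgn-aff-nonresidue

  -- One prime is split off at a time. `sgn-aff-product` rests on mixed-radix digits and not on the
  -- Chinese remainder theorem, so a prime may occur repeatedly.
  sgn-aff-legendres : ∀ a {ps} → All Prime ps → ℕ.product ps ℕ.% 2 ≡ 1 → .{{_ : NonZero (ℕ.product ps)}} →
                      Represents (sgn (aff (ℕ.product ps) a 0ℤ)) (foldr ℤ._*_ 1ℤ (map (legendre a) ps))
  sgn-aff-legendres a [] _ = rep-1 (trans (sgn-cong one-point) (det-δ 1))
    where
    one-point : ∀ i → aff 1 a 0ℤ i ≡ i
    one-point zero with aff 1 a 0ℤ zero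
    ... | zero = ≡.refl
  sgn-aff-legendres a {p ∷ ps} (p-prime ∷ ps-prime) odd with odd-prime≥3 p-prime (%2≡1⇒odd (odd-*ˡ p (ℕ.product ps) odd))
  ... | s , p≡ = represents-cong (sgn-aff-product p (ℕ.product ps) a (suc s , p≡) (%2≡1⇒odd ps-odd) p∼ ps∼) (represents-* p∼ ps∼)
    where
    instance
      _ = prime⇒nonZero p-prime
      ps≢0 : NonZero (ℕ.product ps)
      ps≢0 = ℕ.m*n≢0⇒n≢0 p
    ps-odd : ℕ.product ps ℕ.% 2 ≡ 1
    ps-odd = odd-*ʳ p (ℕ.product ps) odd
    p∼ : Represents (sgn (aff p a 0ℤ)) (legendre a p)
    p∼ = sgn-aff-legendre p-prime s p≡ a
    ps∼ : Represents (sgn (aff (ℕ.product ps) a 0ℤ)) (foldr ℤ._*_ 1ℤ (map (legendre a) ps))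
    ps∼ = sgn-aff-legendres a ps-prime ps-odd

  sgn-aff-jacobi : ∀ a n .{{_ : NonZero n}} → n ℕ.% 2 ≡ 1 → Represents (sgn (aff n a 0ℤ)) (jacobi a n)
  sgn-aff-jacobi a n odd = transport isFactorisation odd
    where
    open PrimeFactorisation (factorise n)
    -- The modulus is generalised to `m` since `factors` itself depends on `n`, which keeps
    -- `isFactorisation` from being matched directly.
    transport : ∀ {m} .{{_ : NonZero m}} → m ≡ ℕ.product factors → m ℕ.% 2 ≡ 1 →
                Represents (sgn (aff m a 0ℤ)) (foldr ℤ._*_ 1ℤ (map (legendre a) factors))
    transport ≡.refl odd = sgn-aff-legendres a factorsPrime odd

-- The floor determinant

-- The bound 3 leaves room for the indices 0, `m` and `2 m` below `n`, whose rows or columns will be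
-- dependent.
CommonFactor : ℤ → ℕ → Set
CommonFactor a n = ∃[ p ] ∃[ m ] 3 ℕ.≤ p × n ≡ p ℕ.* m × + p ∣ a

Invertible : ℤ → ℕ → Set
Invertible a n = ∃[ b ] a ℤ.* b ≡ 1ℤ [mod n ]

-- The inverse comes from `1 - (1 - a b) (1 - a b′) = a (b + b′ - a b b′)`, where the product on the
-- left is a multiple of `m n`.
invertible-* : ∀ a m n → Invertible a m → Invertible a n → Invertible a (m ℕ.* n)
invertible-* a m n (b , mod (divides k eq)) (b′ , mod (divides l eq′)) =
  b ℤ.+ b′ ℤ.- a ℤ.* b ℤ.* b′ , mod (divides (ℤ.- (k ℤ.* l)) (begin
    a ℤ.* (b ℤ.+ b′ ℤ.- a ℤ.* b ℤ.* b′) ℤ.- 1ℤ        ≡⟨ lemma a b b′ ⟩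
    ℤ.- ((a ℤ.* b ℤ.- 1ℤ) ℤ.* (a ℤ.* b′ ℤ.- 1ℤ))      ≡⟨ ≡.cong₂ (λ x y → ℤ.- (x ℤ.* y)) eq eq′ ⟩
    ℤ.- ((k ℤ.* + m) ℤ.* (l ℤ.* + n))                 ≡⟨ lemma′ k (+ m) l (+ n) ⟩
    ℤ.- (k ℤ.* l) ℤ.* (+ m ℤ.* + n)                   ≡⟨ ≡.cong (ℤ.- (k ℤ.* l) ℤ.*_) (ℤ.pos-* m n) ⟨
    ℤ.- (k ℤ.* l) ℤ.* + (m ℕ.* n)                     ∎))
  where
  open ≡-Reasoning
  lemma : ∀ a b b′ → a ℤ.* (b ℤ.+ b′ ℤ.- a ℤ.* b ℤ.* b′) ℤ.- 1ℤ ≡ ℤ.- ((a ℤ.* b ℤ.- 1ℤ) ℤ.* (a ℤ.* b′ ℤ.- 1ℤ))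
  lemma = solve-∀
  lemma′ : ∀ k m l n → ℤ.- ((k ℤ.* m) ℤ.* (l ℤ.* n)) ≡ ℤ.- (k ℤ.* l) ℤ.* (m ℤ.* n)
  lemma′ = solve-∀

commonFactor-or-invertible : ∀ a n .{{_ : NonZero n}} → n ℕ.% 2 ≡ 1 → CommonFactor a n ⊎ Invertible a n
commonFactor-or-invertible a n odd = ≡.subst (λ m → CommonFactor a m ⊎ Invertible a m) (≡.sym isFactorisation)
  (go factorsPrime (≡.subst (λ m → m ℕ.% 2 ≡ 1) isFactorisation odd))
  where
  open PrimeFactorisation (factorise n)
  go : ∀ {ps} → All Prime ps → ℕ.product ps ℕ.% 2 ≡ 1 → CommonFactor a (ℕ.product ps) ⊎ Invertible a (ℕ.product ps)
  go [] _ = inj₂ (0ℤ , mod (divides (a ℤ.* 0ℤ ℤ.- 1ℤ) (≡.sym (ℤ.*-identityʳ _))))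
  go {p ∷ ps} (p-prime ∷ ps-prime) odd = step (+ p ∣? a) (go ps-prime (odd-*ʳ p (ℕ.product ps) odd))
    where
    step : Dec (+ p ∣ a) → CommonFactor a (ℕ.product ps) ⊎ Invertible a (ℕ.product ps) →
           CommonFactor a (p ℕ.* ℕ.product ps) ⊎ Invertible a (p ℕ.* ℕ.product ps)
    step (yes p∣a) _ = inj₁ (p , ℕ.product ps , p≥3 (odd-prime≥3 p-prime (%2≡1⇒odd (odd-*ˡ p (ℕ.product ps) odd))) , ≡.refl , p∣a)
      where
      p≥3 : ∃[ s ] p ≡ suc (suc (suc (s ℕ.* 2))) → 3 ℕ.≤ p
      p≥3 (s , p≡) = ≡.subst (3 ℕ.≤_) (≡.sym p≡) (ℕ.s≤s (ℕ.s≤s (ℕ.s≤s ℕ.z≤n)))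
    step (no p∤a) (inj₁ (p′ , m , p′≥3 , eq , p′∣a)) = inj₁ (p′ , p ℕ.* m , p′≥3 , ≡.trans (≡.cong (p ℕ.*_) eq)
      (≡.trans (≡.sym (ℕ.*-assoc p p′ m)) (≡.trans (≡.cong (ℕ._* m) (ℕ.*-comm p p′)) (ℕ.*-assoc p′ p m))) , p′∣a)
    step (no p∤a) (inj₂ inverse) = inj₂ (invertible-* a p (ℕ.product ps) (mod-inverse p-prime p∤a) inverse)

twice-sum-indices : ∀ n → sumℤ {n} (λ j → + suc (toℕ j)) ℤ.* + 2 ≡ + n ℤ.* (+ n ℤ.+ 1ℤ)
twice-sum-indices n = ≡.trans (≡.cong (ℤ._* + 2) (sumℤ-cong {n} (λ j → ≡.cong (λ m → + suc m) (≡.sym (ℕ.+-identityʳ (toℕ j)))))) (≡.trans (go n 0) (lemma (+ n)))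
  where
  open ≡-Reasoning
  lemma : ∀ n → n ℤ.* (n ℤ.+ 0ℤ ℤ.* + 2 ℤ.+ 1ℤ) ≡ n ℤ.* (n ℤ.+ 1ℤ)
  lemma = solve-∀
  step : ∀ o n → (1ℤ ℤ.+ (0ℤ ℤ.+ o)) ℤ.* + 2 ℤ.+ n ℤ.* (n ℤ.+ (1ℤ ℤ.+ o) ℤ.* + 2 ℤ.+ 1ℤ) ≡ (1ℤ ℤ.+ n) ℤ.* (1ℤ ℤ.+ n ℤ.+ o ℤ.* + 2 ℤ.+ 1ℤ)
  step = solve-∀
  -- The offset `o` is generalised because dropping the first summand shifts the other indices.
  go : ∀ n o → sumℤ {n} (λ j → + suc (toℕ j ℕ.+ o)) ℤ.* + 2 ≡ + n ℤ.* (+ n ℤ.+ + o ℤ.* + 2 ℤ.+ 1ℤ)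
  go zero    o = ≡.refl
  go (suc n) o = begin
    (+ suc o ℤ.+ sumℤ {n} (λ j → + suc (suc (toℕ j ℕ.+ o)))) ℤ.* + 2
      ≡⟨ ℤ.*-distribʳ-+ (+ 2) (+ suc o) (sumℤ {n} (λ j → + suc (suc (toℕ j ℕ.+ o)))) ⟩
    + suc o ℤ.* + 2 ℤ.+ sumℤ {n} (λ j → + suc (suc (toℕ j ℕ.+ o))) ℤ.* + 2
      ≡⟨ ≡.cong (λ x → + suc o ℤ.* + 2 ℤ.+ x ℤ.* + 2) (sumℤ-cong {n} (λ j → ≡.cong (λ k → + suc k) (≡.sym (ℕ.+-suc (toℕ j) o)))) ⟩
    + suc o ℤ.* + 2 ℤ.+ sumℤ {n} (λ j → + suc (toℕ j ℕ.+ suc o)) ℤ.* + 2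
      ≡⟨ ≡.cong (λ x → + suc o ℤ.* + 2 ℤ.+ x) (go n (suc o)) ⟩
    + suc o ℤ.* + 2 ℤ.+ + n ℤ.* (+ n ℤ.+ + suc o ℤ.* + 2 ℤ.+ 1ℤ)       ≡⟨ step (+ o) (+ n) ⟩
    + suc n ℤ.* (+ suc n ℤ.+ + o ℤ.* + 2 ℤ.+ 1ℤ)                       ∎

sumℤ-*ʳ : ∀ {n} (f : Fin n → ℤ) k → sumℤ f ℤ.* k ≡ sumℤ (λ i → f i ℤ.* k)
sumℤ-*ʳ {zero}  f k = ≡.refl
sumℤ-*ʳ {suc n} f k = ≡.trans (ℤ.*-distribʳ-+ k (f zero) (sumℤ (f ∘ suc))) (≡.cong (λ x → f zero ℤ.* k ℤ.+ x) (sumℤ-*ʳ (f ∘ suc) k))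

-- The power of q that comes from scaling rows and columns.

module Quotients (n : ℕ) .{{_ : NonZero n}} where
  X : ℤ → Fin n → ℤ
  X a j = a ℤ.* + suc (toℕ j)

  residue : ℤ → Fin n → Fin n
  residue a j = red n (X a j)

  residue≡aff : ∀ a j → residue a j ≡ aff n a a j
  residue≡aff a j = red-cong n (≡⇒≡[mod] (lemma a (+ toℕ j)))
    where
    lemma : ∀ a j → a ℤ.* (1ℤ ℤ.+ j) ≡ a ℤ.* j ℤ.+ a
    lemma = solve-∀

  Σquotients : ℤ → ℤ
  Σquotients a = sumℤ (λ j → X a j /ℕ n)

  Σresidues : ∀ a → Invertible a n → sumℤ (λ j → + toℕ (residue a j)) ≡ sumℤ {n} (λ j → + toℕ j)
  Σresidues a (b , ab≡1) = ≡.trans (sumℤ-cong (λ j → ≡.cong (λ i → + toℕ i) (residue≡aff a j)))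
    (≡.sym (sumℤ-permute (λ j → + toℕ j) (permutation (aff n a a) (aff n b (ℤ.- (b ℤ.* a))) (aff-inverse n {a} {b} a ab≡1) (aff-inverse′ n {a} {b} a ab≡1))))

  ΣX : ∀ a → Invertible a n → sumℤ (X a) ≡ sumℤ {n} (λ j → + toℕ j) ℤ.+ Σquotients a ℤ.* + n
  ΣX a inv = begin
    sumℤ (X a)                                                         ≡⟨ sumℤ-cong (λ j → red-divMod n (X a j)) ⟩
    sumℤ (λ j → + toℕ (residue a j) ℤ.+ (X a j /ℕ n) ℤ.* + n)
      ≡⟨ sumℤ-+ (λ j → + toℕ (residue a j)) (λ j → (X a j /ℕ n) ℤ.* + n) ⟩
    sumℤ (λ j → + toℕ (residue a j)) ℤ.+ sumℤ (λ j → (X a j /ℕ n) ℤ.* + n)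
      ≡⟨ ≡.cong₂ ℤ._+_ (Σresidues a inv) (≡.sym (sumℤ-*ʳ (λ j → X a j /ℕ n) (+ n))) ⟩
    sumℤ {n} (λ j → + toℕ j) ℤ.+ Σquotients a ℤ.* + n                  ∎
    where open ≡-Reasoning

  -- The residues of both multiplications are permutations of 0, ..., n - 1 and have the same sum.
  -- So `n` times the difference of the quotient sums is the sum of all `X a j ℤ.- X (a ℤ.+ 1ℤ) j`,
  -- which is `- n (n + 1) / 2`. Doubling avoids the fraction.
  Σquotients-difference : ∀ a → Invertible a n → Invertible (a ℤ.+ 1ℤ) n →
                          (Σquotients a ℤ.- Σquotients (a ℤ.+ 1ℤ)) ℤ.* + 2 ≡ ℤ.- (+ n ℤ.+ 1ℤ)
  Σquotients-difference a inv inv′ = ℤ.*-cancelʳ-≡ _ _ (+ n) (begin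
    (A ℤ.- B) ℤ.* + 2 ℤ.* + n                                    ≡⟨ lemma₁ A B S (+ n) ⟩
    ((S ℤ.+ A ℤ.* + n) ℤ.- (S ℤ.+ B ℤ.* + n)) ℤ.* + 2
      ≡⟨ ≡.cong₂ (λ x y → (x ℤ.- y) ℤ.* + 2) (ΣX a inv) (ΣX (a ℤ.+ 1ℤ) inv′) ⟨
    (sumℤ (X a) ℤ.- sumℤ (X (a ℤ.+ 1ℤ))) ℤ.* + 2                 ≡⟨ ≡.cong (λ x → (sumℤ (X a) ℤ.- x) ℤ.* + 2) ΣX′ ⟩
    (sumℤ (X a) ℤ.- (sumℤ (X a) ℤ.+ I)) ℤ.* + 2                  ≡⟨ lemma₂ (sumℤ (X a)) I ⟩
    ℤ.- (I ℤ.* + 2)                                              ≡⟨ ≡.cong ℤ.-_ (twice-sum-indices n) ⟩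
    ℤ.- (+ n ℤ.* (+ n ℤ.+ 1ℤ))                                   ≡⟨ lemma₃ (+ n) ⟩
    ℤ.- (+ n ℤ.+ 1ℤ) ℤ.* + n                                     ∎)
    where
    open ≡-Reasoning
    A B S I : ℤ
    A = Σquotients a
    B = Σquotients (a ℤ.+ 1ℤ)
    S = sumℤ {n} (λ j → + toℕ j)
    I = sumℤ {n} (λ j → + suc (toℕ j))
    lemma₁ : ∀ A B S n → (A ℤ.- B) ℤ.* + 2 ℤ.* n ≡ ((S ℤ.+ A ℤ.* n) ℤ.- (S ℤ.+ B ℤ.* n)) ℤ.* + 2
    lemma₁ = solve-∀
    lemma₂ : ∀ x i → (x ℤ.- (x ℤ.+ i)) ℤ.* + 2 ≡ ℤ.- (i ℤ.* + 2)
    lemma₂ = solve-∀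
    lemma₃ : ∀ n → ℤ.- (n ℤ.* (n ℤ.+ 1ℤ)) ≡ ℤ.- (n ℤ.+ 1ℤ) ℤ.* n
    lemma₃ = solve-∀
    lemma₄ : ∀ a j → (a ℤ.+ 1ℤ) ℤ.* j ≡ a ℤ.* j ℤ.+ j
    lemma₄ = solve-∀
    ΣX′ : sumℤ (X (a ℤ.+ 1ℤ)) ≡ sumℤ (X a) ℤ.+ I
    ΣX′ = ≡.trans (sumℤ-cong {n} (λ j → lemma₄ a (+ suc (toℕ j)))) (sumℤ-+ (X a) (λ j → + suc (toℕ j)))

module Stride (n : ℕ) .{{_ : NonZero n}} (p m : ℕ) (p≥3 : 3 ℕ.≤ p) (n≡pm : n ≡ p ℕ.* m) where
  open Quotients n using (X)

  m≢0 : m ≢ 0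
  m≢0 ≡.refl = ℕ.≢-nonZero⁻¹ n (≡.trans n≡pm (ℕ.*-zeroʳ p))
  bound : ∀ k → k ℕ.< 3 → k ℕ.* m ℕ.< n
  bound k k<3 = ≡.subst (k ℕ.* m ℕ.<_) (≡.sym n≡pm) (ℕ.*-monoˡ-< m {{ℕ.≢-nonZero m≢0}} (ℕ.<-≤-trans k<3 p≥3))
  index : ∀ k → k ℕ.< 3 → Fin n
  index k k<3 = fromℕ< (bound k k<3)
  toℕ-index : ∀ k k<3 → toℕ (index k k<3) ≡ k ℕ.* m
  toℕ-index k k<3 = Fin.toℕ-fromℕ< (bound k k<3)
  0<3 : 0 ℕ.< 3
  0<3 = ℕ.s≤s ℕ.z≤n
  1<3 : 1 ℕ.< 3
  1<3 = ℕ.s≤s (ℕ.s≤s ℕ.z≤n)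
  2<3 : 2 ℕ.< 3
  2<3 = ℕ.s≤s (ℕ.s≤s (ℕ.s≤s ℕ.z≤n))
  index-≢ : ∀ {k l} k<3 l<3 → k ≢ l → index k k<3 ≢ index l l<3
  index-≢ {k} {l} k<3 l<3 k≢l eq = k≢l (ℕ.*-cancelʳ-≡ k l m {{ℕ.≢-nonZero m≢0}}
    (≡.trans (≡.sym (toℕ-index k k<3)) (≡.trans (≡.cong toℕ eq) (toℕ-index l l<3))))
  -- From `b m = d p m = d n`: a stride of `m` indices changes the quotient by exactly `d`.
  X-step : ∀ b d → b ≡ d ℤ.* + p → ∀ k k<3 k+1<3 → X b (index (suc k) k+1<3) ≡ X b (index k k<3) ℤ.+ d ℤ.* + n
  X-step b d b≡dp k k<3 k+1<3 = ≡.trans (≡.cong (λ i → b ℤ.* + suc i) (toℕ-index (suc k) k+1<3))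
    (≡.trans (≡.cong (λ z → b ℤ.* (1ℤ ℤ.+ z)) (ℤ.pos-+ m (k ℕ.* m)))
    (≡.trans (lemma b (+ m) (+ (k ℕ.* m)))
    (≡.cong₂ ℤ._+_ (≡.cong (λ i → b ℤ.* + suc i) (≡.sym (toℕ-index k k<3)))
                   (≡.trans (≡.cong (ℤ._* + m) b≡dp) (≡.trans (ℤ.*-assoc d (+ p) (+ m)) (≡.cong (d ℤ.*_) (≡.trans (≡.sym (ℤ.pos-* p m)) (≡.cong +_ (≡.sym n≡pm)))))))))
    where
    lemma : ∀ b m j → b ℤ.* (1ℤ ℤ.+ (m ℤ.+ j)) ≡ b ℤ.* (1ℤ ℤ.+ j) ℤ.+ b ℤ.* m
    lemma = solve-∀

∣⇒/ℕ : ∀ n .{{_ : NonZero n}} x → + n ∣ x → (x /ℕ n) ℤ.* + n ≡ x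
∣⇒/ℕ n x (divides k ≡.refl) = ≡.cong (ℤ._* + n) (/ℕ-exact n k)

-- The computation takes place over a commutative ring with these two inverses, which the apartness
-- hypotheses `q # 0#` and `q # 1#` of the theorem supply.
record Parameter {c ℓ} (R : CommutativeRing c ℓ) : Set (c ⊔ ℓ) where
  open CommutativeRing R
  field
    q t u    : Carrier
    qt≈1     : q * t ≈ 1#
    [1-q]u≈1 : (1# - q) * u ≈ 1#

-- The pairs (λ₀ κ, κ) and (μ κ + 1, κ + 1) run through the solutions of
-- a x ≡ (a + 1) y mod n with 0 ≤ x, y < n and 1 ≤ x, y ≤ n respectively.
module Exponents (n-1 : ℕ) (a b b′ : ℤ) (ab≡1 : a ℤ.* b ≡ 1ℤ [mod suc n-1 ]) (ab′≡1 : (a ℤ.+ 1ℤ) ℤ.* b′ ≡ 1ℤ [mod suc n-1 ]) where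
  open ≡-Reasoning
  n : ℕ
  n = suc n-1

  -- Modulo `n`, `α` is the fraction (a + 1) / a, and `α′` is its inverse.
  α α′ : ℤ
  α  = (a ℤ.+ 1ℤ) ℤ.* b
  α′ = a ℤ.* b′

  αα′≡1 : α ℤ.* α′ ≡ 1ℤ [mod n ]
  αα′≡1 = mod-trans (≡⇒≡[mod] (lemma a b b′)) (mod-* ab≡1 ab′≡1)
    where
    lemma : ∀ a b b′ → ((a ℤ.+ 1ℤ) ℤ.* b) ℤ.* (a ℤ.* b′) ≡ (a ℤ.* b) ℤ.* ((a ℤ.+ 1ℤ) ℤ.* b′)
    lemma = solve-∀

  aα≡a+1 : a ℤ.* α ≡ a ℤ.+ 1ℤ [mod n ]
  aα≡a+1 = mod-trans (≡⇒≡[mod] (lemma a b)) (mod-trans (mod-*ˡ (a ℤ.+ 1ℤ) ab≡1) (≡⇒≡[mod] (ℤ.*-identityʳ (a ℤ.+ 1ℤ))))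
    where
    lemma : ∀ a b → a ℤ.* ((a ℤ.+ 1ℤ) ℤ.* b) ≡ (a ℤ.+ 1ℤ) ℤ.* (a ℤ.* b)
    lemma = solve-∀

  -- `μ κ + 1` is congruent to `α (κ + 1)`; the constant `α - 1` translates between indices from 0
  -- and numbers from 1.
  μ λ₀ : Fin n → Fin n
  μ  = aff n α (α ℤ.- 1ℤ)
  λ₀ = aff n α 0ℤ

  E E₀ : Fin n → ℤ
  E κ  = (a ℤ.+ 1ℤ) ℤ.* + suc (toℕ κ) ℤ.- a ℤ.* + suc (toℕ (μ κ))
  E₀ κ = (a ℤ.+ 1ℤ) ℤ.* + toℕ κ ℤ.- a ℤ.* + toℕ (λ₀ κ)

  n∣E : ∀ κ → + n ∣ E κ
  n∣E κ = _≡_[mod_].divisible (mod-sym {n} {a ℤ.* + suc (toℕ (μ κ))} {(a ℤ.+ 1ℤ) ℤ.* + suc (toℕ κ)}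
    (mod-trans (mod-*ˡ a (mod-+ˡ 1ℤ (red-mod n (α ℤ.* + toℕ κ ℤ.+ (α ℤ.- 1ℤ)))))
    (mod-trans (≡⇒≡[mod] (lemma a α (+ toℕ κ))) (mod-*ʳ (+ suc (toℕ κ)) aα≡a+1))))
    where
    lemma : ∀ a α κ → a ℤ.* (1ℤ ℤ.+ (α ℤ.* κ ℤ.+ (α ℤ.- 1ℤ))) ≡ a ℤ.* α ℤ.* (1ℤ ℤ.+ κ)
    lemma = solve-∀

  n∣E₀ : ∀ κ → + n ∣ E₀ κ
  n∣E₀ κ = _≡_[mod_].divisible (mod-sym {n} {a ℤ.* + toℕ (λ₀ κ)} {(a ℤ.+ 1ℤ) ℤ.* + toℕ κ}
    (mod-trans (mod-*ˡ a (red-mod n (α ℤ.* + toℕ κ ℤ.+ 0ℤ)))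
    (mod-trans (≡⇒≡[mod] (lemma a α (+ toℕ κ))) (mod-*ʳ (+ toℕ κ) aα≡a+1))))
    where
    lemma : ∀ a α κ → a ℤ.* (α ℤ.* κ ℤ.+ 0ℤ) ≡ a ℤ.* α ℤ.* κ
    lemma = solve-∀

  -- The values at `κ + 1` and at `κ` of the single sequence e(0), ..., e(n). The end value e(n) = 1
  -- arises because `e` represents the residue 0 by `n`, whereas `e₀` represents it by 0.
  e e₀ : Fin n → ℤ
  e κ  = E κ /ℕ n
  e₀ κ = E₀ κ /ℕ n

  λ₀-zero : λ₀ zero ≡ zero
  λ₀-zero = red-unique n zero (≡⇒≡[mod] (lemma α))
    where
    lemma : ∀ α → α ℤ.* 0ℤ ℤ.+ 0ℤ ≡ 0ℤ
    lemma = solve-∀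

  e₀-zero : e₀ zero ≡ 0ℤ
  e₀-zero = ≡.trans (≡.cong (_/ℕ n) (≡.trans (≡.cong (λ i → (a ℤ.+ 1ℤ) ℤ.* 0ℤ ℤ.- a ℤ.* + toℕ i) λ₀-zero) (lemma a))) (/ℕ-exact n 0ℤ)
    where
    lemma : ∀ a → (a ℤ.+ 1ℤ) ℤ.* 0ℤ ℤ.- a ℤ.* 0ℤ ≡ 0ℤ
    lemma = solve-∀

  e-last : e (fromℕ n-1) ≡ 1ℤ
  e-last = ≡.trans (≡.cong (_/ℕ n) (begin
    (a ℤ.+ 1ℤ) ℤ.* + suc (toℕ (fromℕ n-1)) ℤ.- a ℤ.* + suc (toℕ (μ (fromℕ n-1)))
      ≡⟨ ≡.cong (λ i → (a ℤ.+ 1ℤ) ℤ.* + suc (toℕ (fromℕ n-1)) ℤ.- a ℤ.* + suc (toℕ i)) μ-last ⟩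
    (a ℤ.+ 1ℤ) ℤ.* + suc (toℕ (fromℕ n-1)) ℤ.- a ℤ.* + suc (toℕ (fromℕ n-1))      ≡⟨ lemma a (+ suc (toℕ (fromℕ n-1))) ⟩
    1ℤ ℤ.* + suc (toℕ (fromℕ n-1))
      ≡⟨ ≡.cong (λ m → 1ℤ ℤ.* + suc m) (Fin.toℕ-fromℕ n-1) ⟩
    1ℤ ℤ.* + n                                                                    ∎)) (/ℕ-exact n 1ℤ)
    where
    lemma : ∀ a m → (a ℤ.+ 1ℤ) ℤ.* m ℤ.- a ℤ.* m ≡ 1ℤ ℤ.* m
    lemma = solve-∀
    lemma′ : ∀ α m → α ℤ.* m ℤ.+ (α ℤ.- 1ℤ) ℤ.- m ≡ (α ℤ.- 1ℤ) ℤ.* (1ℤ ℤ.+ m)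
    lemma′ = solve-∀
    μ-last : μ (fromℕ n-1) ≡ fromℕ n-1
    μ-last = red-unique n (fromℕ n-1) (mod (divides (α ℤ.- 1ℤ) (≡.trans (lemma′ α (+ toℕ (fromℕ n-1))) (≡.cong (λ m → (α ℤ.- 1ℤ) ℤ.* + suc m) (Fin.toℕ-fromℕ n-1)))))

  -- Both sides represent `α (κ + 1)`. Since `λ₀` is injective and fixes 0, the left-hand side is
  -- not 0 and so lies, like the right-hand side, between 1 and `n`.
  λ₀-suc : ∀ (κ : Fin n-1) → toℕ (λ₀ (suc κ)) ≡ suc (toℕ (μ (inject₁ κ)))
  λ₀-suc κ = go (λ₀ (suc κ)) ≡.refl
    where
    lemma : ∀ α κ → α ℤ.* (1ℤ ℤ.+ κ) ℤ.+ 0ℤ ℤ.- 1ℤ ≡ α ℤ.* κ ℤ.+ (α ℤ.- 1ℤ)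
    lemma = solve-∀
    lemma′ : ∀ l → 1ℤ ℤ.+ l ℤ.- 1ℤ ≡ l
    lemma′ = solve-∀
    go : ∀ i → λ₀ (suc κ) ≡ i → toℕ i ≡ suc (toℕ (μ (inject₁ κ)))
    go zero eq = contradiction (≡.trans (≡.sym (inverse (suc κ))) (≡.trans (≡.cong (aff n α′ (ℤ.- (α′ ℤ.* 0ℤ))) (≡.trans eq (≡.sym λ₀-zero))) (inverse zero))) λ ()
      where
      inverse : ∀ i → aff n α′ (ℤ.- (α′ ℤ.* 0ℤ)) (λ₀ i) ≡ i
      inverse = aff-inverse′ n {α} {α′} 0ℤ αα′≡1
    go (suc l) eq = ≡.cong suc (≡.trans (≡.sym (Fin.toℕ-inject₁ l)) (≡.cong toℕ (≡.sym μ≡l)))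
      where
      l≡ : + toℕ (inject₁ l) ≡ α ℤ.* + toℕ (inject₁ κ) ℤ.+ (α ℤ.- 1ℤ) [mod n ]
      l≡ = mod-trans (≡⇒≡[mod] (≡.trans (≡.cong +_ (Fin.toℕ-inject₁ l)) (≡.sym (lemma′ (+ toℕ l)))))
        (mod-trans (mod-+ʳ (ℤ.- 1ℤ) (≡.subst (λ i → + toℕ i ≡ α ℤ.* + suc (toℕ κ) ℤ.+ 0ℤ [mod n ]) eq (red-mod n (α ℤ.* + suc (toℕ κ) ℤ.+ 0ℤ))))
        (≡⇒≡[mod] (≡.trans (lemma α (+ toℕ κ)) (≡.cong (λ m → α ℤ.* + m ℤ.+ (α ℤ.- 1ℤ)) (≡.sym (Fin.toℕ-inject₁ κ))))))
      μ≡l : μ (inject₁ κ) ≡ inject₁ l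
      μ≡l = red-unique n (inject₁ l) (mod-sym l≡)

  e₀-suc : ∀ (κ : Fin n-1) → e₀ (suc κ) ≡ e (inject₁ κ)
  e₀-suc κ = ≡.cong (_/ℕ n) (≡.cong₂ (λ x y → (a ℤ.+ 1ℤ) ℤ.* + suc x ℤ.- a ℤ.* + y) (≡.sym (Fin.toℕ-inject₁ κ)) (λ₀-suc κ))

  -- As `n` divides `E κ`, its quotient may be added inside the floor, where `(a + 1) (κ + 1)` is
  -- traded for `a (μ κ + 1)`. In `exponent+e₀` the term `(a + 1) κ` falls short by `a + 1`, of
  -- which `a` is absorbed by the shift from `j + 1` to `j` and -1 remains.
  exponent+e : ∀ (j κ : Fin n) → (a ℤ.* + suc (toℕ j) ℤ.- (a ℤ.+ 1ℤ) ℤ.* + suc (toℕ κ)) /ℕ n ℤ.+ e κ ≡ (a ℤ.* (+ toℕ j ℤ.- + toℕ (μ κ))) /ℕ n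
  exponent+e j κ = ≡.trans (≡.sym (/ℕ-+ n (a ℤ.* + suc (toℕ j) ℤ.- (a ℤ.+ 1ℤ) ℤ.* + suc (toℕ κ)) (e κ)))
    (≡.cong (_/ℕ n) (≡.trans (≡.cong (λ x → a ℤ.* + suc (toℕ j) ℤ.- (a ℤ.+ 1ℤ) ℤ.* + suc (toℕ κ) ℤ.+ x) (∣⇒/ℕ n (E κ) (n∣E κ)))
      (lemma a (+ toℕ j) (+ toℕ κ) (+ toℕ (μ κ)))))
    where
    lemma : ∀ a j κ m → a ℤ.* (1ℤ ℤ.+ j) ℤ.- (a ℤ.+ 1ℤ) ℤ.* (1ℤ ℤ.+ κ) ℤ.+ ((a ℤ.+ 1ℤ) ℤ.* (1ℤ ℤ.+ κ) ℤ.- a ℤ.* (1ℤ ℤ.+ m)) ≡ a ℤ.* (j ℤ.- m)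
    lemma = solve-∀

  exponent+e₀ : ∀ (j κ : Fin n) → (a ℤ.* + suc (toℕ j) ℤ.- (a ℤ.+ 1ℤ) ℤ.* + suc (toℕ κ)) /ℕ n ℤ.+ e₀ κ ≡ (a ℤ.* (+ toℕ j ℤ.- + toℕ (λ₀ κ)) ℤ.- 1ℤ) /ℕ n
  exponent+e₀ j κ = ≡.trans (≡.sym (/ℕ-+ n (a ℤ.* + suc (toℕ j) ℤ.- (a ℤ.+ 1ℤ) ℤ.* + suc (toℕ κ)) (e₀ κ)))
    (≡.cong (_/ℕ n) (≡.trans (≡.cong (λ x → a ℤ.* + suc (toℕ j) ℤ.- (a ℤ.+ 1ℤ) ℤ.* + suc (toℕ κ) ℤ.+ x) (∣⇒/ℕ n (E₀ κ) (n∣E₀ κ)))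
      (lemma a (+ toℕ j) (+ toℕ κ) (+ toℕ (λ₀ κ)))))
    where
    lemma : ∀ a j κ m → a ℤ.* (1ℤ ℤ.+ j) ℤ.- (a ℤ.+ 1ℤ) ℤ.* (1ℤ ℤ.+ κ) ℤ.+ ((a ℤ.+ 1ℤ) ℤ.* κ ℤ.- a ℤ.* m) ≡ a ℤ.* (j ℤ.- m) ℤ.- 1ℤ
    lemma = solve-∀

  ∤-difference : ∀ {i j : Fin n} → i ≢ j → ¬ (+ n ∣ a ℤ.* (+ toℕ j ℤ.- + toℕ i))
  ∤-difference {i} {j} i≢j n∣ = i≢j (≡.sym (toℕ-injective-mod {n} {j} {i} (mod (mod-≡0⇒∣ (mod-trans
    (mod-trans (≡⇒≡[mod] (≡.sym (ℤ.*-identityˡ x))) (mod-trans (mod-*ʳ x (mod-sym ab≡1)) (≡⇒≡[mod] (lemma a b x))))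
    (mod-trans (mod-*ˡ b (∣⇒mod-≡0 n∣)) (≡⇒≡[mod] (ℤ.*-zeroʳ b))))))))
    where
    x : ℤ
    x = + toℕ j ℤ.- + toℕ i
    lemma : ∀ a b x → a ℤ.* b ℤ.* x ≡ b ℤ.* (a ℤ.* x)
    lemma = solve-∀

-- The determinant over a commutative ring.

module FloorDeterminant {c ℓ} (R : CommutativeRing c ℓ) (parameter : Parameter R) where
  open CommutativeRing R hiding (zero)
  open Parameter parameter
  open Zolotarev R public
  open RingProperties ring
  open CommutativeSemiringExp commutativeSemiring using (^-distrib-*)
  open SetoidReasoning setoid

  pw : ℤ → Carrier
  pw (+ n)    = q ^ n
  pw -[1+ n ] = t ^ suc n

  pw-suc : ∀ x → pw (1ℤ ℤ.+ x) ≈ q * pw x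
  pw-suc (+ n)          = refl
  pw-suc -[1+ zero ]    = sym (trans (*-congˡ (*-identityʳ t)) qt≈1)
  pw-suc -[1+ suc n ]   = sym (trans (sym (*-assoc q t (t ^ suc n))) (trans (*-congʳ qt≈1) (*-identityˡ _)))

  pw-pred : ∀ x → pw (-1ℤ ℤ.+ x) ≈ t * pw x
  pw-pred (+ zero)  = refl
  pw-pred (+ suc n) = sym (trans (sym (*-assoc t q (q ^ n))) (trans (*-congʳ (trans (*-comm t q) qt≈1)) (*-identityˡ _)))
  pw-pred -[1+ n ]  = refl

  pw-+ : ∀ x y → pw (x ℤ.+ y) ≈ pw x * pw y
  pw-+ (+ zero) y = trans (reflexive (≡.cong pw (ℤ.+-identityˡ y))) (sym (*-identityˡ _))
  pw-+ (+ suc n) y = begin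
    pw (+ suc n ℤ.+ y)           ≡⟨ ≡.cong pw (ℤ.+-assoc 1ℤ (+ n) y) ⟩
    pw (1ℤ ℤ.+ (+ n ℤ.+ y))      ≈⟨ pw-suc (+ n ℤ.+ y) ⟩
    q * pw (+ n ℤ.+ y)           ≈⟨ *-congˡ (pw-+ (+ n) y) ⟩
    q * (pw (+ n) * pw y)        ≈⟨ *-assoc _ _ _ ⟨
    pw (+ suc n) * pw y          ∎
  pw-+ -[1+ zero ] y = trans (pw-pred y) (*-congʳ (sym (*-identityʳ t)))
  pw-+ -[1+ suc n ] y = begin
    pw (-[1+ suc n ] ℤ.+ y)          ≡⟨ ≡.cong pw (ℤ.+-assoc -1ℤ -[1+ n ] y) ⟩
    pw (-1ℤ ℤ.+ (-[1+ n ] ℤ.+ y))    ≈⟨ pw-pred (-[1+ n ] ℤ.+ y) ⟩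
    t * pw (-[1+ n ] ℤ.+ y)          ≈⟨ *-congˡ (pw-+ -[1+ n ] y) ⟩
    t * (pw -[1+ n ] * pw y)         ≈⟨ *-assoc _ _ _ ⟨
    pw -[1+ suc n ] * pw y           ∎

  pw-neg : ∀ n → pw (ℤ.- + n) ≈ t ^ n
  pw-neg zero    = refl
  pw-neg (suc n) = refl

  pw-sum : ∀ {n} (f : Fin n → ℤ) → product (λ i → pw (f i)) ≈ pw (sumℤ f)
  pw-sum {zero}  f = refl
  pw-sum {suc n} f = trans (*-congˡ (pw-sum (f ∘ suc))) (sym (pw-+ (f zero) (sumℤ (f ∘ suc))))

  pw-negsum : ∀ {n} (f : Fin n → ℤ) → product (λ i → pw (ℤ.- f i)) ≈ pw (ℤ.- sumℤ f)
  pw-negsum {zero}  f = refl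
  pw-negsum {suc n} f = trans (*-congˡ (pw-negsum (f ∘ suc))) (trans (sym (pw-+ (ℤ.- f zero) (ℤ.- sumℤ (f ∘ suc))))
    (reflexive (≡.cong pw (≡.sym (ℤ.neg-distrib-+ (f zero) (sumℤ (f ∘ suc)))))))

  qInteger : ℤ → Carrier
  qInteger x = (1# - pw x) * u

  -- qInteger is an affine function of q ^ x, so three rows whose exponents
  -- form an arithmetic progression are linearly dependent.
  det-progression : ∀ {n} (f : Fin n → Fin n → ℤ) {i₀ i₁ i₂} d → i₀ ≢ i₂ → i₁ ≢ i₂ →
                    (∀ k → f i₁ k ≡ f i₀ k ℤ.+ d) → (∀ k → f i₂ k ≡ f i₁ k ℤ.+ d) → det (λ j k → qInteger (f j k)) ≈ 0#
  det-progression {n} f {i₀} {i₁} {i₂} d i₀≢i₂ i₁≢i₂ f₁ f₂ = begin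
    det M
      -- The values `1 - w`, `1 - w s`, `1 - w s²` satisfy the linear recurrence with characteristic
      -- roots 1 and `s`, whence the coefficients `1# + s` and `- s`.
      ≈⟨ linear i₂ (1# + s) (- s) {M} {M [ i₂ ↦ M i₁ ]} {M [ i₂ ↦ M i₀ ]}
                                                            (λ i i≢ k → sym (↦-off i i≢ k)) (λ i i≢ k → sym (↦-off i i≢ k)) row ⟩
    (1# + s) * det (M [ i₂ ↦ M i₁ ]) + (- s) * det (M [ i₂ ↦ M i₀ ])
                                                       ≈⟨ +-cong (*-congˡ (equal i₁≢i₂)) (*-congˡ (equal i₀≢i₂)) ⟩
    (1# + s) * 0# + (- s) * 0#                         ≈⟨ trans (+-cong (zeroʳ _) (zeroʳ _)) (+-identityˡ _) ⟩
    0#                                                 ∎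
    where
    open Alternating (det-alternating {n})
    M : Matrix n
    M j k = qInteger (f j k)
    s : Carrier
    s = pw d
    equal : ∀ {i} → i ≢ i₂ → det (M [ i₂ ↦ M i ]) ≈ 0#
    equal {i} i≢i₂ = alternates i≢i₂ {M [ i₂ ↦ M i ]} (λ k → trans (↦-off i i≢i₂ k) (sym (↦-at i₂ k)))
    pw-f₁ : ∀ k → pw (f i₁ k) ≈ pw (f i₀ k) * s
    pw-f₁ k = trans (reflexive (≡.cong pw (f₁ k))) (pw-+ (f i₀ k) d)
    pw-f₂ : ∀ k → pw (f i₂ k) ≈ pw (f i₀ k) * s * s
    pw-f₂ k = trans (reflexive (≡.cong pw (f₂ k))) (trans (pw-+ (f i₁ k) d) (*-congʳ (pw-f₁ k)))
    row : ∀ k → M i₂ k ≈ (1# + s) * (M [ i₂ ↦ M i₁ ]) i₂ k + (- s) * (M [ i₂ ↦ M i₀ ]) i₂ k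
    row k = begin
      (1# - pw (f i₂ k)) * u      ≈⟨ *-congʳ (+-congˡ (-‿cong (pw-f₂ k))) ⟩
      (1# - w * s * s) * u        ≈⟨ solve 3 (λ w s u → (con (+ 1) :- w :* s :* s) :* u :=
                                       (con (+ 1) :+ s) :* ((con (+ 1) :- w :* s) :* u) :+ (:- s) :* ((con (+ 1) :- w) :* u)) refl w s u ⟩
      (1# + s) * ((1# - w * s) * u) + (- s) * ((1# - w) * u)
                                  ≈⟨ +-cong (*-congˡ (trans (*-congʳ (+-congˡ (-‿cong (sym (pw-f₁ k))))) (sym (↦-at i₂ k)))) (*-congˡ (sym (↦-at i₂ k))) ⟩
      (1# + s) * (M [ i₂ ↦ M i₁ ]) i₂ k + (- s) * (M [ i₂ ↦ M i₀ ]) i₂ k ∎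
      where
      w : Carrier
      w = pw (f i₀ k)

  step-matrix-< : ∀ {n} {i j : Fin n} → toℕ j ℕ.< toℕ i → step-matrix t i j ≡ t
  step-matrix-< {i = suc i} {zero}  _           = ≡.refl
  step-matrix-< {i = suc i} {suc j} (ℕ.s≤s j<i) = step-matrix-< j<i

  step-matrix-≥ : ∀ {n} {i j : Fin n} → toℕ i ℕ.≤ toℕ j → step-matrix t i j ≡ 1#
  step-matrix-≥ {i = zero}           _           = ≡.refl
  step-matrix-≥ {i = suc i} {suc j}  (ℕ.s≤s i≤j) = step-matrix-≥ i≤j

  -- The indices 0 and `m` are both sent to 0, so the 0-1 matrix has two equal rows.
  sgn-commonFactor : ∀ n .{{_ : NonZero n}} b → CommonFactor b n → sgn (aff n b 0ℤ) ≈ 0#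
  sgn-commonFactor n b (p , m , p≥3 , n≡pm , divides d b≡dp) = Alternating.alternates (det-alternating {n}) (index-≢ {0} {1} 0<3 1<3 λ ())
    (λ j → reflexive (≡.cong (λ k → δ k j) (red-cong n (mod-trans (vanishes 0 0<3) (mod-sym (vanishes 1 1<3))))))
    where
    open Stride n p m p≥3 n≡pm
    lemma : ∀ d p l m → d ℤ.* p ℤ.* (l ℤ.* m) ℤ.+ 0ℤ ℤ.- 0ℤ ≡ d ℤ.* l ℤ.* (p ℤ.* m)
    lemma = solve-∀
    vanishes : ∀ l l<3 → b ℤ.* + toℕ (index l l<3) ℤ.+ 0ℤ ≡ 0ℤ [mod n ]
    vanishes l l<3 = mod (divides (d ℤ.* + l)
      (≡.trans (≡.cong₂ (λ x y → x ℤ.* y ℤ.+ 0ℤ ℤ.- 0ℤ) b≡dp (≡.trans (≡.cong +_ (toℕ-index l l<3)) (ℤ.pos-* l m)))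
      (≡.trans (lemma d (+ p) (+ l) (+ m)) (≡.cong (d ℤ.* + l ℤ.*_) (≡.trans (≡.sym (ℤ.pos-* p m)) (≡.cong +_ (≡.sym n≡pm)))))))

  module _ (n : ℕ) .{{_ : NonZero n}} (a : ℤ) where
    open Quotients n

    exponent : Fin n → Fin n → ℤ
    exponent j k = (X a j ℤ.- X (a ℤ.+ 1ℤ) k) /ℕ n

    det-commonFactorˡ : CommonFactor a n → det (λ j k → qInteger (exponent j k)) ≈ 0#
    det-commonFactorˡ (p , m , p≥3 , n≡pm , divides d a≡dp) =
      det-progression exponent {index 0 0<3} {index 1 1<3} {index 2 2<3} d (index-≢ 0<3 2<3 λ ()) (index-≢ 1<3 2<3 λ ())
        (λ k → step k 0 0<3 1<3) (λ k → step k 1 1<3 2<3)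
      where
      open Stride n p m p≥3 n≡pm
      lemma : ∀ x e y → x ℤ.+ e ℤ.- y ≡ x ℤ.- y ℤ.+ e
      lemma = solve-∀
      step : ∀ k l l<3 l+1<3 → exponent (index (suc l) l+1<3) k ≡ exponent (index l l<3) k ℤ.+ d
      step k l l<3 l+1<3 = ≡.trans (≡.cong (_/ℕ n) (≡.trans (≡.cong (ℤ._- X (a ℤ.+ 1ℤ) k) (X-step a d a≡dp l l<3 l+1<3))
        (lemma (X a (index l l<3)) (d ℤ.* + n) (X (a ℤ.+ 1ℤ) k)))) (/ℕ-+ n (X a (index l l<3) ℤ.- X (a ℤ.+ 1ℤ) k) d)

    det-commonFactorʳ : CommonFactor (a ℤ.+ 1ℤ) n → det (λ j k → qInteger (exponent j k)) ≈ 0#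
    det-commonFactorʳ (p , m , p≥3 , n≡pm , divides d a≡dp) = trans (sym (det-transpose (λ j k → qInteger (exponent j k))))
      (det-progression (λ k j → exponent j k) {index 0 0<3} {index 1 1<3} {index 2 2<3} (ℤ.- d) (index-≢ 0<3 2<3 λ ()) (index-≢ 1<3 2<3 λ ())
        (λ k → step k 0 0<3 1<3) (λ k → step k 1 1<3 2<3))
      where
      open Stride n p m p≥3 n≡pm
      lemma : ∀ x d n y → x ℤ.- (y ℤ.+ d ℤ.* n) ≡ x ℤ.- y ℤ.+ ℤ.- d ℤ.* n
      lemma = solve-∀
      step : ∀ k l l<3 l+1<3 → exponent k (index (suc l) l+1<3) ≡ exponent k (index l l<3) ℤ.+ ℤ.- d
      step k l l<3 l+1<3 = ≡.trans (≡.cong (_/ℕ n) (≡.trans (≡.cong (λ y → X a k ℤ.- y) (X-step (a ℤ.+ 1ℤ) d a≡dp l l<3 l+1<3))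
        (lemma (X a k) d (+ n) (X (a ℤ.+ 1ℤ) (index l l<3))))) (/ℕ-+ n (X a k ℤ.- X (a ℤ.+ 1ℤ) (index l l<3)) (ℤ.- d))

    Q : Matrix n
    Q j k = pw (exponent j k)

    -- Only the borrow in the subtraction couples `j` and `k`, and it depends on the order of the
    -- two residues alone.
    Q-factor : ∀ j k → Q j k ≈ pw (X a j /ℕ n) * (pw (ℤ.- (X (a ℤ.+ 1ℤ) k /ℕ n)) * step-matrix t (residue (a ℤ.+ 1ℤ) k) (residue a j))
    Q-factor j k = by-cases (toℕ (residue (a ℤ.+ 1ℤ) k) ℕ.≤? toℕ (residue a j))
      where
      x y : ℤ
      x = X a j
      y = X (a ℤ.+ 1ℤ) k
      split : pw (x /ℕ n ℤ.- y /ℕ n) ≈ pw (x /ℕ n) * pw (ℤ.- (y /ℕ n))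
      split = pw-+ (x /ℕ n) (ℤ.- (y /ℕ n))
      by-cases : Dec (toℕ (red n y) ℕ.≤ toℕ (red n x)) → Q j k ≈ pw (x /ℕ n) * (pw (ℤ.- (y /ℕ n)) * step-matrix t (red n y) (red n x))
      by-cases (yes y≤x) = begin
        pw ((x ℤ.- y) /ℕ n)                              ≡⟨ ≡.cong pw (/ℕ-difference-≥ n x y y≤x) ⟩
        pw (x /ℕ n ℤ.- y /ℕ n)                           ≈⟨ split ⟩
        pw (x /ℕ n) * pw (ℤ.- (y /ℕ n))                  ≈⟨ *-congˡ (*-identityʳ _) ⟨
        pw (x /ℕ n) * (pw (ℤ.- (y /ℕ n)) * 1#)
          ≡⟨ ≡.cong (λ s → pw (x /ℕ n) * (pw (ℤ.- (y /ℕ n)) * s)) (step-matrix-≥ y≤x) ⟨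
        pw (x /ℕ n) * (pw (ℤ.- (y /ℕ n)) * step-matrix t (red n y) (red n x)) ∎
      by-cases (no y≰x) = begin
        pw ((x ℤ.- y) /ℕ n)                              ≡⟨ ≡.cong pw (/ℕ-difference-< n x y (ℕ.≰⇒> y≰x)) ⟩
        pw (x /ℕ n ℤ.- y /ℕ n ℤ.+ -1ℤ)                   ≈⟨ pw-+ (x /ℕ n ℤ.- y /ℕ n) -1ℤ ⟩
        pw (x /ℕ n ℤ.- y /ℕ n) * (t * 1#)                ≈⟨ *-cong split (*-identityʳ t) ⟩
        (pw (x /ℕ n) * pw (ℤ.- (y /ℕ n))) * t            ≈⟨ *-assoc _ _ _ ⟩
        pw (x /ℕ n) * (pw (ℤ.- (y /ℕ n)) * t)
          ≡⟨ ≡.cong (λ s → pw (x /ℕ n) * (pw (ℤ.- (y /ℕ n)) * s)) (step-matrix-< (ℕ.≰⇒> y≰x)) ⟨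
        pw (x /ℕ n) * (pw (ℤ.- (y /ℕ n)) * step-matrix t (red n y) (red n x)) ∎

    det-Q : Odd n → det Q ≈ pw (Σquotients a ℤ.- Σquotients (a ℤ.+ 1ℤ)) *
                    ((sgn (aff n a 0ℤ) * sgn (aff n (a ℤ.+ 1ℤ) 0ℤ)) * det (step-matrix {n} t))
    det-Q n-odd = begin
      det Q
        ≈⟨ det-cong Q-factor ⟩
      det (λ j k → x j * (y k * S (v k) (w j)))
        ≈⟨ det-scale-rows x (λ j k → y k * S (v k) (w j)) ⟩
      product x * det (λ j k → y k * S (v k) (w j))
        ≈⟨ *-congˡ (det-scale-columns y (λ j k → S (v k) (w j))) ⟩
      product x * (product y * det (λ j k → S (v k) (w j)))
        ≈⟨ *-assoc _ _ _ ⟨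
      (product x * product y) * det (λ j k → S (v k) (w j))
        ≈⟨ *-cong (trans (*-cong (pw-sum (λ j → X a j /ℕ n)) (pw-negsum (λ k → X (a ℤ.+ 1ℤ) k /ℕ n))) (sym (pw-+ (Σquotients a) (ℤ.- Σquotients (a ℤ.+ 1ℤ)))))
                  (det-reindex w v (transpose S)) ⟩
      pw (Σquotients a ℤ.- Σquotients (a ℤ.+ 1ℤ)) * ((sgn w * sgn v) * det (transpose S))
        ≈⟨ *-congˡ (*-cong (*-cong (sgn-residue a) (sgn-residue (a ℤ.+ 1ℤ))) (det-transpose S)) ⟩
      pw (Σquotients a ℤ.- Σquotients (a ℤ.+ 1ℤ)) * ((sgn (aff n a 0ℤ) * sgn (aff n (a ℤ.+ 1ℤ) 0ℤ)) * det S) ∎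
      where
      x y : Vector Carrier n
      x j = pw (X a j /ℕ n)
      y k = pw (ℤ.- (X (a ℤ.+ 1ℤ) k /ℕ n))
      v w : Fin n → Fin n
      v = residue (a ℤ.+ 1ℤ)
      w = residue a
      S : Matrix n
      S = step-matrix t
      sgn-residue : ∀ b → sgn (residue b) ≈ sgn (aff n b 0ℤ)
      sgn-residue b = trans (sgn-cong (residue≡aff b)) (sgn-aff n n-odd b b)

  sum-difference : ∀ {n} (f g : Vector Carrier n) → sum (λ i → f i - g i) ≈ sum f - sum g
  sum-difference f g = begin
    sum (λ i → f i - g i)
      ≈⟨ sum-cong (λ i → solve 2 (λ x y → x :- y := con (+ 1) :* x :+ (:- con (+ 1)) :* y) refl (f i) (g i)) ⟩
    sum (λ i → 1# * f i + (- 1#) * g i) ≈⟨ sum-linear 1# (- 1#) f g ⟩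
    1# * sum f + (- 1#) * sum g
      ≈⟨ solve 2 (λ x y → x :- y := con (+ 1) :* x :+ (:- con (+ 1)) :* y) refl (sum f) (sum g) ⟨
    sum f - sum g                       ∎

  module _ (n-1 : ℕ) (a b b′ : ℤ) (ab≡1 : a ℤ.* b ≡ 1ℤ [mod suc n-1 ]) (ab′≡1 : (a ℤ.+ 1ℤ) ℤ.* b′ ≡ 1ℤ [mod suc n-1 ]) where
    open Exponents n-1 a b b′ ab≡1 ab′≡1
    open Quotients n using (Σquotients; Σquotients-difference)

    private
      z̃ z : Vector Carrier n
      z̃ κ = pw (e κ) - pw (e₀ κ)
      -- The vector called z in the overview is `z̃`. The factor `- (q * u)` is the inverse of
      -- `1# - t`, so that Q maps `z` to the vector of ones.
      z κ = - (q * u) * z̃ κ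

      sum-z̃ : sum z̃ ≈ q - 1#
      sum-z̃ = begin
        sum z̃                                                    ≈⟨ sum-difference (pw ∘ e) (pw ∘ e₀) ⟩
        sum (pw ∘ e) - sum (pw ∘ e₀)
          ≈⟨ +-cong (sum-init-last (pw ∘ e)) (-‿cong (+-cong (reflexive (≡.cong pw e₀-zero)) (sum-cong λ κ → reflexive (≡.cong pw (e₀-suc κ))))) ⟩
        (s + pw (e (fromℕ n-1))) - (1# + s)
          ≈⟨ +-congʳ (+-congˡ (trans (reflexive (≡.cong pw e-last)) (*-identityʳ q))) ⟩
        (s + q) - (1# + s)
          ≈⟨ solve 2 (λ s q → (s :+ q) :- (con (+ 1) :+ s) := q :- con (+ 1)) refl s q ⟩
        q - 1#                                                   ∎
        where
        s : Carrier
        s = sum (λ κ → pw (e (inject₁ κ)))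

      Q-z̃ : ∀ j → sum (λ κ → Q n a j κ * z̃ κ) ≈ 1# - t
      Q-z̃ j = begin
        sum (λ κ → Q n a j κ * z̃ κ)
          ≈⟨ sum-cong (λ κ → trans (solve 3 (λ x y z → x :* (y :- z) := x :* y :- x :* z) refl (Q n a j κ) (pw (e κ)) (pw (e₀ κ)))
                                                               (+-cong (term κ) (-‿cong (term₀ κ)))) ⟩
        sum (λ κ → G (μ κ) - G₀ (λ₀ κ))                    ≈⟨ sum-difference (G ∘ μ) (G₀ ∘ λ₀) ⟩
        sum (G ∘ μ) - sum (G₀ ∘ λ₀)
          ≈⟨ +-cong (sum-permute G (permutation μ (aff n α′ (ℤ.- (α′ ℤ.* (α ℤ.- 1ℤ)))) (aff-inverse n {α} {α′} (α ℤ.- 1ℤ) αα′≡1) (aff-inverse′ n {α} {α′} (α ℤ.- 1ℤ) αα′≡1)))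
                                                                (-‿cong (sum-permute G₀ (permutation λ₀ (aff n α′ (ℤ.- (α′ ℤ.* 0ℤ))) (aff-inverse n {α} {α′} 0ℤ αα′≡1) (aff-inverse′ n {α} {α′} 0ℤ αα′≡1)))) ⟨
        sum G - sum G₀                                     ≈⟨ sum-difference G G₀ ⟨
        sum (λ i → G i - G₀ i)                             ≈⟨ sum-cong (λ i → cancel i (i Fin.≟ j)) ⟩
        sum (λ i → (1# - t) * δ i j)                       ≈⟨ sum-δʳ j (λ _ → 1# - t) ⟩
        1# - t                                             ∎
        where
        G G₀ : Vector Carrier n
        G i  = pw ((a ℤ.* (+ toℕ j ℤ.- + toℕ i)) /ℕ n)
        G₀ i = pw ((a ℤ.* (+ toℕ j ℤ.- + toℕ i) ℤ.- 1ℤ) /ℕ n)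
        term : ∀ κ → Q n a j κ * pw (e κ) ≈ G (μ κ)
        term κ = trans (sym (pw-+ (exponent n a j κ) (e κ))) (reflexive (≡.cong pw (exponent+e j κ)))
        term₀ : ∀ κ → Q n a j κ * pw (e₀ κ) ≈ G₀ (λ₀ κ)
        term₀ κ = trans (sym (pw-+ (exponent n a j κ) (e₀ κ))) (reflexive (≡.cong pw (exponent+e₀ j κ)))
        a[j-j]≡0 : a ℤ.* (+ toℕ j ℤ.- + toℕ j) ≡ 0ℤ
        a[j-j]≡0 = ≡.trans (≡.cong (a ℤ.*_) (ℤ.+-inverseʳ (+ toℕ j))) (ℤ.*-zeroʳ a)
        -- With `x = a (j - i)`, the floors of `x / n` and `(x - 1) / n` differ only if `n` divides
        -- `x`. As `a` is invertible this means `i = j`, where they are 0 and -1.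
        cancel : ∀ i → Dec (i ≡ j) → G i - G₀ i ≈ (1# - t) * δ i j
        cancel i (yes ≡.refl) = begin
          G i - G₀ i                     ≡⟨ ≡.cong (λ x → pw (x /ℕ n) - pw ((x ℤ.- 1ℤ) /ℕ n)) a[j-j]≡0 ⟩
          pw (0ℤ /ℕ n) - pw (-1ℤ /ℕ n)   ≡⟨ ≡.cong₂ (λ x y → pw x - pw y) (/ℕ-exact n 0ℤ) (-1/ℕn≡-1 n) ⟩
          1# - t * 1#
            ≈⟨ solve 1 (λ t → con (+ 1) :- t :* con (+ 1) := (con (+ 1) :- t) :* con (+ 1)) refl t ⟩
          (1# - t) * 1#                  ≡⟨ ≡.cong ((1# - t) *_) (δ-refl i) ⟨
          (1# - t) * δ i i               ∎
        cancel i (no i≢j) = begin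
          G i - G₀ i
            ≡⟨ ≡.cong (λ x → G i - pw x) (/ℕ-pred n (a ℤ.* (+ toℕ j ℤ.- + toℕ i)) (∤-difference i≢j)) ⟩
          G i - G i                      ≈⟨ -‿inverseʳ (G i) ⟩
          0#                             ≈⟨ zeroʳ (1# - t) ⟨
          (1# - t) * 0#                  ≡⟨ ≡.cong ((1# - t) *_) (δ-≢ i≢j) ⟨
          (1# - t) * δ i j               ∎

      sum-z : sum z ≈ q
      sum-z = begin
        sum z                       ≈⟨ *-distribˡ-sum (- (q * u)) z̃ ⟨
        - (q * u) * sum z̃           ≈⟨ *-congˡ sum-z̃ ⟩
        - (q * u) * (q - 1#)
          ≈⟨ solve 2 (λ q u → :- (q :* u) :* (q :- con (+ 1)) := q :* ((con (+ 1) :- q) :* u)) refl q u ⟩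
        q * ((1# - q) * u)          ≈⟨ *-congˡ [1-q]u≈1 ⟩
        q * 1#                      ≈⟨ *-identityʳ q ⟩
        q                           ∎

      Q-z : ∀ j → sum (λ κ → Q n a j κ * z κ) ≈ 1#
      Q-z j = begin
        sum (λ κ → Q n a j κ * (- (q * u) * z̃ κ))
          ≈⟨ sum-cong (λ κ → solve 3 (λ x y z → x :* (y :* z) := y :* (x :* z)) refl (Q n a j κ) (- (q * u)) (z̃ κ)) ⟩
        sum (λ κ → - (q * u) * (Q n a j κ * z̃ κ))     ≈⟨ *-distribˡ-sum (- (q * u)) (λ κ → Q n a j κ * z̃ κ) ⟨
        - (q * u) * sum (λ κ → Q n a j κ * z̃ κ)       ≈⟨ *-congˡ (Q-z̃ j) ⟩
        - (q * u) * (1# - t)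
          ≈⟨ solve 3 (λ q u t → :- (q :* u) :* (con (+ 1) :- t) := (q :* t) :* u :- q :* u) refl q u t ⟩
        (q * t) * u - q * u                           ≈⟨ +-congʳ (*-congʳ qt≈1) ⟩
        1# * u - q * u
          ≈⟨ solve 2 (λ q u → con (+ 1) :* u :- q :* u := (con (+ 1) :- q) :* u) refl q u ⟩
        (1# - q) * u                                  ≈⟨ [1-q]u≈1 ⟩
        1#                                            ∎

      Z : Matrix n
      Z κ k = δ κ k - z κ

      -- The column of ones is Q z, so the all-ones matrix is Q times the matrix whose columns all
      -- equal `z`.
      factorisation : ∀ j k → qInteger (exponent n a j k) ≈ - u * (Q n a · Z) j k
      factorisation j k = begin
        (1# - Q n a j k) * u
          ≈⟨ solve 2 (λ x u → (con (+ 1) :- x) :* u := :- u :* (x :- con (+ 1))) refl (Q n a j k) u ⟩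
        - u * (Q n a j k - 1#)          ≈⟨ *-congˡ (+-cong (sum-δʳ k (Q n a j)) (-‿cong (Q-z j))) ⟨
        - u * (sum (λ κ → Q n a j κ * δ κ k) - sum (λ κ → Q n a j κ * z κ))
          ≈⟨ *-congˡ (sum-difference (λ κ → Q n a j κ * δ κ k) (λ κ → Q n a j κ * z κ)) ⟨
        - u * sum (λ κ → Q n a j κ * δ κ k - Q n a j κ * z κ)
          ≈⟨ *-congˡ (sum-cong λ κ → solve 3 (λ x y z → x :* (y :- z) := x :* y :- x :* z) refl (Q n a j κ) (δ κ k) (z κ)) ⟨
        - u * (Q n a · Z) j k           ∎

      product-const : ∀ m x → product {m} (λ _ → x) ≈ x ^ m
      product-const zero    x = refl
      product-const (suc m) x = *-congˡ (product-const m x)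

      -u[1-t]≈t : - u * (1# - t) ≈ t
      -u[1-t]≈t = begin
        - u * (1# - t)              ≈⟨ solve 2 (λ u t → :- u :* (con (+ 1) :- t) := t :* u :- con (+ 1) :* u) refl u t ⟩
        t * u - 1# * u              ≈⟨ +-congˡ (-‿cong (*-congʳ qt≈1)) ⟨
        t * u - (q * t) * u
          ≈⟨ solve 3 (λ u t q → t :* u :- (q :* t) :* u := t :* ((con (+ 1) :- q) :* u)) refl u t q ⟩
        t * ((1# - q) * u)          ≈⟨ *-congˡ [1-q]u≈1 ⟩
        t * 1#                      ≈⟨ *-identityʳ t ⟩
        t                           ∎

    -- Of the `n` factors `- u`, one meets `det Z`, which is `1# - q`, and yields the sign -1; each
    -- of the others meets a factor `1# - t` of the step determinant and yields `t`. Together with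
    -- the exponent `- (n + 1) / 2` from the scaling this gives
    -- `- (n + 1) / 2 - (n - 1) = (1 - 3 n) / 2`.
    det-coprime : Odd n → det (λ j k → qInteger (exponent n a j k)) ≈
                  - ((sgn (aff n a 0ℤ) * sgn (aff n (a ℤ.+ 1ℤ) 0ℤ)) * pw ((1ℤ ℤ.- + 3 ℤ.* + n) /ℕ 2))
    det-coprime n-odd = begin
      det (λ j k → qInteger (exponent n a j k))          ≈⟨ det-cong factorisation ⟩
      det (λ j k → - u * (Q n a · Z) j k)                ≈⟨ det-scale-rows (λ _ → - u) (Q n a · Z) ⟩
      product {n} (λ _ → - u) * det (Q n a · Z)
        ≈⟨ *-cong (product-const n (- u)) (trans (det-· (Q n a) Z) (*-cong (det-Q n a n-odd) (trans (det-δ-rank-one z) (+-congˡ (-‿cong sum-z))))) ⟩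
      (- u * (- u) ^ n-1) * ((pw N * (sg * det (step-matrix {n} t))) * (1# - q))
        ≈⟨ *-congˡ (*-congʳ (*-congˡ (*-congˡ (det-step-matrix n-1 t)))) ⟩
      (- u * (- u) ^ n-1) * ((pw N * (sg * (1# - t) ^ n-1)) * (1# - q))
        ≈⟨ solve 6 (λ u v w s y q → (:- u :* v) :* ((w :* (s :* y)) :* (con (+ 1) :- q)) := :- (((con (+ 1) :- q) :* u) :* (s :* (w :* (v :* y))))) refl u ((- u) ^ n-1) (pw N) sg ((1# - t) ^ n-1) q ⟩
      - (((1# - q) * u) * (sg * (pw N * ((- u) ^ n-1 * (1# - t) ^ n-1))))
        ≈⟨ -‿cong (trans (*-congʳ [1-q]u≈1) (*-identityˡ _)) ⟩
      - (sg * (pw N * ((- u) ^ n-1 * (1# - t) ^ n-1)))    ≈⟨ -‿cong (*-congˡ (*-congˡ power)) ⟩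
      - (sg * (pw N * pw (ℤ.- + n-1)))
        ≈⟨ -‿cong (*-congˡ (trans (sym (pw-+ N (ℤ.- + n-1))) (reflexive (≡.cong pw N-exponent)))) ⟩
      - (sg * pw ((1ℤ ℤ.- + 3 ℤ.* + n) /ℕ 2))             ∎
      where
      N : ℤ
      N = Σquotients a ℤ.- Σquotients (a ℤ.+ 1ℤ)
      sg : Carrier
      sg = sgn (aff n a 0ℤ) * sgn (aff n (a ℤ.+ 1ℤ) 0ℤ)
      power : (- u) ^ n-1 * (1# - t) ^ n-1 ≈ pw (ℤ.- + n-1)
      power = trans (sym (^-distrib-* (- u) (1# - t) n-1)) (trans (^-congˡ n-1 -u[1-t]≈t) (sym (pw-neg n-1)))
      lemma : ∀ N m → (N ℤ.+ ℤ.- m) ℤ.* + 2 ≡ N ℤ.* + 2 ℤ.- m ℤ.* + 2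
      lemma = solve-∀
      lemma′ : ∀ m → ℤ.- (1ℤ ℤ.+ m ℤ.+ 1ℤ) ℤ.- m ℤ.* + 2 ≡ 1ℤ ℤ.- + 3 ℤ.* (1ℤ ℤ.+ m)
      lemma′ = solve-∀
      -- Twice the left-hand side is `1 - 3 n`, so the floor division by 2 is exact.
      N-exponent : N ℤ.+ ℤ.- + n-1 ≡ (1ℤ ℤ.- + 3 ℤ.* + n) /ℕ 2
      N-exponent = ≡.sym (≡.trans (≡.cong (_/ℕ 2) (≡.sym (≡.trans (lemma N (+ n-1)) (≡.trans (≡.cong (ℤ._- + n-1 ℤ.* + 2) (Σquotients-difference a (b , ab≡1) (b′ , ab′≡1))) (lemma′ (+ n-1))))))
        (/ℕ-exact 2 (N ℤ.+ ℤ.- + n-1)))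

  -- If `a` or `a + 1` shares a prime factor with `n`, both sides vanish; otherwise both are
  -- invertible modulo `n` and `det-coprime` applies.
  det-floor : ∀ a n .{{_ : NonZero n}} → n ℕ.% 2 ≡ 1 → det (λ j k → qInteger (exponent n a j k)) ≈
              - (sgn (aff n (a ℤ.* (a ℤ.+ 1ℤ)) 0ℤ) * pw ((1ℤ ℤ.- + 3 ℤ.* + n) /ℕ 2))
  det-floor a n@(suc n-1) odd = trans (by-cases (commonFactor-or-invertible a n odd) (commonFactor-or-invertible (a ℤ.+ 1ℤ) n odd))
    (-‿cong (*-congʳ (sym (sgn-aff-* n a (a ℤ.+ 1ℤ)))))
    where
    s s′ : Carrier
    s = sgn (aff n a 0ℤ)
    s′ = sgn (aff n (a ℤ.+ 1ℤ) 0ℤ)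
    vanishing : ∀ x → s * s′ ≈ 0# → 0# ≈ - ((s * s′) * x)
    vanishing x ss′≈0 = sym (trans (-‿cong (trans (*-congʳ ss′≈0) (zeroˡ x))) -0#≈0#)
    by-cases : CommonFactor a n ⊎ Invertible a n → CommonFactor (a ℤ.+ 1ℤ) n ⊎ Invertible (a ℤ.+ 1ℤ) n →
               det (λ j k → qInteger (exponent n a j k)) ≈ - ((s * s′) * pw ((1ℤ ℤ.- + 3 ℤ.* + n) /ℕ 2))
    by-cases (inj₁ common) _ = trans (det-commonFactorˡ n a common) (vanishing _ (trans (*-congʳ (sgn-commonFactor n a common)) (zeroˡ s′)))
    by-cases (inj₂ _) (inj₁ common) = trans (det-commonFactorʳ n a common) (vanishing _ (trans (*-congˡ (sgn-commonFactor n (a ℤ.+ 1ℤ) common)) (zeroʳ s)))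
    by-cases (inj₂ (b , ab≡1)) (inj₂ (b′ , ab′≡1)) = det-coprime n-1 a b b′ ab≡1 ab′≡1 (%2≡1⇒odd odd)

-- Transfer to Heyting fields.

theorem1p1 : ∀ {c ℓ₁ ℓ₂ : Level} (K : HeytingField c ℓ₁ ℓ₂) →
    let open HeytingField K
        open FieldOps K
    in
    (a : ℤ) (n : ℕ) .{{_ : NonZero n}} → n % 2 ≡ 1 →
    (q : Carrier) (q#0 : q # 0#) (q#1 : q # 1#) →
    det (λ (j k : Fin n) →
      qInt q q#0 q#1
        ((a ℤ.* + suc (toℕ j) ℤ.- (a ℤ.+ 1ℤ) ℤ.* + suc (toℕ k)) /ℕ n))
    ≈ - (fromℤ (jacobi (a ℤ.* (a ℤ.+ 1ℤ)) n)
          * pow q q#0 ((1ℤ ℤ.- + 3 ℤ.* + n) /ℕ 2))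
theorem1p1 K a n odd q q#0 q#1 = begin
  det (λ j k → qInt q q#0 q#1 (exponent n a j k))
    ≈⟨ det-cong (λ j k → *-congʳ (+-congˡ (-‿cong (pow≈pw (exponent n a j k))))) ⟩
  det (λ j k → qInteger (exponent n a j k))          ≈⟨ det-floor a n odd ⟩
  - (sgn (aff n (a ℤ.* (a ℤ.+ 1ℤ)) 0ℤ) * pw x)
    ≈⟨ -‿cong (*-cong (represents⇒fromℤ (sgn-aff-jacobi (a ℤ.* (a ℤ.+ 1ℤ)) n odd)) (sym (pow≈pw x))) ⟩
  - (fromℤ (jacobi (a ℤ.* (a ℤ.+ 1ℤ)) n) * pow q q#0 x) ∎
  where
  open HeytingField K using (#⇒invertible; #-sym; heytingCommutativeRing)
  open FieldOps K using (fromℤ; inv; pow; qInt)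
  R : CommutativeRing _ _
  R = HeytingCommutativeRing.commutativeRing heytingCommutativeRing
  open CommutativeRing R
  open RingProperties ring using (-0#≈0#)
  open SetoidReasoning setoid

  x : ℤ
  x = (1ℤ ℤ.- + 3 ℤ.* + n) /ℕ 2

  q*inv≈1 : q * inv q#0 ≈ 1#
  -- Apartness provides the inverse of the difference `q - 0#`.
  q*inv≈1 = trans (*-congʳ (sym (trans (+-congˡ -0#≈0#) (+-identityʳ q)))) (proj₂ (proj₂ (#⇒invertible q#0)))

  parameter : Parameter R
  parameter = record
    { q        = q
    ; t        = inv q#0
    ; u        = inv (#-sym q#1)
    ; qt≈1     = q*inv≈1
    ; [1-q]u≈1 = proj₂ (proj₂ (#⇒invertible (#-sym q#1)))
    }

  open FloorDeterminant R parameter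

  pow≈pw : ∀ i → pow q q#0 i ≈ pw i
  pow≈pw (+ _)    = refl
  pow≈pw -[1+ _ ] = refl

  represents⇒fromℤ : ∀ {y i} → Represents y i → y ≈ fromℤ i
  represents⇒fromℤ (rep-0 y≈0)   = y≈0
  -- `fromℤ` uses the unoptimised multiple, for which `1 × 1#` is `1# + 0#`.
  represents⇒fromℤ (rep-1 y≈1)   = trans y≈1 (sym (+-identityʳ 1#))
  represents⇒fromℤ (rep--1 y≈-1) = trans y≈-1 (-‿cong (sym (+-identityʳ 1#)))
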